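{- Let $v\le w$ be elements of $I(d)$ and $m\ge0$ an integer. The set of standard monomials in $I(d)$ of degree $m$ that are $w$-dominated and $v$-compatible is in bijection with the set of monomials in $OR_v$ of degree $m$ that are $O$-dominated by $w$.
   Context: $k^*:=2d+1-k$. $I(d,2d)$ is the set of $d$-element subsets of $\{1,\dots,2d\}$ written increasingly, ordered by $u\le w$ iff $u_i\le w_i$ for all $i$; $I(d)$ consists of those $u$ containing exactly one of $k,k^*$ for each $k$ and having an even number of entries exceeding $d$. A standard monomial in $I(d)$ is a sequence $\theta_1\ge\dots\ge\theta_t$ in $I(d)$; it is $w$-dominated if $w\ge\theta_1$ and $v$-compatible if each $\theta_k$ satisfies $\theta_k>v$ or $v>\theta_k$ (strictly). The $v$-degree of $\theta$ is $\frac12|v\setminus\theta|$, and the degree of a standard monomial is the sum of the $v$-degrees of its members. $R_v=\{(r,c):1\le r,c\le2d,\ r\notin v,\ c\in v\}$, $N_v=\{(r,c)\in R_v:r>c\}$, $OR_v=\{(r,c)\in R_v:r<c^*\}$, $ON_v=N_v\cap OR_v$. A monomial in a set is a finite multiset; its degree is the sum of multiplicities. $(R,C)>(r,c)$ means $R>r$ and $C<c$; a $v$-chain is a sequence $\alpha_1>\dots>\alpha_\ell$ in $ON_v$. For $\alpha=(r,c)$: $p_v(\alpha)=(c^*,c)$, $p_h(\alpha)=(r,r^*)$, $\alpha^\#=(c^*,r^*)$. Consecutive $\alpha_j=(r_j,c_j)$, $\alpha_{j+1}=(r_{j+1},c_{j+1})$ are connected if $r_j\le c_{j+1}^*$ and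 $r_{j+1}>r_j^*$; connected components are classes of the generated equivalence relation. For a connected $v$-chain $C:\alpha_1>\dots>\alpha_\ell$ with $\alpha_\ell=(r_\ell,c_\ell)$: $S_C=\{p_v(\alpha_i)\}_{i\le\ell}$ if $\ell$ even; $\{p_v(\alpha_i)\}_{i\le\ell}\cup\{p_h(\alpha_\ell)\}$ if $\ell$ odd and $r_\ell>r_\ell^*$; $\{p_v(\alpha_i)\}_{i<\ell}\cup\{\alpha_\ell,\alpha_\ell^\#\}$ if $\ell$ odd and $r_\ell<r_\ell^*$; for general $C$, $S_C$ is the union over its connected components. $w(C)$ is obtained from $v$ by removing the column indices and adding the row indices of the elements of $S_C$. $w\in I(d)$ $O$-dominates $C$ if $w\ge w(C)$, and $O$-dominates a monomial $S$ in $OR_v$ if it $O$-dominates every $v$-chain all of whose elements lie in $S\cap ON_v$. -}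

module Defs where

open import Data.Nat using (ℕ; zero; suc; _+_; _∸_; _≤_; _<_; _≤ᵇ_; _<ᵇ_; _≡ᵇ_; ⌊_/2⌋)
open import Data.Nat.DivMod using (_%_)
open import Data.Bool using (Bool; true; false; _∧_; _∨_; not; if_then_else_)
open import Data.List using (List; []; _∷_; _++_; map; length; filterᵇ; upTo; concatMap)
open import Data.Bool.ListAction using (any)
open import Data.Nat.ListAction using (sum)
open import Data.List.Membership.Propositional using (_∈_; _∉_)
open import Data.List.Relation.Unary.All using (All)
open import Data.List.Relation.Unary.Linked using (Linked)
open import Data.List.Relation.Binary.Pointwise using (Pointwise)
open import Data.Product using (Σ; _×_; _,_; proj₁; proj₂)
open import Data.Sum using (_⊎_)
open import Data.Unit using (⊤)
open import Data.Vec as Vec using (Vec)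
open import Relation.Binary.PropositionalEquality using (_≡_; _≢_)

star : ℕ → ℕ → ℕ
star d k = suc (d + d) ∸ k

InRange : ℕ → ℕ → Set
InRange d k = 1 ≤ k × k ≤ d + d

elemᵇ : ℕ → List ℕ → Bool
elemᵇ x u = any (x ≡ᵇ_) u

-- I(d,2d): d-element subsets of {1..2d}, written increasingly

IsI2d : ℕ → List ℕ → Set
IsI2d d u = Linked _<_ u × All (InRange d) u × length u ≡ d

_≼_ : List ℕ → List ℕ → Set
u ≼ w = Pointwise _≤_ u w

_≺_ : List ℕ → List ℕ → Set
u ≺ w = u ≼ w × u ≢ w

InI : ℕ → List ℕ → Set
InI d u =
  IsI2d d u ×
  (∀ k → InRange d k → (k ∈ u × star d k ∉ u) ⊎ (k ∉ u × star d k ∈ u)) ×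
  length (filterᵇ (d <ᵇ_) u) % 2 ≡ 0

StandardMonomial : ℕ → List (List ℕ) → Set
StandardMonomial d θs = All (InI d) θs × Linked (λ a b → b ≼ a) θs

WDominated : List ℕ → List (List ℕ) → Set
WDominated w [] = ⊤
WDominated w (θ ∷ _) = θ ≼ w

VCompatible : List ℕ → List (List ℕ) → Set
VCompatible v θs = All (λ θ → v ≺ θ ⊎ θ ≺ v) θs

diffCard : List ℕ → List ℕ → ℕ
diffCard v θ = length (filterᵇ (λ x → not (elemᵇ x θ)) v)

vDegree : List ℕ → List ℕ → ℕ
vDegree v θ = ⌊ diffCard v θ /2⌋

degree : List ℕ → List (List ℕ) → ℕ
degree v θs = sum (map (vDegree v) θs)

Pair : Set
Pair = ℕ × ℕ

InR : ℕ → List ℕ → Pair → Set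
InR d v (r , c) = InRange d r × InRange d c × r ∉ v × c ∈ v

InOR : ℕ → List ℕ → Pair → Set
InOR d v (r , c) = InR d v (r , c) × r < star d c

InON : ℕ → List ℕ → Pair → Set
InON d v (r , c) = InOR d v (r , c) × c < r

-- Monomials (finite multisets) in pairs (r,c), 1 ≤ r,c ≤ 2d, encoded
-- canonically as a 2d × 2d matrix of multiplicities: row r-1, column c-1.

Monomial : ℕ → Set
Monomial d = Vec (Vec ℕ (d + d)) (d + d)

vat : ∀ {n} → Vec ℕ n → ℕ → ℕ
vat Vec.[] _ = 0
vat (x Vec.∷ xs) zero = x
vat (x Vec.∷ xs) (suc i) = vat xs i

-- multiplicity of (r,c) (1-based; 0 outside the range)
mult : ∀ {m n} → Vec (Vec ℕ n) m → Pair → ℕ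
mult M (suc r , suc c) = vat (Vec.map (λ row → vat row c) M) r
mult M _ = 0

mdegree : ∀ {m n} → Vec (Vec ℕ n) m → ℕ
mdegree M = Vec.sum (Vec.map Vec.sum M)

OMonomial : (d : ℕ) → List ℕ → ℕ → Monomial d → Set
OMonomial d v m M = (∀ α → mult M α ≢ 0 → InOR d v α) × mdegree M ≡ m

_⋗_ : Pair → Pair → Set
(R , C) ⋗ (r , c) = r < R × C < c

VChain : ℕ → List ℕ → List Pair → Set
VChain d v ch = Linked _⋗_ ch × All (InON d v) ch

connectedᵇ : ℕ → Pair → Pair → Bool
connectedᵇ d (r , c) (r' , c') = (r ≤ᵇ star d c') ∧ (star d r <ᵇ r')

attach : Bool → Pair → List (List Pair) → List (List Pair)
attach true a (C ∷ Cs) = (a ∷ C) ∷ Cs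
attach _ a Cs = (a ∷ []) ∷ Cs

-- connected components: since only consecutive elements are related, the
-- classes of the generated equivalence relation are the maximal runs of
-- consecutive connected elements.
components : ℕ → List Pair → List (List Pair)
components d [] = []
components d (a ∷ []) = (a ∷ []) ∷ []
components d (a ∷ b ∷ rest) = attach (connectedᵇ d a b) a (components d (b ∷ rest))

pv : ℕ → Pair → Pair
pv d (r , c) = (star d c , c)

ph : ℕ → Pair → Pair
ph d (r , c) = (r , star d r)

sharp : ℕ → Pair → Pair
sharp d (r , c) = (star d c , star d r)

initLast : Pair → List Pair → List Pair × Pair
initLast a [] = ([] , a)
initLast a (b ∷ bs) = (a ∷ proj₁ (initLast b bs) , proj₂ (initLast b bs))

SConn : ℕ → List Pair → List Pair
SConn d [] = []
SConn d (a ∷ as) =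
  if length (a ∷ as) % 2 ≡ᵇ 0
  then map (pv d) (a ∷ as)
  else (let il = initLast a as ; ini = proj₁ il ; lst = proj₂ il in
        if star d (proj₁ lst) <ᵇ proj₁ lst
        then map (pv d) (a ∷ as) ++ (ph d lst ∷ [])
        else map (pv d) ini ++ (lst ∷ sharp d lst ∷ []))

SChain : ℕ → List Pair → List Pair
SChain d C = concatMap (SConn d) (components d C)

wOf : ℕ → List ℕ → List Pair → List ℕ
wOf d v C =
  filterᵇ (λ x → (elemᵇ x v ∧ not (elemᵇ x cols)) ∨ elemᵇ x rows)
          (map suc (upTo (d + d)))
  where
  cols = map proj₂ (SChain d C)
  rows = map proj₁ (SChain d C)

ODominatesChain : ℕ → List ℕ → List ℕ → List Pair → Set
ODominatesChain d v w C = wOf d v C ≼ w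

ODominates : (d : ℕ) → List ℕ → List ℕ → Monomial d → Set
ODominates d v w M =
  ∀ C → VChain d v C → All (λ α → mult M α ≢ 0) C → ODominatesChain d v w C

SetBijection : {A B : Set} → (A → Set) → (B → Set) → Set
SetBijection {A} {B} P Q =
  Σ (A → B) λ f →
    (∀ a → P a → Q (f a)) ×
    (∀ a a' → P a → P a' → f a ≡ f a' → a ≡ a') ×
    (∀ b → Q b → Σ A λ a → P a × f a ≡ b)

{-# OPTIONS --safe #-}
module Submission where

-- An element of I(d) is determined by its members k ≤ d, hence by d bits; those of v cut the triangle of pairs p < q ≤ d
-- into rows, which carry ON_v when p ∈ v and its mirror image, for the complement of v, when p ∉ v. Elements of I(d)
-- above and below v contribute to the two parts independently, so only the part above v needs an argument.
--
-- There one step of the correspondence is Viennot's shadow construction, adapted to symmetric matrices: sweep a lattice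
-- path over the cells, letting a line start at each occupied cell, two lines that meet annihilate, and lines reflect on
-- the diagonal. Each cell is an involution, so a monomial S corresponds to the set of lines leaving along the last path,
-- that is an element θ of I(d), together with a residual monomial S′, and deg S = deg S′ + (v-degree of θ). In terms of
-- heights the sweep is the recursion max(h01, h10, h00 + [a > 0]), rounded up to even numbers on the diagonal, and the
-- backward sweep is the adjoint recursion with min; therefore (θ , S′) comes from some S exactly if θ dominates the
-- element attached to S′, and iterating gives θ₁ ≥ θ₂ ≥ … with θ₁ attached to S.
--
-- It remains to see that w dominates θ₁ exactly if it O-dominates S. The sweep of a single chain C produces w(C), and it
-- is monotone in the support; conversely, following the minima of the backward sweep started from w traces out a chain
-- in S on which the heights are as low as for S itself.

open import Defs
open import Data.Bool as B using (Bool; true; false; not; _xor_; if_then_else_; _∧_; _∨_; T; T?)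
open import Data.Bool.Properties
  using (not-involutive; xor-assoc; xor-same; xor-annihilates-not; ∨-zeroʳ; ∨-identityʳ; ∨-assoc;
    not-distribˡ-xor; not-distribʳ-xor)
open import Data.Empty using (⊥; ⊥-elim)
open import Data.List using (List; []; _∷_; map; _++_; concat; concatMap; length; filterᵇ; filter; upTo; reverse)
open import Data.List.Membership.Propositional using (_∈_; _∉_)
open import Data.List.Membership.Propositional.Properties
  using (∈-map⁻; ∈-map⁺; ∈-++⁺ˡ; ∈-++⁺ʳ; ∈-++⁻; ∈-filter⁺; ∈-filter⁻; ∈-upTo⁺; ∈-upTo⁻)
open import Data.List.Properties
  using (++-assoc; map-++; map-∘; map-id; ++-identityʳ; filter-++; length-++; map-cong; filter-all;
    filter-none; reverse-involutive; unfold-reverse; reverse-map)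
open import Data.List.Relation.Binary.Permutation.Propositional.Properties using (↭-reverse; ∈-resp-↭)
open import Data.List.Relation.Binary.Pointwise using ([]; _∷_)
open import Data.List.Relation.Unary.All as All using (All; []; _∷_)
open import Data.List.Relation.Unary.All.Properties as All using (++⁺; map⁺; ++⁻ˡ)
open import Data.List.Relation.Unary.AllPairs as AllPairs using (AllPairs; []; _∷_)
import Data.List.Relation.Unary.AllPairs.Properties as AllPairs
open import Data.List.Relation.Unary.Any using (here; there)
open import Data.List.Relation.Unary.Linked as Linked using (Linked; []; [-]; _∷_)
open import Data.List.Relation.Unary.Linked.Properties as Linked using (Linked⇒AllPairs; AllPairs⇒Linked)
open import Data.Nat using (ℕ; zero; suc; _+_; _≤_; _<_; z≤n; s≤s; ⌊_/2⌋; _≡ᵇ_; _∸_; _≤ᵇ_; _<ᵇ_)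
open import Data.Nat.DivMod using (_%_)
open import Data.Nat.ListAction using (sum)
open import Data.Nat.ListAction.Properties using (sum-++; sum-↭)
open import Data.Nat.Properties
open import Data.Nat.Solver using (module +-*-Solver)
open import Data.Product using (Σ; _×_; _,_; proj₁; proj₂)
open import Data.Sum as Sum using (_⊎_; inj₁; inj₂)
open import Data.Unit using (⊤; tt)
open import Data.Vec as Vec using (Vec; []; _∷_; replicate; zipWith; _∷ʳ_; toList)
open import Data.Vec.Properties as VecP using (∷-injective; ≡-dec; map-∷ʳ; toList-∷ʳ; length-toList)
open import Function using (_∘_)
open import Relation.Binary.Definitions using (tri<; tri≈; tri>)
open import Relation.Binary.PropositionalEquality
open import Relation.Nullary using (¬_; yes; no; Dec; ¬?)

-- A lattice path is a word of bits and a line crossing one of its steps flips that bit, so the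
-- labels along the last path, added to `b`, are an element of I(d). The obstacle is the diagonal:
-- rounding respects the order of two heights only if they have the same parity. Hence the
-- comparisons carry the invariant that `odd δ` is the parity of the difference of the remaining
-- words. Cells preserve it because lines are born and annihilated in pairs, and it holds initially
-- because all elements of I(d) have an even number of entries exceeding d. Surjectivity rests on
-- the adjunction. A backward sweep can always be run, but it comes from a monomial only if no line
-- is left at the end. `zeros` is the largest word of labels, so a lower bound by `zeros` already
-- means that all labels vanish, and the adjunction turns domination of the outgoing word into this
-- bound. The same device reduces domination to chains. A word vanishes as soon as the number of its
-- true entries does, so the backward sweep from w leaves one number to control, and one chain
-- suffices for it instead of one for each position of the word.

Bits : ℕ → Set
Bits = Vec Bool

infixl 6 _⊕_
_⊕_ : ∀ {n} → Bits n → Bits n → Bits n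
_⊕_ = zipWith _xor_

zeros : ∀ {n} → Bits n
zeros = replicate _ false

⟦_⟧ : Bool → ℕ
⟦ true ⟧ = 1
⟦ false ⟧ = 0

par : ∀ {n} → Bits n → Bool
par [] = false
par (x ∷ u) = x xor par u

ones : ∀ {n} → Bits n → ℕ
ones [] = 0
ones (x ∷ u) = ⟦ x ⟧ + ones u

odd : ℕ → Bool
odd zero = false
odd (suc n) = not (odd n)

ones-par : ∀ {n} (u : Bits n) → odd (ones u) ≡ par u
ones-par [] = refl
ones-par (true ∷ u) = cong not (ones-par u)
ones-par (false ∷ u) = ones-par u

-- Viennot's shadow lines at one cell. The arguments tell whether a line enters along either side and the
-- multiplicity of the cell; cellC and cellL tell whether a line leaves, cellA is the residual multiplicity.
cellC : Bool → Bool → ℕ → Bool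
cellC true _ _ = false
cellC false true _ = true
cellC false false zero = false
cellC false false (suc _) = true

cellL : Bool → Bool → ℕ → Bool
cellL true true _ = false
cellL true false _ = true
cellL false true _ = false
cellL false false zero = false
cellL false false (suc _) = true

cellA : Bool → Bool → ℕ → ℕ
cellA true true a = suc a
cellA true false a = a
cellA false true a = a
cellA false false zero = zero
cellA false false (suc a) = a

cellC-involutive : ∀ i k a → cellC (cellC i k a) (cellL i k a) (cellA i k a) ≡ i
cellC-involutive true true a = refl
cellC-involutive true false a = refl
cellC-involutive false true a = refl
cellC-involutive false false zero = refl
cellC-involutive false false (suc a) = refl

cellL-involutive : ∀ i k a → cellL (cellC i k a) (cellL i k a) (cellA i k a) ≡ k
cellL-involutive true true a = refl
cellL-involutive true false a = refl
cellL-involutive false true a = refl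
cellL-involutive false false zero = refl
cellL-involutive false false (suc a) = refl

cellA-involutive : ∀ i k a → cellA (cellC i k a) (cellL i k a) (cellA i k a) ≡ a
cellA-involutive true true a = refl
cellA-involutive true false a = refl
cellA-involutive false true a = refl
cellA-involutive false false zero = refl
cellA-involutive false false (suc a) = refl

cell-xor : ∀ i k a → cellC i k a xor cellL i k a ≡ i xor k
cell-xor true true a = refl
cell-xor true false a = refl
cell-xor false true a = refl
cell-xor false false zero = refl
cell-xor false false (suc a) = refl

-- Heights are well defined: the two ways around the cell, from the corner between the incoming
-- edges to the opposite corner, have the same total increment.
cell-flow : ∀ i k a → ⟦ i ⟧ + ⟦ cellC i k a ⟧ ≡ ⟦ k ⟧ + ⟦ cellL i k a ⟧
cell-flow true true a = refl
cell-flow true false a = refl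
cell-flow false true a = refl
cell-flow false false zero = refl
cell-flow false false (suc a) = refl

-- A line counts one and a unit of multiplicity two: a birth turns one unit into two lines, an
-- annihilation turns two lines back into one unit.
cell-degree : ∀ i k a → ⟦ i ⟧ + (⟦ k ⟧ + (a + a)) ≡
  ⟦ cellC i k a ⟧ + (⟦ cellL i k a ⟧ + (cellA i k a + cellA i k a))
cell-degree true true a = cong suc (sym (+-suc a a))
cell-degree true false a = refl
cell-degree false true a = refl
cell-degree false false zero = refl
cell-degree false false (suc a) = cong suc (+-suc a a)

-- A row is swept from its last cell; the half cell on the diagonal reflects the last label into the row.
rowC : ∀ {n} → Vec ℕ n → Bits (suc n) → Bool
rowC [] (l ∷ _) = l
rowC (a ∷ as) (i ∷ ls) = cellC i (rowC as ls) a

rowL : ∀ {n} → Vec ℕ n → Bits (suc n) → Bits n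
rowL [] _ = []
rowL (a ∷ as) (i ∷ ls) = cellL i (rowC as ls) a ∷ rowL as ls

rowA : ∀ {n} → Vec ℕ n → Bits (suc n) → Vec ℕ n
rowA [] _ = []
rowA (a ∷ as) (i ∷ ls) = cellA i (rowC as ls) a ∷ rowA as ls

-- Undoes a row from its first cell on: the cell rule is an involution, so the same rule applies
-- again, and the carry arriving at the diagonal becomes the last label.
rowU : ∀ {n} → Vec ℕ n → Bool → Bits n → Bits (suc n)
rowU [] c _ = c ∷ []
rowU (a ∷ as) c (l ∷ ls) = cellC c l a ∷ rowU as (cellL c l a) ls

rowB : ∀ {n} → Vec ℕ n → Bool → Bits n → Vec ℕ n
rowB [] c _ = []
rowB (a ∷ as) c (l ∷ ls) = cellA c l a ∷ rowB as (cellL c l a) ls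

rowC-rowU : ∀ {n} (a : Vec ℕ n) c l → rowC (rowB a c l) (rowU a c l) ≡ c
rowC-rowU [] c l = refl
rowC-rowU (a ∷ as) c (l ∷ ls)
  rewrite rowC-rowU as (cellL c l a) ls = cellC-involutive c l a

rowL-rowU : ∀ {n} (a : Vec ℕ n) c l → rowL (rowB a c l) (rowU a c l) ≡ l
rowL-rowU [] c [] = refl
rowL-rowU (a ∷ as) c (l ∷ ls)
  rewrite rowC-rowU as (cellL c l a) ls = cong₂ _∷_ (cellL-involutive c l a) (rowL-rowU as _ ls)

rowA-rowU : ∀ {n} (a : Vec ℕ n) c l → rowA (rowB a c l) (rowU a c l) ≡ a
rowA-rowU [] c [] = refl
rowA-rowU (a ∷ as) c (l ∷ ls)
  rewrite rowC-rowU as (cellL c l a) ls = cong₂ _∷_ (cellA-involutive c l a) (rowA-rowU as _ ls)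

rowU-row : ∀ {n} (a : Vec ℕ n) ls → rowU (rowA a ls) (rowC a ls) (rowL a ls) ≡ ls
rowU-row [] (l ∷ []) = refl
rowU-row (a ∷ as) (i ∷ ls)
  rewrite cellL-involutive i (rowC as ls) a =
    cong₂ _∷_ (cellC-involutive i (rowC as ls) a) (rowU-row as ls)

rowB-row : ∀ {n} (a : Vec ℕ n) ls → rowB (rowA a ls) (rowC a ls) (rowL a ls) ≡ a
rowB-row [] (l ∷ []) = refl
rowB-row (a ∷ as) (i ∷ ls)
  rewrite cellL-involutive i (rowC as ls) a =
    cong₂ _∷_ (cellA-involutive i (rowC as ls) a) (rowB-row as ls)

row-par : ∀ {n} (a : Vec ℕ n) ls → par (rowC a ls ∷ rowL a ls) ≡ par ls
row-par [] (l ∷ []) = refl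
row-par (a ∷ as) (i ∷ ls) = begin
    cellC i k a xor (cellL i k a xor par (rowL as ls)) ≡⟨ xor-assoc (cellC i k a) _ _ ⟨
    (cellC i k a xor cellL i k a) xor par (rowL as ls) ≡⟨ cong (_xor par (rowL as ls)) (cell-xor i k a) ⟩
    (i xor k) xor par (rowL as ls) ≡⟨ xor-assoc i k _ ⟩
    i xor (k xor par (rowL as ls)) ≡⟨ cong (i xor_) (row-par as ls) ⟩
    i xor par ls ∎
  where open ≡-Reasoning
        k = rowC as ls

double-+ : ∀ a s → (a + s) + (a + s) ≡ (a + a) + (s + s)
double-+ a s = begin
    (a + s) + (a + s) ≡⟨ +-assoc a s (a + s) ⟩
    a + (s + (a + s)) ≡⟨ cong (a +_) (sym (+-assoc s a s)) ⟩
    a + ((s + a) + s) ≡⟨ cong (λ x → a + (x + s)) (+-comm s a) ⟩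
    a + ((a + s) + s) ≡⟨ cong (a +_) (+-assoc a s s) ⟩
    a + (a + (s + s)) ≡⟨ sym (+-assoc a a (s + s)) ⟩
    (a + a) + (s + s) ∎
  where open ≡-Reasoning

row-degree : ∀ {n} (a : Vec ℕ n) ls → ones ls + (Vec.sum a + Vec.sum a) ≡
  ones (rowC a ls ∷ rowL a ls) + (Vec.sum (rowA a ls) + Vec.sum (rowA a ls))
row-degree [] (l ∷ []) = refl
row-degree (a ∷ as) (i ∷ ls) = begin
    ⟦ i ⟧ + ones ls + ((a + s) + (a + s)) ≡⟨ cong (⟦ i ⟧ + ones ls +_) (double-+ a s) ⟩
    ⟦ i ⟧ + ones ls + ((a + a) + (s + s)) ≡⟨ shuffle ⟦ i ⟧ (ones ls) (a + a) (s + s) ⟩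
    ⟦ i ⟧ + ((a + a) + (ones ls + (s + s))) ≡⟨ cong (λ x → ⟦ i ⟧ + ((a + a) + x)) (row-degree as ls) ⟩
    ⟦ i ⟧ + ((a + a) + (⟦ k ⟧ + o + (s' + s'))) ≡⟨ shuffle2 ⟦ i ⟧ (a + a) ⟦ k ⟧ o (s' + s') ⟩
    ⟦ i ⟧ + (⟦ k ⟧ + (a + a)) + (o + (s' + s')) ≡⟨ cong (_+ (o + (s' + s'))) (cell-degree i k a) ⟩
    ⟦ C ⟧ + (⟦ L ⟧ + (A + A)) + (o + (s' + s')) ≡⟨ shuffle3 ⟦ C ⟧ ⟦ L ⟧ (A + A) o (s' + s') ⟩
    ⟦ C ⟧ + (⟦ L ⟧ + o) + ((A + A) + (s' + s')) ≡⟨ cong (⟦ C ⟧ + (⟦ L ⟧ + o) +_) (sym (double-+ A s')) ⟩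
    ⟦ C ⟧ + (⟦ L ⟧ + o) + ((A + s') + (A + s')) ∎
  where
  open ≡-Reasoning
  open +-*-Solver using (solve; _:+_; _:=_)
  k = rowC as ls
  s = Vec.sum as
  s' = Vec.sum (rowA as ls)
  o = ones (rowL as ls)
  C = cellC i k a
  L = cellL i k a
  A = cellA i k a
  shuffle : ∀ x y z w → x + y + (z + w) ≡ x + (z + (y + w))
  shuffle = solve 4 (λ x y z w → x :+ y :+ (z :+ w) := x :+ (z :+ (y :+ w))) refl
  shuffle2 : ∀ x z k o w → x + (z + (k + o + w)) ≡ x + (k + z) + (o + w)
  shuffle2 = solve 5 (λ x z k o w → x :+ (z :+ (k :+ o :+ w)) := x :+ (k :+ z) :+ (o :+ w)) refl
  shuffle3 : ∀ c l z o w → c + (l + z) + (o + w) ≡ c + (l + o) + (z + w)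
  shuffle3 = solve 5 (λ c l z o w → c :+ (l :+ z) :+ (o :+ w) := c :+ (l :+ o) :+ (z :+ w)) refl

-- Multiplicities of the cells of ON_v: a row for each member c ≤ d of v, with one cell for each of the d − c
-- non-members of v between c and c*.
Fill : ∀ {n} → Bits n → Set
Fill [] = ⊤
Fill {suc n} (true ∷ b) = Vec ℕ n × Fill b
Fill (false ∷ b) = Fill b

fdeg : ∀ {n} (b : Bits n) → Fill b → ℕ
fdeg [] _ = 0
fdeg (true ∷ b) (a , f) = Vec.sum a + fdeg b f
fdeg (false ∷ b) f = fdeg b f

-- out and res run the sweep from the labels of the initial boundary; inL and inF run it backwards.
out : ∀ {n} (b : Bits n) → Fill b → Bits n → Bits n
out [] _ _ = []
out (true ∷ b) (a , f) ls = rowC a ls ∷ out b f (rowL a ls)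
out (false ∷ b) f (l ∷ ls) = l ∷ out b f ls

res : ∀ {n} (b : Bits n) → Fill b → Bits n → Fill b
res [] _ _ = tt
res (true ∷ b) (a , f) ls = rowA a ls , res b f (rowL a ls)
res (false ∷ b) f (l ∷ ls) = res b f ls

inL : ∀ {n} (b : Bits n) → Fill b → Bits n → Bits n
inL [] _ _ = []
inL (true ∷ b) (a , f) (t ∷ ts) = rowU a t (inL b f ts)
inL (false ∷ b) f (t ∷ ts) = t ∷ inL b f ts

inF : ∀ {n} (b : Bits n) → Fill b → Bits n → Fill b
inF [] _ _ = tt
inF (true ∷ b) (a , f) (t ∷ ts) = rowB a t (inL b f ts) , inF b f ts
inF (false ∷ b) f (t ∷ ts) = inF b f ts

out-inF : ∀ {n} (b : Bits n) f t → out b (inF b f t) (inL b f t) ≡ t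
out-inF [] f [] = refl
out-inF (true ∷ b) (a , f) (t ∷ ts) = cong₂ _∷_ (rowC-rowU a t _)
  (trans (cong (out b (inF b f ts)) (rowL-rowU a t _)) (out-inF b f ts))
out-inF (false ∷ b) f (t ∷ ts) = cong (t ∷_) (out-inF b f ts)

res-inF : ∀ {n} (b : Bits n) f t → res b (inF b f t) (inL b f t) ≡ f
res-inF [] f t = refl
res-inF (true ∷ b) (a , f) (t ∷ ts) = cong₂ _,_ (rowA-rowU a t _)
  (trans (cong (res b (inF b f ts)) (rowL-rowU a t _)) (res-inF b f ts))
res-inF (false ∷ b) f (t ∷ ts) = res-inF b f ts

inL-res : ∀ {n} (b : Bits n) f ls → inL b (res b f ls) (out b f ls) ≡ ls
inL-res [] f [] = refl
inL-res (true ∷ b) (a , f) ls =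
  trans (cong (rowU (rowA a ls) (rowC a ls)) (inL-res b f (rowL a ls))) (rowU-row a ls)
inL-res (false ∷ b) f (l ∷ ls) = cong (l ∷_) (inL-res b f ls)

inF-res : ∀ {n} (b : Bits n) f ls → inF b (res b f ls) (out b f ls) ≡ f
inF-res [] f ls = refl
inF-res (true ∷ b) (a , f) ls = cong₂ _,_
  (trans (cong (rowB (rowA a ls) (rowC a ls)) (inL-res b f (rowL a ls))) (rowB-row a ls))
  (inF-res b f (rowL a ls))
inF-res (false ∷ b) f (l ∷ ls) = inF-res b f ls

out-par : ∀ {n} (b : Bits n) f ls → par (out b f ls) ≡ par ls
out-par [] f [] = refl
out-par (true ∷ b) (a , f) ls = trans (cong (rowC a ls xor_) (out-par b f (rowL a ls))) (row-par a ls)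
out-par (false ∷ b) f (l ∷ ls) = cong (l xor_) (out-par b f ls)

inL-par : ∀ {n} (b : Bits n) f t → par (inL b f t) ≡ par t
inL-par b f t = trans (sym (out-par b (inF b f t) (inL b f t))) (cong par (out-inF b f t))

out-degree : ∀ {n} (b : Bits n) f ls → ones ls + (fdeg b f + fdeg b f) ≡
  ones (out b f ls) + (fdeg b (res b f ls) + fdeg b (res b f ls))
out-degree [] f [] = refl
out-degree (true ∷ b) (a , f) ls = begin
    ones ls + ((s + g) + (s + g)) ≡⟨ cong (ones ls +_) (double-+ s g) ⟩
    ones ls + ((s + s) + (g + g)) ≡⟨ +-assoc (ones ls) _ _ ⟨
    ones ls + (s + s) + (g + g) ≡⟨ cong (_+ (g + g)) (row-degree a ls) ⟩
    ⟦ c ⟧ + o + (s' + s') + (g + g) ≡⟨ shuffle ⟦ c ⟧ o (s' + s') (g + g) ⟩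
    ⟦ c ⟧ + (s' + s') + (o + (g + g)) ≡⟨ cong (⟦ c ⟧ + (s' + s') +_) (out-degree b f (rowL a ls)) ⟩
    ⟦ c ⟧ + (s' + s') + (o' + (g' + g')) ≡⟨ shuffle ⟦ c ⟧ o' (s' + s') (g' + g') ⟨
    ⟦ c ⟧ + o' + (s' + s') + (g' + g') ≡⟨ +-assoc (⟦ c ⟧ + o') _ _ ⟩
    ⟦ c ⟧ + o' + ((s' + s') + (g' + g')) ≡⟨ cong (⟦ c ⟧ + o' +_) (sym (double-+ s' g')) ⟩
    ⟦ c ⟧ + o' + ((s' + g') + (s' + g')) ∎
  where
  open ≡-Reasoning
  open +-*-Solver using (solve; _:+_; _:=_)
  s = Vec.sum a
  s' = Vec.sum (rowA a ls)
  g = fdeg b f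
  g' = fdeg b (res b f (rowL a ls))
  c = rowC a ls
  o = ones (rowL a ls)
  o' = ones (out b f (rowL a ls))
  shuffle : ∀ x y z w → x + y + z + w ≡ x + z + (y + w)
  shuffle = solve 4 (λ x y z w → x :+ y :+ z :+ w := x :+ z :+ (y :+ w)) refl
out-degree (false ∷ b) f (l ∷ ls) = begin
    ⟦ l ⟧ + ones ls + _ ≡⟨ +-assoc ⟦ l ⟧ _ _ ⟩
    ⟦ l ⟧ + (ones ls + _) ≡⟨ cong (⟦ l ⟧ +_) (out-degree b f ls) ⟩
    ⟦ l ⟧ + (ones (out b f ls) + _) ≡⟨ +-assoc ⟦ l ⟧ _ _ ⟨
    ⟦ l ⟧ + ones (out b f ls) + _ ∎
  where open ≡-Reasoning

-- Monotonicity of the sweep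

-- The update of δ to δ + x - y, defined only if the result is not negative. In continuation form it
-- reduces on concrete bits, so comparisons at a cell become finite case checks.
Step : ℕ → Bool → Bool → (ℕ → Set) → Set
Step δ true true P = P δ
Step δ false false P = P δ
Step δ true false P = P (suc δ)
Step zero false true P = ⊥
Step (suc δ) false true P = P δ

-- δ plus the number of true entries of any prefix of u bounds that of w: for δ = 0 this is the order of I(d), larger
-- elements having fewer small members.
Dom : ∀ {n} → ℕ → Bits n → Bits n → Set
Dom δ [] [] = ⊤
Dom δ (x ∷ u) (y ∷ w) = Step δ x y (λ δ′ → Dom δ′ u w)

Dom-refl : ∀ {n} δ (u : Bits n) → Dom δ u u
Dom-refl δ [] = tt
Dom-refl δ (true ∷ u) = Dom-refl δ u
Dom-refl δ (false ∷ u) = Dom-refl δ u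

Dom-trans : ∀ {n} δ ε (u v w : Bits n) → Dom δ u v → Dom ε v w → Dom (δ + ε) u w
Dom-trans δ ε [] [] [] p q = tt
Dom-trans δ ε (true ∷ u) (true ∷ v) (true ∷ w) p q = Dom-trans δ ε u v w p q
Dom-trans δ ε (true ∷ u) (true ∷ v) (false ∷ w) p q =
  subst (λ x → Dom x u w) (+-suc δ ε) (Dom-trans δ (suc ε) u v w p q)
Dom-trans δ (suc ε) (true ∷ u) (false ∷ v) (true ∷ w) p q =
  subst (λ x → Dom x u w) (sym (+-suc δ ε)) (Dom-trans (suc δ) ε u v w p q)
Dom-trans δ ε (true ∷ u) (false ∷ v) (false ∷ w) p q = Dom-trans (suc δ) ε u v w p q
Dom-trans (suc δ) ε (false ∷ u) (true ∷ v) (true ∷ w) p q = Dom-trans δ ε u v w p q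
Dom-trans (suc δ) ε (false ∷ u) (true ∷ v) (false ∷ w) p q =
  subst (λ x → Dom x u w) (+-suc δ ε) (Dom-trans δ (suc ε) u v w p q)
Dom-trans δ (suc ε) (false ∷ u) (false ∷ v) (true ∷ w) p q =
  subst (λ x → Step x false true (λ δ′ → Dom δ′ u w)) (sym (+-suc δ ε)) (Dom-trans δ ε u v w p q)
Dom-trans δ ε (false ∷ u) (false ∷ v) (false ∷ w) p q = Dom-trans δ ε u v w p q

Dom-antisym : ∀ {n} (u w : Bits n) → Dom 0 u w → Dom 0 w u → u ≡ w
Dom-antisym [] [] p q = refl
Dom-antisym (true ∷ u) (true ∷ w) p q = cong (true ∷_) (Dom-antisym u w p q)
Dom-antisym (false ∷ u) (false ∷ w) p q = cong (false ∷_) (Dom-antisym u w p q)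

Dom-not : ∀ {n} δ (u w : Bits n) → Dom δ u w → Dom δ (Vec.map not w) (Vec.map not u)
Dom-not δ [] [] p = tt
Dom-not δ (true ∷ u) (true ∷ w) p = Dom-not δ u w p
Dom-not δ (true ∷ u) (false ∷ w) p = Dom-not (suc δ) u w p
Dom-not (suc δ) (false ∷ u) (true ∷ w) p = Dom-not δ u w p
Dom-not δ (false ∷ u) (false ∷ w) p = Dom-not δ u w p

Dom-zeros : ∀ {n} δ (u : Bits n) → Dom δ u zeros
Dom-zeros δ [] = tt
Dom-zeros δ (true ∷ u) = Dom-zeros (suc δ) u
Dom-zeros δ (false ∷ u) = Dom-zeros δ u

-- Negating the bits and exchanging the two words leaves every increment x - y unchanged. Two steps
-- are treated at once because a path meets a cell in two edges.
Step-not : ∀ δ x y x′ y′ {P : ℕ → Set} →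
  Step δ x y (λ δ′ → Step δ′ x′ y′ P) →
  Step δ (not y) (not x) (λ δ′ → Step δ′ (not y′) (not x′) P)
Step-not δ true true true true p = p
Step-not δ true true true false p = p
Step-not (suc δ) true true false true p = p
Step-not δ true true false false p = p
Step-not δ true false true true p = p
Step-not δ true false true false p = p
Step-not δ true false false true p = p
Step-not δ true false false false p = p
Step-not (suc δ) false true true true p = p
Step-not (suc δ) false true true false p = p
Step-not (suc (suc δ)) false true false true p = p
Step-not (suc δ) false true false false p = p
Step-not δ false false true true p = p
Step-not δ false false true false p = p
Step-not (suc δ) false false false true p = p
Step-not δ false false false false p = p

-- Transports the parity invariant past the first bits x and y of the two words: `o` is the parity
-- of δ before them, the left side that after them.
xor-par : ∀ x y {p q o} → o ≡ (x xor p) xor (y xor q) → (x xor y) xor o ≡ p xor q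
xor-par true true {true} {q} refl = refl
xor-par true true {false} {q} refl = not-involutive q
xor-par true false {true} {q} refl = refl
xor-par true false {false} {q} refl = not-involutive q
xor-par false true {true} {q} refl = cong not (not-involutive q)
xor-par false true {false} {q} refl = not-involutive q
xor-par false false {p} {q} refl = refl

Step-map : ∀ δ x y {P Q : ℕ → Set} →
  (∀ δ′ → odd δ′ ≡ (x xor y) xor odd δ → P δ′ → Q δ′) → Step δ x y P → Step δ x y Q
Step-map δ true true h = h δ refl
Step-map δ true false h = h (suc δ) refl
Step-map (suc δ) false true h = h δ (sym (not-involutive (odd δ)))
Step-map δ false false h = h δ refl

-- Where a line enters, one of h01, h10 already equals h00 + 1 and the multiplicity has no influence
-- on the height; so inclusion of supports is asked for at the other cells. The weaker form is
-- essential: an annihilation makes the residual occupy cells that may have been empty.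
Compat : Bool → Bool → ℕ → ℕ → Set
Compat i k a a′ = a ≢ 0 → i ≡ false → k ≡ false → a′ ≢ 0

-- The height behind the cell is max(h01, h10, h00 + [a > 0]), which is monotone. The labels of the
-- carry are negated because they belong to a member of v, which a line removes, whereas at a
-- non-member a line adds one.
cellMono : ∀ δ i k a i′ k′ a′ {P : ℕ → Set} → Compat i′ k′ a a′ →
  Step δ i i′ (λ δ′ → Step δ′ (not k) (not k′) P) →
  Step δ (not (cellC i k a)) (not (cellC i′ k′ a′)) (λ δ′ → Step δ′ (cellL i k a) (cellL i′ k′ a′) P)
cellMono δ true true a true true a′ h p = p
cellMono (suc δ) true true a true false a′ h p = p
cellMono zero true true a true false a′ h ()
cellMono δ true true a false true a′ h p = p
cellMono δ true true a false false zero h p = p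
cellMono δ true true a false false (suc a′) h p = p
cellMono δ true false a true true a′ h p = p
cellMono δ true false a true false a′ h p = p
cellMono δ true false a false true a′ h p = p
cellMono δ true false a false false zero h p = p
cellMono δ true false a false false (suc a′) h p = p
cellMono (suc δ) false true a true true a′ h p = p
cellMono (suc (suc δ)) false true a true false a′ h p = p
cellMono (suc zero) false true a true false a′ h ()
cellMono δ false true a false true a′ h p = p
cellMono (suc δ) false true a false false zero h p = p
cellMono (suc δ) false true a false false (suc a′) h p = p
cellMono zero false true a false false a′ h ()
cellMono (suc δ) false false zero true true a′ h p = p
cellMono (suc δ) false false (suc a) true true a′ h p = p
cellMono (suc δ) false false zero true false a′ h p = p
cellMono (suc δ) false false (suc a) true false a′ h p = p
cellMono δ false false zero false true a′ h p = p
cellMono δ false false (suc a) false true a′ h p = p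
cellMono δ false false zero false false zero h p = p
cellMono δ false false zero false false (suc a′) h p = p
cellMono δ false false (suc a) false false zero h p = ⊥-elim (h (λ ()) refl refl refl)
cellMono δ false false (suc a) false false (suc a′) h p = p

-- Where no line enters, the residual multiplicity is at most the original one.
cellA-compat : ∀ c l a → Compat (cellC c l a) (cellL c l a) a (cellA c l a)
cellA-compat true true a h _ _ ()
cellA-compat true false a h _ () e
cellA-compat false true a h () _ e
cellA-compat false false zero h _ _ e = h refl
cellA-compat false false (suc a) h () _ e

-- The cell map is an involution and negation reverses the order, so this is cellMono read backwards.
cellMono⁻¹ : ∀ δ i k a c l {P : ℕ → Set} →
  Step δ (not (cellC i k a)) (not c) (λ δ′ → Step δ′ (cellL i k a) l P) →
  Step δ i (cellC c l a) (λ δ′ → Step δ′ (not k) (not (cellL c l a)) P)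
cellMono⁻¹ δ i k a c l {P} p = subst₂ (λ x y → Step δ x (cellC c l a) (λ δ′ → Step δ′ y (not (cellL c l a)) P))
  (trans (not-involutive _) (cellC-involutive i k a)) (cong not (cellL-involutive i k a)) r
  where
  q : Step δ c (cellC i k a) (λ δ′ → Step δ′ (not l) (not (cellL i k a)) P)
  q = subst₂ (λ x y → Step δ x y (λ δ′ → Step δ′ (not l) (not (cellL i k a)) P))
        (not-involutive c) (not-involutive _) (Step-not δ (not (cellC i k a)) (not c) (cellL i k a) l p)
  s : Step δ (not (cellC c l a)) (not (cellC (cellC i k a) (cellL i k a) (cellA i k a)))
        (λ δ′ → Step δ′ (cellL c l a) (cellL (cellC i k a) (cellL i k a) (cellA i k a)) P)
  s = cellMono δ c l a (cellC i k a) (cellL i k a) (cellA i k a) (cellA-compat i k a) q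
  r : Step δ (not (not (cellC (cellC i k a) (cellL i k a) (cellA i k a)))) (cellC c l a)
        (λ δ′ → Step δ′ (not (cellL (cellC i k a) (cellL i k a) (cellA i k a))) (not (cellL c l a)) P)
  r = subst (λ x → Step δ (not (not (cellC (cellC i k a) (cellL i k a) (cellA i k a)))) x
        (λ δ′ → Step δ′ (not (cellL (cellC i k a) (cellL i k a) (cellA i k a))) (not (cellL c l a)) P))
        (not-involutive _) (Step-not δ (not (cellC c l a)) (not (cellC (cellC i k a) (cellL i k a) (cellA i k a)))
          (cellL c l a) (cellL (cellC i k a) (cellL i k a) (cellA i k a)) s)

RowCompat : ∀ {n} → Vec ℕ n → Vec ℕ n → Bits (suc n) → Set
RowCompat [] [] _ = ⊤
RowCompat (a ∷ as) (a′ ∷ as′) (i ∷ ls) = Compat i (rowC as′ ls) a a′ × RowCompat as as′ ls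

-- The diagonal half cell: two heights of the same parity stay in order when rounded up to even numbers.
diagonal : ∀ δ x y {P : Set} → odd δ ≡ x xor y → Step δ x y (λ _ → P) → Step δ (not x) (not y) (λ _ → P)
diagonal δ true true o p = p
diagonal (suc δ) true false o p = p
diagonal (suc δ) false true o p = p
diagonal δ false false o p = p

-- The carry comes from the last cell while words are compared from the first bit: the inner call
-- compares the paths that have passed all cells but the first, and `cellMono` moves them over that
-- one.
rowMono : ∀ {n} δ (a a′ : Vec ℕ n) ls ls′ → odd δ ≡ par ls xor par ls′ → RowCompat a a′ ls′ →
  Dom δ ls ls′ → Dom δ (not (rowC a ls) ∷ rowL a ls) (not (rowC a′ ls′) ∷ rowL a′ ls′)
rowMono δ [] [] (l ∷ []) (l′ ∷ []) o h p = diagonal δ l l′ (trans o (rid l l′)) p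
  where
  rid : ∀ x y → (x xor false) xor (y xor false) ≡ x xor y
  rid true true = refl
  rid true false = refl
  rid false true = refl
  rid false false = refl
rowMono δ (a ∷ as) (a′ ∷ as′) (i ∷ ls) (i′ ∷ ls′) o (h , hs) p =
  cellMono δ i (rowC as ls) a i′ (rowC as′ ls′) a′ h
    (Step-map δ i i′ (λ δ′ o′ → rowMono δ′ as as′ ls ls′ (trans o′ (xor-par i i′ o)) hs) p)

rowB-compat : ∀ {n} (a : Vec ℕ n) c l → RowCompat a (rowB a c l) (rowU a c l)
rowB-compat [] c l = tt
rowB-compat (a ∷ as) c (l ∷ ls) rewrite rowC-rowU as (cellL c l a) ls =
  cellA-compat c l a , rowB-compat as (cellL c l a) ls

-- The adjunction for one row: `a` is swept forwards for `ls`, but is the residual of the backward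
-- sweep that produces `rowU a c l`.
rowMono⁻¹ : ∀ {n} δ (a : Vec ℕ n) ls c l → odd δ ≡ par ls xor (c xor par l) →
  Dom δ (not (rowC a ls) ∷ rowL a ls) (not c ∷ l) → Dom δ ls (rowU a c l)
rowMono⁻¹ δ [] (x ∷ []) c [] o p = subst₂ (λ x c → Step δ x c (λ _ → ⊤)) (not-involutive x) (not-involutive c)
    (diagonal δ (not x) (not c) (trans o (rid x c)) p)
  where
  rid : ∀ x y → (x xor false) xor (y xor false) ≡ not x xor not y
  rid true true = refl
  rid true false = refl
  rid false true = refl
  rid false false = refl
rowMono⁻¹ δ (a ∷ as) (i ∷ ls) c (l ∷ l′) o p =
  Step-map δ i (cellC c l a)
    (λ δ′ o′ → rowMono⁻¹ δ′ as ls (cellL c l a) l′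
      (trans o′ (xor-par i (cellC c l a) (trans o (cong ((i xor par ls) xor_) eq)))))
    (cellMono⁻¹ δ i (rowC as ls) a c l p)
  where
  eq : c xor (l xor par l′) ≡ cellC c l a xor (cellL c l a xor par l′)
  eq = trans (sym (xor-assoc c l _)) (trans (cong (_xor par l′) (sym (cell-xor c l a)))
         (xor-assoc (cellC c l a) _ _))

FillCompat : ∀ {n} (b : Bits n) → Fill b → Fill b → Bits n → Set
FillCompat [] _ _ _ = ⊤
FillCompat (true ∷ b) (a , f) (a′ , f′) ls = RowCompat a a′ ls × FillCompat b f f′ (rowL a′ ls)
FillCompat (false ∷ b) f f′ (_ ∷ ls) = FillCompat b f f′ ls

outMono : ∀ {n} δ (b : Bits n) f f′ ls ls′ → odd δ ≡ par ls xor par ls′ → FillCompat b f f′ ls′ →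
  Dom δ ls ls′ → Dom δ (b ⊕ out b f ls) (b ⊕ out b f′ ls′)
outMono δ [] f f′ [] [] o h p = tt
outMono δ (true ∷ b) (a , f) (a′ , f′) ls ls′ o (h , hs) p =
  Step-map δ (not (rowC a ls)) (not (rowC a′ ls′))
    (λ δ′ o′ → outMono δ′ b f f′ (rowL a ls) (rowL a′ ls′) (trans o′ (eq δ o)) hs)
    (rowMono δ a a′ ls ls′ o h p)
  where
  eq : ∀ δ → odd δ ≡ par ls xor par ls′ → (not (rowC a ls) xor not (rowC a′ ls′)) xor odd δ ≡
    par (rowL a ls) xor par (rowL a′ ls′)
  eq δ o = trans (cong (_xor odd δ) (xor-annihilates-not (rowC a ls) (rowC a′ ls′)))
    (xor-par (rowC a ls) (rowC a′ ls′) (trans o (sym (cong₂ _xor_ (row-par a ls) (row-par a′ ls′)))))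
outMono δ (false ∷ b) f f′ (l ∷ ls) (l′ ∷ ls′) o h p =
  Step-map δ l l′ (λ δ′ o′ → outMono δ′ b f f′ ls ls′ (trans o′ (xor-par l l′ o)) h) p

inF-compat : ∀ {n} (b : Bits n) f t → FillCompat b f (inF b f t) (inL b f t)
inF-compat [] f t = tt
inF-compat (true ∷ b) (a , f) (t ∷ ts) = rowB-compat a t (inL b f ts) ,
  subst (FillCompat b f (inF b f ts)) (sym (rowL-rowU a t _)) (inF-compat b f ts)
inF-compat (false ∷ b) f (t ∷ ts) = inF-compat b f ts

-- The adjunction between the forward sweep with `f` as monomial and the backward sweep with `f` as
-- residual.
inMono : ∀ {n} δ (b : Bits n) f ls t → odd δ ≡ par ls xor par t →
  Dom δ (b ⊕ out b f ls) (b ⊕ t) → Dom δ ls (inL b f t)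
inMono δ [] f [] [] o p = tt
inMono δ (true ∷ b) (a , f) ls (t ∷ ts) o p =
  rowMono⁻¹ δ a ls t (inL b f ts) (trans o (cong (λ x → par ls xor (t xor x)) (sym (inL-par b f ts))))
    (Step-map δ (not (rowC a ls)) (not t)
      (λ δ′ o′ → inMono δ′ b f (rowL a ls) ts (trans o′ (eq o))) p)
  where
  eq : ∀ {o} → o ≡ par ls xor (t xor par ts) → (not (rowC a ls) xor not t) xor o ≡
    par (rowL a ls) xor par ts
  eq {o} h = trans (cong (_xor o) (xor-annihilates-not (rowC a ls) t))
    (xor-par (rowC a ls) t (trans h (cong (_xor (t xor par ts)) (sym (row-par a ls)))))
inMono δ (false ∷ b) f (l ∷ ls) (t ∷ ts) o p =
  Step-map δ l t (λ δ′ o′ → inMono δ′ b f ls ts (trans o′ (xor-par l t o))) p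

-- Multichains and monomials

⊕-cancel : ∀ {n} (u w : Bits n) → u ⊕ (u ⊕ w) ≡ w
⊕-cancel [] [] = refl
⊕-cancel (true ∷ u) (y ∷ w) = cong₂ _∷_ (not-involutive y) (⊕-cancel u w)
⊕-cancel (false ∷ u) (y ∷ w) = cong (y ∷_) (⊕-cancel u w)

⊕-zeros : ∀ {n} (u : Bits n) → u ⊕ zeros ≡ u
⊕-zeros [] = refl
⊕-zeros (true ∷ u) = cong (true ∷_) (⊕-zeros u)
⊕-zeros (false ∷ u) = cong (false ∷_) (⊕-zeros u)

par-zeros : ∀ n → par (zeros {n}) ≡ false
par-zeros zero = refl
par-zeros (suc n) = par-zeros n

ones-zeros : ∀ n → ones (zeros {n}) ≡ 0
ones-zeros zero = refl
ones-zeros (suc n) = ones-zeros n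

ones-0 : ∀ {n} (u : Bits n) → ones u ≡ 0 → u ≡ zeros
ones-0 [] e = refl
ones-0 (false ∷ u) e = cong (false ∷_) (ones-0 u e)

zeroFill : ∀ {n} (b : Bits n) → Fill b
zeroFill [] = tt
zeroFill (true ∷ b) = replicate _ 0 , zeroFill b
zeroFill (false ∷ b) = zeroFill b

row-zeroFill : ∀ n → (rowC (replicate n 0) zeros ≡ false) × (rowL (replicate n 0) zeros ≡ zeros)
row-zeroFill zero = refl , refl
row-zeroFill (suc n) with p , q ← row-zeroFill n rewrite p = refl , cong (false ∷_) q

out-zeroFill : ∀ {n} (b : Bits n) → out b (zeroFill b) zeros ≡ zeros
out-zeroFill [] = refl
out-zeroFill {suc n} (true ∷ b) with p , q ← row-zeroFill n rewrite p | q = cong (false ∷_) (out-zeroFill b)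
out-zeroFill (false ∷ b) = cong (false ∷_) (out-zeroFill b)

row-zeros : ∀ {n} (a : Vec ℕ n) → rowC a zeros ≡ false → a ≡ replicate n 0 × rowL a zeros ≡ zeros
row-zeros [] e = refl , refl
row-zeros (a ∷ as) e with rowC as zeros in eq
row-zeros (zero ∷ as) e | false with p , q ← row-zeros as eq = cong (0 ∷_) p , cong (false ∷_) q
row-zeros (suc a ∷ as) () | false
row-zeros (a ∷ as) () | true

out-zeros : ∀ {n} (b : Bits n) f → out b f zeros ≡ zeros → f ≡ zeroFill b
out-zeros [] f e = refl
out-zeros (true ∷ b) (a , f) e with p , q ← ∷-injective e with r , s ← row-zeros a p =
  cong₂ _,_ r (out-zeros b f (trans (cong (out b f) (sym s)) q))
out-zeros (false ∷ b) f e = out-zeros b f (proj₂ (∷-injective e))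

zeroRow-compat : ∀ {n} (a : Vec ℕ n) ls → RowCompat (replicate n 0) a ls
zeroRow-compat [] ls = tt
zeroRow-compat (a ∷ as) (l ∷ ls) = (λ h → ⊥-elim (h refl)) , zeroRow-compat as ls

zeroFill-compat : ∀ {n} (b : Bits n) f ls → FillCompat b (zeroFill b) f ls
zeroFill-compat [] f ls = tt
zeroFill-compat (true ∷ b) (a , f) ls = zeroRow-compat a ls , zeroFill-compat b f (rowL a ls)
zeroFill-compat (false ∷ b) f (l ∷ ls) = zeroFill-compat b f ls

-- The least element of I(d) that dominates the monomial f.
top : ∀ {n} (b : Bits n) → Fill b → Bits n
top b f = b ⊕ out b f zeros

top-zeroFill : ∀ {n} (b : Bits n) → top b (zeroFill b) ≡ b
top-zeroFill b = trans (cong (b ⊕_) (out-zeroFill b)) (⊕-zeros b)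

zeros-par : ∀ n → false ≡ par (zeros {n}) xor par (zeros {n})
zeros-par n = sym (xor-same (par (zeros {n})))

below-top : ∀ {n} (b : Bits n) f → Dom 0 b (top b f)
below-top {n} b f = subst (λ x → Dom 0 x (top b f)) (top-zeroFill b)
  (outMono 0 b (zeroFill b) f zeros zeros (zeros-par n) (zeroFill-compat b f zeros) (Dom-refl 0 (zeros {n})))

top-par : ∀ {n} (b : Bits n) f → par (b ⊕ top b f) ≡ false
top-par {n} b f = trans (cong par (⊕-cancel b (out b f zeros))) (trans (out-par b f zeros) (par-zeros n))

-- By the adjunction the incoming labels dominate `zeros`, which is itself the largest word. So no
-- line is left over, and β together with the residual `f` comes from a monomial.
top-inL : ∀ {n} (b : Bits n) f β → par (b ⊕ β) ≡ false → Dom 0 (top b f) β → inL b f (b ⊕ β) ≡ zeros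
top-inL {n} b f β e p = Dom-antisym _ _ (Dom-zeros 0 (inL b f (b ⊕ β)))
  (inMono 0 b f zeros (b ⊕ β) (sym (cong₂ _xor_ (par-zeros n) e))
    (subst (Dom 0 (top b f)) (sym (⊕-cancel b β)) p))

-- The largest element β is put in last, so it is the first to be recovered, as the `top` of the
-- result.
Psi : ∀ {n} (b : Bits n) → List (Bits n) → Fill b
Psi b [] = zeroFill b
Psi b (β ∷ βs) = inF b (Psi b βs) (b ⊕ β)

-- Parity is taken relative to `b`; this is invariant under complementing both words, so the same
-- definition serves below v.
Above : ∀ {n} → Bits n → Bits n → Set
Above b β = Dom 0 b β × β ≢ b × par (b ⊕ β) ≡ false

Multichain : ∀ {n} → Bits n → List (Bits n) → Set
Multichain b βs = All (Above b) βs × Linked (λ x y → Dom 0 y x) βs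

Below : ∀ {n} → Bits n → List (Bits n) → Set
Below w [] = ⊤
Below w (β ∷ _) = Dom 0 β w

headOr : ∀ {n} → Bits n → List (Bits n) → Bits n
headOr b [] = b
headOr b (β ∷ _) = β

tail-Multichain : ∀ {n} {b β : Bits n} {βs} → Multichain b (β ∷ βs) → Multichain b βs
tail-Multichain (_ ∷ p , q) = p , Linked.tail q

head-Above : ∀ {n} {b : Bits n} β βs → Multichain b (β ∷ βs) → Dom 0 (headOr b βs) β
head-Above β [] ((p , _) ∷ _ , _) = p
head-Above β (_ ∷ _) (_ , q ∷ _) = q

-- Mutual induction: the tail must have its head as `top` for the backward sweep of β to end without
-- lines, and this in turn makes β the `top` of the whole list.
Psi-inL : ∀ {n} (b : Bits n) β βs → Multichain b (β ∷ βs) → inL b (Psi b βs) (b ⊕ β) ≡ zeros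
top-Psi : ∀ {n} (b : Bits n) βs → Multichain b βs → top b (Psi b βs) ≡ headOr b βs

Psi-inL b β βs mc@((_ , _ , e) ∷ _ , _) = top-inL b (Psi b βs) β e
  (subst (λ x → Dom 0 x β) (sym (top-Psi b βs (tail-Multichain mc))) (head-Above β βs mc))

top-Psi b [] mc = top-zeroFill b
top-Psi b (β ∷ βs) mc = trans
  (cong (λ x → b ⊕ out b (Psi b (β ∷ βs)) x) (sym (Psi-inL b β βs mc)))
  (trans (cong (b ⊕_) (out-inF b (Psi b βs) (b ⊕ β))) (⊕-cancel b β))

Psi-tail : ∀ {n} (b : Bits n) β βs → Multichain b (β ∷ βs) → res b (Psi b (β ∷ βs)) zeros ≡ Psi b βs
Psi-tail b β βs mc = trans
  (cong (res b (Psi b (β ∷ βs))) (sym (Psi-inL b β βs mc))) (res-inF b (Psi b βs) (b ⊕ β))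

Psi-injective : ∀ {n} (b : Bits n) βs γs → Multichain b βs → Multichain b γs → Psi b βs ≡ Psi b γs → βs ≡ γs
Psi-injective b [] [] mc nc e = refl
Psi-injective b [] (γ ∷ γs) mc nc@((_ , h , _) ∷ _ , _) e =
  ⊥-elim (h (sym (trans (sym (top-Psi b [] mc)) (trans (cong (top b) e) (top-Psi b (γ ∷ γs) nc)))))
Psi-injective b (β ∷ βs) [] mc@((_ , h , _) ∷ _ , _) nc e =
  ⊥-elim (h (trans (sym (top-Psi b (β ∷ βs) mc)) (trans (cong (top b) e) (top-Psi b [] nc))))
Psi-injective b (β ∷ βs) (γ ∷ γs) mc nc e = cong₂ _∷_
  (trans (sym (top-Psi b (β ∷ βs) mc)) (trans (cong (top b) e) (top-Psi b (γ ∷ γs) nc)))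
  (Psi-injective b βs γs (tail-Multichain mc) (tail-Multichain nc)
    (trans (sym (Psi-tail b β βs mc)) (trans (cong (λ f → res b f zeros) e) (Psi-tail b γ γs nc))))

halve : ∀ x t y → x + x ≡ t + (y + y) → x ≡ ⌊ t /2⌋ + y
halve x t zero e = trans (n≡⌊n+n/2⌋ x) (trans (cong ⌊_/2⌋ (trans e (+-identityʳ t))) (sym (+-identityʳ _)))
halve x t (suc y) e with x
... | zero = ⊥-elim (1+n≢0 (trans (sym (trans (cong (t +_) (cong suc (+-suc y y))) (+-suc t _))) (sym e)))
... | suc x = trans (cong suc (halve x t y (suc-injective (suc-injective
        (trans (cong suc (sym (+-suc x x))) (trans e (trans (+-suc t _) (cong suc (trans (cong (t +_) (+-suc y y)) (+-suc t _)))))))))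
        ) (sym (+-suc _ y))

degrees : ∀ {n} → Bits n → List (Bits n) → ℕ
degrees b βs = sum (map (λ β → ⌊ ones (b ⊕ β) /2⌋) βs)

fdeg-zeroFill : ∀ {n} (b : Bits n) → fdeg b (zeroFill b) ≡ 0
fdeg-zeroFill [] = refl
fdeg-zeroFill {suc n} (true ∷ b) = cong₂ _+_ (sum-0 n) (fdeg-zeroFill b)
  where
  sum-0 : ∀ n → Vec.sum (replicate n 0) ≡ 0
  sum-0 zero = refl
  sum-0 (suc n) = sum-0 n
fdeg-zeroFill (false ∷ b) = fdeg-zeroFill b

fdeg-res : ∀ {n} (b : Bits n) f → fdeg b f ≡ ⌊ ones (out b f zeros) /2⌋ + fdeg b (res b f zeros)
fdeg-res {n} b f = halve _ (ones (out b f zeros)) _ (trans (cong (_+ (fdeg b f + fdeg b f)) (sym (ones-zeros n))) (out-degree b f zeros))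

fdeg-Psi : ∀ {n} (b : Bits n) βs → Multichain b βs → fdeg b (Psi b βs) ≡ degrees b βs
fdeg-Psi b [] mc = fdeg-zeroFill b
fdeg-Psi b (β ∷ βs) mc = trans (fdeg-res b (Psi b (β ∷ βs))) (cong₂ _+_
  (cong (λ x → ⌊ ones x /2⌋) (trans (cong (out b (Psi b (β ∷ βs))) (sym (Psi-inL b β βs mc))) (out-inF b (Psi b βs) (b ⊕ β))))
  (trans (cong (fdeg b) (Psi-tail b β βs mc)) (fdeg-Psi b βs (tail-Multichain mc))))

half-positive : ∀ {n} (u : Bits n) → par u ≡ false → u ≢ zeros → 1 ≤ ⌊ ones u /2⌋
half-positive u e h with ones u in eq
... | zero = ⊥-elim (h (ones-0 u eq))
... | suc zero = ⊥-elim (false≢true (trans (sym e) (trans (sym (ones-par u)) (cong odd eq))))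
  where
  false≢true : false ≢ true
  false≢true ()
... | suc (suc k) = s≤s z≤n

-- The support of the residual may be larger, but not at cells where no line of the sweep of `f`
-- enters. This is the reason why the successive elements decrease.
top-res : ∀ {n} (b : Bits n) f → Dom 0 (top b (res b f zeros)) (top b f)
top-res {n} b f = outMono 0 b (res b f zeros) f zeros zeros (zeros-par n)
  (subst₂ (FillCompat b (res b f zeros)) (inF-res b f zeros) (inL-res b f zeros)
    (inF-compat b (res b f zeros) (out b f zeros)))
  (Dom-refl 0 (zeros {n}))

cons-Linked : ∀ {n} {b : Bits n} β βs → Linked (λ x y → Dom 0 y x) βs → Dom 0 (headOr b βs) β →
  Linked (λ x y → Dom 0 y x) (β ∷ βs)
cons-Linked β [] l p = [-]
cons-Linked β (_ ∷ _) l p = p ∷ l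

-- Induction on the degree. The number of lines that leave is even, so if there are any, the
-- residual loses at least one in degree; if there are none, the monomial is trivial.
Psi-surjective : ∀ {n} (b : Bits n) f → Σ (List (Bits n)) λ βs → Multichain b βs × Psi b βs ≡ f
Psi-surjective {n} b f = go (fdeg b f) f ≤-refl
  where
  go : ∀ k f → fdeg b f ≤ k → Σ (List (Bits n)) λ βs → Multichain b βs × Psi b βs ≡ f
  go k f h with ≡-dec B._≟_ (out b f zeros) zeros
  go k f h | yes e = [] , ([] , []) , sym (out-zeros b f e)
  go zero f h | no e = ⊥-elim (<⇒≱ (half-positive (out b f zeros) (trans (out-par b f zeros) (par-zeros n)) e)
      (≤-trans (m≤m+n _ _) (≤-trans (≤-reflexive (sym (fdeg-res b f))) h)))
  go (suc k) f h | no e with go k (res b f zeros)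
      (≤-pred (≤-trans (≤-trans (+-monoˡ-≤ (fdeg b (res b f zeros))
        (half-positive (out b f zeros) (trans (out-par b f zeros) (par-zeros n)) e))
        (≤-reflexive (sym (fdeg-res b f)))) h))
  ... | βs , mc , eq = top b f ∷ βs , ((below-top b f , ne , top-par b f) ∷ proj₁ mc ,
          cons-Linked {b = b} _ βs (proj₂ mc) (subst (λ x → Dom 0 x (top b f))
            (trans (cong (top b) (sym eq)) (top-Psi b βs mc)) (top-res b f))) ,
        trans (cong₂ (inF b) eq (⊕-cancel b (out b f zeros))) (inF-res b f zeros)
    where
    ne : top b f ≢ b
    ne q = e (trans (sym (⊕-cancel b _)) (trans (cong (b ⊕_) q) (trans (cong (b ⊕_) (sym (⊕-zeros b))) (⊕-cancel b zeros))))

-- Chains from the backward sweep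

pre : ∀ {n} → ℕ → Bits n → ℕ
pre zero _ = 0
pre (suc j) [] = 0
pre (suc j) (x ∷ u) = ⟦ x ⟧ + pre j u

data Nth : ∀ {n} → ℕ → ℕ → Vec ℕ n → Set where
  here : ∀ {n x} {xs : Vec ℕ n} → Nth 0 x (x ∷ xs)
  there : ∀ {n i x y} {xs : Vec ℕ n} → Nth i x xs → Nth (suc i) x (y ∷ xs)

First : ∀ {n} → ℕ → ℕ → Vec ℕ n → Set
First j x xs = Σ ℕ λ i → i < j × Nth i x xs

_∈ⱽ_ : ∀ {n} → ℕ → Vec ℕ n → Set
x ∈ⱽ xs = Σ ℕ λ i → Nth i x xs

Nth-∷ʳ : ∀ {n i x} {xs : Vec ℕ n} {y} → Nth i x xs → Nth i x (xs ∷ʳ y)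
Nth-∷ʳ here = here
Nth-∷ʳ (there p) = there (Nth-∷ʳ p)

Nth-last : ∀ {n} (xs : Vec ℕ n) {y} → Nth n y (xs ∷ʳ y)
Nth-last [] = here
Nth-last (x ∷ xs) = there (Nth-last xs)

Nth-∷ʳ⁻ : ∀ {n i x} (xs : Vec ℕ n) {y} → Nth i x (xs ∷ʳ y) → Nth i x xs ⊎ (i ≡ n × x ≡ y)
Nth-∷ʳ⁻ [] here = inj₂ (refl , refl)
Nth-∷ʳ⁻ (x ∷ xs) here = inj₁ here
Nth-∷ʳ⁻ (x ∷ xs) (there p) with Nth-∷ʳ⁻ xs p
... | inj₁ q = inj₁ (there q)
... | inj₂ (refl , e) = inj₂ (refl , e)

Nth-< : ∀ {n i x} {xs : Vec ℕ n} → Nth i x xs → i < n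
Nth-< here = s≤s z≤n
Nth-< (there p) = s≤s (Nth-< p)

-- With e members of {1..d} already read and n still to be read after the current one, k = suc e and k* = hi e n.
hi : ℕ → ℕ → ℕ
hi e n = suc (suc (e + n + n))

hi-eq : ∀ e n → e + suc n + suc n ≡ hi e n
hi-eq e n = trans (+-suc (e + suc n) n) (cong (λ x → suc (x + n)) (+-suc e n))

-- The non-members of the coded set, in increasing order.
R : ∀ {n} → ℕ → Bits n → Vec ℕ n
R e [] = []
R {suc n} e (true ∷ b) = R (suc e) b ∷ʳ hi e n
R e (false ∷ b) = suc e ∷ R (suc e) b

R-lower : ∀ {n i x} e (b : Bits n) → Nth i x (R e b) → e < x
R-lower {suc n} e (true ∷ b) p with Nth-∷ʳ⁻ (R (suc e) b) p
... | inj₁ q = <-trans (n<1+n e) (R-lower (suc e) b q)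
... | inj₂ (_ , refl) = s≤s (m≤n⇒m≤1+n (≤-trans (m≤m+n e n) (m≤m+n (e + n) n)))
R-lower e (false ∷ b) here = n<1+n e
R-lower e (false ∷ b) (there p) = <-trans (n<1+n e) (R-lower (suc e) b p)

R-upper : ∀ {n i x} e (b : Bits n) → Nth i x (R e b) → x ≤ e + n + n
R-upper {suc n} e (true ∷ b) p with Nth-∷ʳ⁻ (R (suc e) b) p
... | inj₁ q = ≤-trans (R-upper (suc e) b q) (≤-trans (n≤1+n _) (≤-reflexive (sym (hi-eq e n))))
... | inj₂ (_ , refl) = ≤-reflexive (sym (hi-eq e n))
R-upper {suc n} e (false ∷ b) here = subst (suc e ≤_) (sym (hi-eq e n)) (s≤s (m≤n⇒m≤1+n (≤-trans (m≤m+n e n) (m≤m+n (e + n) n))))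
R-upper {suc n} e (false ∷ b) (there p) = ≤-trans (R-upper (suc e) b p) (≤-trans (n≤1+n _) (≤-reflexive (sym (hi-eq e n))))

R-mono : ∀ {n i j x y} e (b : Bits n) → Nth i x (R e b) → Nth j y (R e b) → i < j → x < y
R-mono {suc n} e (true ∷ b) p q i<j with Nth-∷ʳ⁻ (R (suc e) b) p | Nth-∷ʳ⁻ (R (suc e) b) q
... | inj₁ p′ | inj₁ q′ = R-mono (suc e) b p′ q′ i<j
... | inj₁ p′ | inj₂ (_ , refl) = s≤s (R-upper (suc e) b p′)
... | inj₂ (refl , _) | inj₁ q′ = ⊥-elim (<-asym i<j (Nth-< q′))
... | inj₂ (refl , _) | inj₂ (refl , _) = ⊥-elim (<-irrefl refl i<j)
R-mono e (false ∷ b) here (there q) i<j = R-lower (suc e) b q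
R-mono e (false ∷ b) (there p) (there q) (s≤s i<j) = R-mono (suc e) b p q i<j

-- The positions of `Fill b` as pairs of indices; for e = 0 these are the elements of ON_v, see
-- `Cell⇒InON` and `InON⇒Cell`.
Cell : ∀ {n} → ℕ → Bits n → Pair → Set
Cell e [] _ = ⊥
Cell e (true ∷ b) (r , c) = (c ≡ suc e × r ∈ⱽ R (suc e) b) ⊎ Cell (suc e) b (r , c)
Cell e (false ∷ b) α = Cell (suc e) b α

Cell-lower : ∀ {n} e (b : Bits n) α → Cell e b α → e < proj₂ α
Cell-lower e (true ∷ b) α (inj₁ (refl , _)) = n<1+n e
Cell-lower e (true ∷ b) α (inj₂ p) = <-trans (n<1+n e) (Cell-lower (suc e) b α p)
Cell-lower e (false ∷ b) α p = <-trans (n<1+n e) (Cell-lower (suc e) b α p)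

fillOf : ∀ {n} → (ℕ → ℕ → ℕ) → ℕ → (b : Bits n) → Fill b
fillOf g e [] = tt
fillOf g e (true ∷ b) = Vec.map (λ r → g r (suc e)) (R (suc e) b) , fillOf g (suc e) b
fillOf g e (false ∷ b) = fillOf g (suc e) b

map-cong-Nth : ∀ {n} {A : Set} {f g : ℕ → A} (xs : Vec ℕ n) → (∀ {i} x → Nth i x xs → f x ≡ g x) → Vec.map f xs ≡ Vec.map g xs
map-cong-Nth [] h = refl
map-cong-Nth (x ∷ xs) h = cong₂ _∷_ (h x here) (map-cong-Nth xs (λ y p → h y (there p)))

fillOf-cong : ∀ {n} {g h} e (b : Bits n) → (∀ r c → Cell e b (r , c) → g r c ≡ h r c) → fillOf g e b ≡ fillOf h e b
fillOf-cong e [] eq = refl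
fillOf-cong e (true ∷ b) eq = cong₂ _,_
  (map-cong-Nth (R (suc e) b) (λ r p → eq r (suc e) (inj₁ (refl , _ , p))))
  (fillOf-cong (suc e) b (λ r c p → eq r c (inj₂ p)))
fillOf-cong e (false ∷ b) eq = fillOf-cong (suc e) b eq

map-compat : ∀ {n} {g h : ℕ → ℕ} (xs : Vec ℕ n) ls → (∀ x → g x ≢ 0 → h x ≢ 0) → RowCompat (Vec.map g xs) (Vec.map h xs) ls
map-compat [] ls k = tt
map-compat (x ∷ xs) (l ∷ ls) k = (λ p _ _ → k x p) , map-compat xs ls k

fillOf-compat : ∀ {n} {g h} e (b : Bits n) ls → (∀ r c → g r c ≢ 0 → h r c ≢ 0) → FillCompat b (fillOf g e b) (fillOf h e b) ls
fillOf-compat e [] ls k = tt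
fillOf-compat {h = h} e (true ∷ b) ls k = map-compat (R (suc e) b) ls (λ r → k r (suc e)) ,
  fillOf-compat (suc e) b (rowL (Vec.map (λ r → h r (suc e)) (R (suc e) b)) ls) k
fillOf-compat e (false ∷ b) (l ∷ ls) k = fillOf-compat (suc e) b ls k

ind : List Pair → ℕ → ℕ → ℕ
ind [] r c = 0
ind ((r′ , c′) ∷ C) r c = if (r ≡ᵇ r′) ∧ (c ≡ᵇ c′) then 1 else ind C r c

≡ᵇ-refl : ∀ m → (m ≡ᵇ m) ≡ true
≡ᵇ-refl zero = refl
≡ᵇ-refl (suc m) = ≡ᵇ-refl m

≢⇒≡ᵇ : ∀ m n → m ≢ n → (m ≡ᵇ n) ≡ false
≢⇒≡ᵇ m n h with m ≡ᵇ n in eq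
... | false = refl
... | true = ⊥-elim (h (≡ᵇ⇒≡ m n (subst B.T (sym eq) tt)))

≡ᵇ-true : ∀ m n → (m ≡ᵇ n) ≡ true → m ≡ n
≡ᵇ-true m n eq = ≡ᵇ⇒≡ m n (subst B.T (sym eq) tt)

ind-head : ∀ r c C → ind ((r , c) ∷ C) r c ≡ 1
ind-head r c C rewrite ≡ᵇ-refl r | ≡ᵇ-refl c = refl

ind-skip : ∀ r′ c′ C r c → c ≢ c′ → ind ((r′ , c′) ∷ C) r c ≡ ind C r c
ind-skip r′ c′ C r c h rewrite ≢⇒≡ᵇ c c′ h with r ≡ᵇ r′
... | true = refl
... | false = refl

ind-support : ∀ {P : ℕ → ℕ → Set} C r c → All (λ α → P (proj₁ α) (proj₂ α)) C → ind C r c ≢ 0 → P r c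
ind-support [] r c [] h = ⊥-elim (h refl)
ind-support {P} ((r′ , c′) ∷ C) r c (p ∷ ps) h with r ≡ᵇ r′ in eq | c ≡ᵇ c′ in eq′
... | true | true = subst₂ P (sym (≡ᵇ-true r r′ eq)) (sym (≡ᵇ-true c c′ eq′)) p
... | true | false = ind-support {P} C r c ps h
... | false | _ = ind-support {P} C r c ps h

cellC-nonzero : ∀ a → a ≢ 0 → cellC false false a ≡ true
cellC-nonzero zero h = ⊥-elim (h refl)
cellC-nonzero (suc a) h = refl

rowU-step : ∀ {n} (a : ℕ) (as : Vec ℕ n) c m l j → pre (suc j) (rowU (a ∷ as) c (m ∷ l)) + ⟦ c ⟧ ≡
  ⟦ m ⟧ + (pre j (rowU as (cellL c m a) l) + ⟦ cellL c m a ⟧)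
rowU-step a as c m l j = begin
    ⟦ i ⟧ + x + ⟦ c ⟧ ≡⟨ move ⟦ i ⟧ x ⟦ c ⟧ ⟩
    x + (⟦ c ⟧ + ⟦ i ⟧) ≡⟨ cong (x +_) (cell-flow c m a) ⟩
    x + (⟦ m ⟧ + ⟦ k ⟧) ≡⟨ move′ x ⟦ m ⟧ ⟦ k ⟧ ⟩
    ⟦ m ⟧ + (x + ⟦ k ⟧) ∎
  where
  open ≡-Reasoning
  open +-*-Solver using (solve; _:+_; _:=_)
  k = cellL c m a
  i = cellC c m a
  x = pre j (rowU as k l)
  move : ∀ i x c → i + x + c ≡ x + (c + i)
  move = solve 3 (λ i x c → i :+ x :+ c := x :+ (c :+ i)) refl
  move′ : ∀ x m k → x + (m + k) ≡ m + (x + k)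
  move′ = solve 3 (λ x m k → x :+ (m :+ k) := m :+ (x :+ k)) refl

-- In terms of heights rowU is the recursion g00 = min(g01, g10, g11 - [a > 0]); unrolling it along a row, the height
-- at a vertex is the least of the candidates met on the way.
rowU-bound : ∀ {n} (a : Vec ℕ n) c l {i j} → i ≤ j → pre i l ≤ pre j (rowU a c l) + ⟦ c ⟧
rowU-bound a c l z≤n = z≤n
rowU-bound [] c [] (s≤s p) = z≤n
rowU-bound (a ∷ as) c (m ∷ l) {suc i} {suc j} (s≤s p) =
  ≤-trans (+-monoʳ-≤ ⟦ m ⟧ (rowU-bound as (cellL c m a) l p)) (≤-reflexive (sym (rowU-step a as c m l j)))

rowU-bound-cell : ∀ {n} (h : ℕ → ℕ) (ρ : Vec ℕ n) c l {i j r} → Nth i r ρ → h r ≢ 0 → i < j →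
  suc (pre i l) ≤ pre j (rowU (Vec.map h ρ) c l) + ⟦ c ⟧
rowU-bound-cell h (r ∷ ρ) true (m ∷ l) {j = suc j} here nz p = m≤n+m 1 _
rowU-bound-cell h (r ∷ ρ) false (true ∷ l) {j = suc j} here nz p = s≤s z≤n
rowU-bound-cell h (r ∷ ρ) false (false ∷ l) {j = suc j} here nz p rewrite cellC-nonzero (h r) nz = s≤s z≤n
rowU-bound-cell h (y ∷ ρ) c (m ∷ l) {suc i} {suc j} (there q) nz (s≤s p) = begin
    suc (⟦ m ⟧ + pre i l) ≡⟨ +-suc ⟦ m ⟧ (pre i l) ⟨
    ⟦ m ⟧ + suc (pre i l) ≤⟨ +-monoʳ-≤ ⟦ m ⟧ (rowU-bound-cell h ρ (cellL c m (h y)) l q nz p) ⟩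
    ⟦ m ⟧ + (pre j (rowU (Vec.map h ρ) (cellL c m (h y)) l) + ⟦ cellL c m (h y) ⟧) ≡⟨ rowU-step (h y) (Vec.map h ρ) c m l j ⟨
    pre (suc j) (rowU (Vec.map h (y ∷ ρ)) c (m ∷ l)) + ⟦ c ⟧ ∎
  where open ≤-Reasoning

-- The candidates at a vertex: no line so far, descent to the next row at vertex i, or a diagonal
-- step through an occupied cell. In `trace-row` they end the chain, leave it as it is, or extend
-- it.
Attained : ∀ {n} → (ℕ → ℕ) → Vec ℕ n → Bool → Bits n → ℕ → ℕ → Set
Attained h ρ c l j x = x ≡ 0
  ⊎ (Σ ℕ λ i → i ≤ j × x + ⟦ c ⟧ ≡ pre i l)
  ⊎ (Σ ℕ λ i → Σ ℕ λ r → i < j × Nth i r ρ × h r ≢ 0 × x + ⟦ c ⟧ ≡ suc (pre i l))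

attained-cons : ∀ {n} (h : ℕ → ℕ) y (ρ : Vec ℕ n) c m l j → pre j (rowU (Vec.map h ρ) (cellL c m (h y)) l) ≡ 0 →
  Attained h (y ∷ ρ) c (m ∷ l) (suc j) (pre (suc j) (rowU (Vec.map h (y ∷ ρ)) c (m ∷ l)))
attained-cons h y ρ true true l j z = inj₁ z
attained-cons h y ρ true false l j z = inj₁ z
attained-cons h y ρ false true l j z = inj₂ (inj₁ (1 , s≤s z≤n , cong suc (trans (+-identityʳ _) z)))
attained-cons h y ρ false false l j z with h y in eq
... | zero = inj₁ z
... | suc a = inj₂ (inj₂ (0 , y , s≤s z≤n , here , (λ e → 1+n≢0 (trans (sym eq) e)) , cong suc (trans (+-identityʳ _) z)))

rowU-attained : ∀ {n} (h : ℕ → ℕ) (ρ : Vec ℕ n) c l j → j ≤ n → Attained h ρ c l j (pre j (rowU (Vec.map h ρ) c l))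
rowU-attained h ρ c l zero p = inj₁ refl
rowU-attained h (y ∷ ρ) c (m ∷ l) (suc j) (s≤s p)
  with rowU-attained h ρ (cellL c m (h y)) l j p
... | inj₁ z = attained-cons h y ρ c m l j z
... | inj₂ (inj₁ (i , q , e)) = inj₂ (inj₁ (suc i , s≤s q ,
  trans (rowU-step (h y) (Vec.map h ρ) c m l j) (cong (⟦ m ⟧ +_) e)))
... | inj₂ (inj₂ (i , r , q , nth , nz , e)) =
  inj₂ (inj₂ (suc i , r , s≤s q , there nth , nz ,
    trans (rowU-step (h y) (Vec.map h ρ) c m l j) (trans (cong (⟦ m ⟧ +_) e) (+-suc ⟦ m ⟧ _))))

pre-par : ∀ {n} (u : Bits n) → odd (pre n u) ≡ par u
pre-par [] = refl
pre-par (true ∷ u) = cong not (pre-par u)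
pre-par (false ∷ u) = pre-par u

pre-suc : ∀ {n} (u : Bits n) j → pre (suc j) u ≡ pre j u ⊎ pre (suc j) u ≡ suc (pre j u)
pre-suc [] zero = inj₁ refl
pre-suc [] (suc j) = inj₁ refl
pre-suc (true ∷ u) zero = inj₂ refl
pre-suc (false ∷ u) zero = inj₁ refl
pre-suc (x ∷ u) (suc j) with pre-suc u j
... | inj₁ e = inj₁ (cong (⟦ x ⟧ +_) e)
... | inj₂ e = inj₂ (trans (cong (⟦ x ⟧ +_) e) (+-suc ⟦ x ⟧ _))

pre-zeros : ∀ n j → pre j (zeros {n}) ≡ 0
pre-zeros n zero = refl
pre-zeros zero (suc j) = refl
pre-zeros (suc n) (suc j) = pre-zeros n j

pre-0 : ∀ {n} (u : Bits n) → pre n u ≡ 0 → u ≡ zeros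
pre-0 [] e = refl
pre-0 (false ∷ u) e = cong (false ∷_) (pre-0 u e)

not-fixed : ∀ x → x ≢ not x
not-fixed true ()
not-fixed false ()

-- At the diagonal the heights are rounded to a common parity.
pre-round : ∀ {n} (u w : Bits (suc n)) → par u ≡ par w → pre n u ≤ pre n w → pre (suc n) u ≤ pre (suc n) w
pre-round {n} u w e p with pre-suc u n | pre-suc w n
... | inj₁ x | inj₁ y rewrite x | y = p
... | inj₁ x | inj₂ y rewrite x | y = m≤n⇒m≤1+n p
... | inj₂ x | inj₂ y rewrite x | y = s≤s p
... | inj₂ x | inj₁ y rewrite x | y with m≤n⇒m<n∨m≡n p
...   | inj₁ q = q
...   | inj₂ q = ⊥-elim (not-fixed (odd (pre n w)) (trans (trans (sym (cong odd y)) (trans (pre-par w)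
        (trans (sym e) (trans (sym (pre-par u)) (cong odd x))))) (cong (λ z → not (odd z)) q)))

cons-chain : ∀ {α} C → All (α ⋗_) C → Linked _⋗_ C → Linked _⋗_ (α ∷ C)
cons-chain [] [] l = [-]
cons-chain (β ∷ C) (p ∷ _) l = p ∷ l

-- The bound j on the positions of the rows is what allows a cell at position j to be put in front
-- of the chain.
Chain : ∀ {n} → (ℕ → ℕ → ℕ) → ℕ → Bits n → ℕ → List Pair → Set
Chain g e b j C = Linked _⋗_ C × All (Cell e b) C × All (λ α → g (proj₁ α) (proj₂ α) ≢ 0) C
  × All (λ α → First j (proj₁ α) (R e b)) C

-- Follows the candidates by which the count for `g` is attained. On the chain collected on the way
-- the same candidates are available, and `rowU-bound` and `rowU-bound-cell` make them lower bounds
-- for its count.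
trace : ∀ {n} g e (b : Bits n) t j → j ≤ n → Σ (List Pair) λ C → Chain g e b j C ×
  pre j (inL b (fillOf g e b) t) ≤ pre j (inL b (fillOf (ind C) e b) t)
trace-row : ∀ {n} g e (b : Bits n) c t j → j ≤ n → Σ (List Pair) λ C → Chain g e (true ∷ b) j C ×
  pre j (inL (true ∷ b) (fillOf g e (true ∷ b)) (c ∷ t)) ≤ pre j (inL (true ∷ b) (fillOf (ind C) e (true ∷ b)) (c ∷ t))

trace g e b t zero p = [] , ([] , [] , [] , []) , z≤n
trace g e (false ∷ b) (x ∷ t) (suc j) (s≤s p) with trace g (suc e) b t j p
... | C , (l , ce , nz , fi) , le = C ,
  (l , ce , nz , All.map (λ (i , q , nth) → suc i , s≤s q , there nth) fi) , +-monoʳ-≤ ⟦ x ⟧ le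
trace {suc n} g e (true ∷ b) (c ∷ t) (suc j) (s≤s p) with m≤n⇒m<n∨m≡n p
... | inj₁ q = trace-row g e b c t (suc j) q
-- The last label lies on the diagonal. The count up to it is determined by the preceding one and by
-- the parity, which the backward sweep preserves for any monomial.
... | inj₂ refl with trace-row g e b c t n ≤-refl
...   | C , (l , ce , nz , fi) , le = C , (l , ce , nz , All.map (λ (i , q , nth) → i , m≤n⇒m≤1+n q , nth) fi) ,
  pre-round (inL (true ∷ b) (fillOf g e (true ∷ b)) (c ∷ t)) (inL (true ∷ b) (fillOf (ind C) e (true ∷ b)) (c ∷ t))
    (trans (inL-par (true ∷ b) (fillOf g e (true ∷ b)) (c ∷ t)) (sym (inL-par (true ∷ b) (fillOf (ind C) e (true ∷ b)) (c ∷ t)))) le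

trace-row {n} g e b c t j p
  with rowU-attained (λ r → g r (suc e)) (R (suc e) b) c (inL b (fillOf g (suc e) b) t) j p
... | inj₁ z = [] , ([] , [] , [] , []) , ≤-trans (≤-reflexive z) z≤n
... | inj₂ (inj₁ (i , q , eq)) with trace g (suc e) b t i (≤-trans q p)
...   | C , (l , ce , nz , fi) , le = C ,
  (l , All.map inj₂ ce , nz , All.map (λ (k , q′ , nth) → k , <-≤-trans q′ q , Nth-∷ʳ nth) fi) ,
  +-cancelʳ-≤ ⟦ c ⟧ _ _ (≤-trans (≤-reflexive eq) (≤-trans le
    (rowU-bound (Vec.map (λ r → ind C r (suc e)) (R (suc e) b)) c (inL b (fillOf (ind C) (suc e) b) t) q)))
-- The elements found afterwards have positions below i and columns beyond `suc e`, so the new cell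
-- exceeds them all.
trace-row {n} g e b c t j p | inj₂ (inj₂ (i , r , q , nth , nzr , eq)) with trace g (suc e) b t i (≤-trans (<⇒≤ q) p)
...   | C , (l , ce , nz , fi) , le = (r , suc e) ∷ C ,
  (cons-chain C (All.zipWith (λ {α} ((k , q′ , nth′) , cell) → R-mono (suc e) b nth′ nth q′ , Cell-lower (suc e) b α cell) (fi , ce)) l ,
   inj₁ (refl , i , nth) ∷ All.map inj₂ ce , nzr ∷ nz ,
   (i , q , Nth-∷ʳ nth) ∷ All.map (λ (k , q′ , nth′) → k , <-trans q′ q , Nth-∷ʳ nth′) fi) ,
  +-cancelʳ-≤ ⟦ c ⟧ _ _ (≤-trans (≤-reflexive eq) (≤-trans (s≤s le) (≤-trans
    (≤-reflexive (cong (λ f → suc (pre i (inL b f t))) (fillOf-cong (suc e) b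
      (λ r′ c′ cell → sym (ind-skip r (suc e) C r′ c′ (λ e′ → <-irrefl (sym e′) (Cell-lower (suc e) b (r′ , c′) cell)))))))
    (rowU-bound-cell (λ r′ → ind ((r , suc e) ∷ C) r′ (suc e)) (R (suc e) b) c
      (inL b (fillOf (ind ((r , suc e) ∷ C)) (suc e) b) t) nth
      (λ z → 1+n≢0 (trans (sym (ind-head r (suc e) C)) z)) q))))

-- Each chain being dominated by w, its backward sweep from w ends with `zeros`; by `trace` so does
-- that of the whole monomial. Then w is the `top` of a monomial with residual `f`, and it dominates
-- the `top` of `f`.
top-chains : ∀ {n} g (b w : Bits n) → par (b ⊕ w) ≡ false →
  (∀ C → Linked _⋗_ C → All (Cell 0 b) C → All (λ α → g (proj₁ α) (proj₂ α) ≢ 0) C → Dom 0 (top b (fillOf (ind C) 0 b)) w) →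
  Dom 0 (top b (fillOf g 0 b)) w
top-chains {n} g b w e h with trace g 0 b (b ⊕ w) n ≤-refl
... | C , (l , ce , nz , _) , le = subst (λ x → Dom 0 (top b f) x) (trans (cong (b ⊕_) (out-inF b f (b ⊕ w))) (⊕-cancel b w))
  (outMono 0 b f (inF b f (b ⊕ w)) zeros (inL b f (b ⊕ w))
    (trans (zeros-par n) (cong (λ x → par (zeros {n}) xor par x) (sym L0)))
    (inF-compat b f (b ⊕ w)) (subst (Dom 0 zeros) (sym L0) (Dom-refl 0 (zeros {n}))))
  where
  f = fillOf g 0 b
  L0 : inL b f (b ⊕ w) ≡ zeros
  L0 = pre-0 _ (n≤0⇒n≡0 (≤-trans le (≤-reflexive
         (trans (cong (pre n) (top-inL b (fillOf (ind C) 0 b) w e (h C l ce nz))) (pre-zeros n n)))))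

top-mono : ∀ {n} {g h} (b : Bits n) → (∀ r c → g r c ≢ 0 → h r c ≢ 0) → Dom 0 (top b (fillOf g 0 b)) (top b (fillOf h 0 b))
top-mono {n} b k = outMono 0 b _ _ zeros zeros (zeros-par n) (fillOf-compat 0 b zeros k) (Dom-refl 0 (zeros {n}))

-- The sweep of a chain

bool-ext : ∀ {x y} → (x ≡ true → y ≡ true) → (y ≡ true → x ≡ true) → x ≡ y
bool-ext {true} {y} f g = sym (f refl)
bool-ext {false} {true} f g = g refl
bool-ext {false} {false} f g = refl

elemᵇ-here : ∀ x u → elemᵇ x (x ∷ u) ≡ true
elemᵇ-here x u rewrite ≡ᵇ-refl x = refl

elemᵇ-skip : ∀ x y u → x ≢ y → elemᵇ x (y ∷ u) ≡ elemᵇ x u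
elemᵇ-skip x y u h rewrite ≢⇒≡ᵇ x y h = refl

∈⇒elemᵇ : ∀ {x u} → x ∈ u → elemᵇ x u ≡ true
∈⇒elemᵇ {x} {u = _ ∷ u} (here refl) = elemᵇ-here x u
∈⇒elemᵇ {x} {u = y ∷ u} (there p) rewrite ∈⇒elemᵇ p = ∨-zeroʳ (x ≡ᵇ y)

elemᵇ⇒∈ : ∀ {x} u → elemᵇ x u ≡ true → x ∈ u
elemᵇ⇒∈ {x} (y ∷ u) e with x ≡ᵇ y in eq
... | true = here (≡ᵇ-true x y eq)
... | false = there (elemᵇ⇒∈ u e)

elemᵇ-false : ∀ {x u} → All (x ≢_) u → elemᵇ x u ≡ false
elemᵇ-false [] = refl
elemᵇ-false {x} {y ∷ u} (h ∷ hs) = trans (elemᵇ-skip x y u h) (elemᵇ-false hs)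

elemᵇ-++ : ∀ x u w → elemᵇ x (u ++ w) ≡ elemᵇ x u ∨ elemᵇ x w
elemᵇ-++ x [] w = refl
elemᵇ-++ x (y ∷ u) w = trans (cong ((x ≡ᵇ y) ∨_) (elemᵇ-++ x u w)) (sym (∨-assoc (x ≡ᵇ y) _ _))

Asc : ∀ {n} → Vec ℕ n → Set
Asc [] = ⊤
Asc (x ∷ xs) = (∀ {y} → y ∈ⱽ xs → x < y) × Asc xs

asc : ∀ {n} (xs : Vec ℕ n) → (∀ {i j x y} → Nth i x xs → Nth j y xs → i < j → x < y) → Asc xs
asc [] h = tt
asc (x ∷ xs) h = (λ (j , p) → h here (there p) (s≤s z≤n)) , asc xs (λ p q i<j → h (there p) (there q) (s≤s i<j))

R-asc : ∀ {n} e (b : Bits n) → Asc (R e b)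
R-asc e b = asc (R e b) (R-mono e b)

thereⱽ : ∀ {n x y} {xs : Vec ℕ n} → x ∈ⱽ xs → x ∈ⱽ (y ∷ xs)
thereⱽ (i , p) = suc i , there p

-- Labels are given by predicates on the non-members of v: `f` before the row, `f′` after it. `l` is
-- the label at c*, which is reflected into the row, and `c` the one that leaves it.
RowIs : ∀ {n} → (ℕ → ℕ) → (ℕ → Bool) → Vec ℕ n → Bool → Bool → (ℕ → Bool) → Set
RowIs g f ρ l c f′ = rowC (Vec.map g ρ) (Vec.map f ρ ∷ʳ l) ≡ c × rowL (Vec.map g ρ) (Vec.map f ρ ∷ʳ l) ≡ Vec.map f′ ρ

RowIs-∷ : ∀ {n} g f (x : ℕ) (ρ : Vec ℕ n) l k f′ {c} → RowIs g f ρ l k f′ →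
  cellC (f x) k (g x) ≡ c → cellL (f x) k (g x) ≡ f′ x → RowIs g f (x ∷ ρ) l c f′
RowIs-∷ g f x ρ l k f′ (p , q) r s rewrite p = r , cong₂ _∷_ s q

row-pass : ∀ {n} g f (ρ : Vec ℕ n) → (∀ {x} → x ∈ⱽ ρ → g x ≡ 0) → RowIs g f ρ false false f
row-pass g f [] h = refl , refl
row-pass g f (x ∷ ρ) h = RowIs-∷ g f x ρ false false f (row-pass g f ρ (λ p → h (thereⱽ p))) (proj₁ cell) (proj₂ cell)
  where
  cell : cellC (f x) false (g x) ≡ false × cellL (f x) false (g x) ≡ f x
  cell rewrite h (0 , here) with f x
  ... | true = refl , refl
  ... | false = refl , refl

-- A carry crosses an occupied cell without starting a line there. This is how a reflected line
-- cancels an element of the chain that is read in the same row.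
row-carry : ∀ {n} g f (ρ : Vec ℕ n) → (∀ {x} → x ∈ⱽ ρ → f x ≡ false) → RowIs g f ρ true true f
row-carry g f [] h = refl , refl
row-carry g f (x ∷ ρ) h = RowIs-∷ g f x ρ true true f (row-carry g f ρ (λ p → h (thereⱽ p))) (proj₁ cell) (proj₂ cell)
  where
  cell : cellC (f x) true (g x) ≡ true × cellL (f x) true (g x) ≡ f x
  cell rewrite h (0 , here) = refl , refl

RowIs-cong : ∀ {n} g f (ρ : Vec ℕ n) l c {f′ f″} → (∀ {x} → x ∈ⱽ ρ → f′ x ≡ f″ x) → RowIs g f ρ l c f′ → RowIs g f ρ l c f″
RowIs-cong g f ρ l c h (p , q) = p , trans q (map-cong-Nth ρ (λ x n → h (_ , n)))

-- The carry meets no line before it reaches m, where the two annihilate; the cells nearer the start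
-- of the row are empty and change nothing.
row-kill : ∀ {n} g f f′ m (ρ : Vec ℕ n) → Asc ρ → m ∈ⱽ ρ → f m ≡ true → f′ m ≡ false →
  (∀ {x} → x ∈ⱽ ρ → x ≢ m → f′ x ≡ f x) → (∀ {x} → x ∈ⱽ ρ → m < x → f x ≡ false) →
  (∀ {x} → x ∈ⱽ ρ → x ≤ m → g x ≡ 0) → RowIs g f ρ true false f′
row-kill g f f′ m (m ∷ ρ) (lt , _) (zero , here) e e′ same up gz =
  RowIs-∷ g f m ρ true true f′
    (RowIs-cong g f ρ true true (λ p → sym (same (thereⱽ p) (λ eq → <-irrefl (sym eq) (lt p)))) (row-carry g f ρ (λ p → up (thereⱽ p) (lt p))))
    (proj₁ cell) (proj₂ cell)
  where
  cell : cellC (f m) true (g m) ≡ false × cellL (f m) true (g m) ≡ f′ m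
  cell rewrite e | e′ = refl , refl
row-kill g f f′ m (x ∷ ρ) (lt , a) (suc i , there q) e e′ same up gz =
  RowIs-∷ g f x ρ true false f′
    (row-kill g f f′ m ρ a (i , q) e e′ (λ p → same (thereⱽ p)) (λ p → up (thereⱽ p)) (λ p → gz (thereⱽ p)))
    (proj₁ cell) (proj₂ cell)
  where
  x<m : x < m
  x<m = lt (i , q)
  cell : cellC (f x) false (g x) ≡ false × cellL (f x) false (g x) ≡ f′ x
  cell rewrite gz (0 , here) (<⇒≤ x<m) | same (0 , here) (<⇒≢ x<m) with f x
  ... | true = refl , refl
  ... | false = refl , refl

-- A new line starts at r, the labels to the right of r having absorbed the incoming carry l.
row-create : ∀ {n} g f f′ r l (ρ : Vec ℕ n) → Asc ρ → r ∈ⱽ ρ → g r ≢ 0 → f′ r ≡ true →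
  (∀ {x} → x ∈ⱽ ρ → x ≤ r → f x ≡ false) → (∀ {x} → x ∈ⱽ ρ → x < r → f′ x ≡ false) →
  (∀ {m} (ρ′ : Vec ℕ m) → Asc ρ′ → (∀ {x} → x ∈ⱽ ρ′ → x ∈ⱽ ρ) → (∀ {x} → x ∈ⱽ ρ → r < x → x ∈ⱽ ρ′) →
     (∀ {x} → x ∈ⱽ ρ′ → r < x) → RowIs g f ρ′ l false f′) →
  RowIs g f ρ l true f′
row-create g f f′ r l (r ∷ ρ) (lt , a) (zero , here) nz e down down′ up =
  RowIs-∷ g f r ρ l false f′ (up ρ a thereⱽ back lt) (proj₁ cell) (proj₂ cell)
  where
  back : ∀ {x} → x ∈ⱽ (r ∷ ρ) → r < x → x ∈ⱽ ρ
  back (zero , here) p = ⊥-elim (<-irrefl refl p)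
  back (suc i , there q) p = i , q
  cell : cellC (f r) false (g r) ≡ true × cellL (f r) false (g r) ≡ f′ r
  cell rewrite down (0 , here) ≤-refl | e with g r
  ... | zero = ⊥-elim (nz refl)
  ... | suc _ = refl , refl
row-create g f f′ r l (x ∷ ρ) (lt , a) (suc i , there q) nz e down down′ up =
  RowIs-∷ g f x ρ l true f′
    (row-create g f f′ r l ρ a (i , q) nz e (λ p → down (thereⱽ p)) (λ p → down′ (thereⱽ p))
      (λ ρ′ a′ sub sup → up ρ′ a′ (λ p → thereⱽ (sub p)) (λ p → sup′ ρ′ sup p)))
    (proj₁ cell) (proj₂ cell)
  where
  x<r : x < r
  x<r = lt (i , q)
  sup′ : ∀ {m} (ρ′ : Vec ℕ m) → (∀ {y} → y ∈ⱽ ρ → r < y → y ∈ⱽ ρ′) → ∀ {y} → y ∈ⱽ (x ∷ ρ) → r < y → y ∈ⱽ ρ′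
  sup′ ρ′ sup (zero , here) p = ⊥-elim (<-asym p x<r)
  sup′ ρ′ sup (suc j , there z) p = sup (j , z) p
  cell : cellC (f x) true (g x) ≡ true × cellL (f x) true (g x) ≡ f′ x
  cell rewrite down (0 , here) (<⇒≤ x<r) | down′ (0 , here) x<r = refl , refl

-- From each pair k, k* the one outside v, listed by k: the index that enters when the outgoing
-- label of k is true.
X : ∀ {n} → ℕ → Bits n → Vec ℕ n
X e [] = []
X {suc n} e (true ∷ b) = hi e n ∷ X (suc e) b
X e (false ∷ b) = suc e ∷ X (suc e) b

X-upper : ∀ {n i x} e (b : Bits n) → Nth i x (X e b) → x ≤ e + n + n
X-upper {suc n} e (true ∷ b) here = ≤-reflexive (sym (hi-eq e n))
X-upper {suc n} e (true ∷ b) (there p) = ≤-trans (X-upper (suc e) b p) (≤-trans (n≤1+n _) (≤-reflexive (sym (hi-eq e n))))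
X-upper {suc n} e (false ∷ b) here = subst (suc e ≤_) (sym (hi-eq e n)) (s≤s (m≤n⇒m≤1+n (≤-trans (m≤m+n e n) (m≤m+n (e + n) n))))
X-upper {suc n} e (false ∷ b) (there p) = ≤-trans (X-upper (suc e) b p) (≤-trans (n≤1+n _) (≤-reflexive (sym (hi-eq e n))))

-- Row entries of the elements left unpaired when each element of a chain is matched greedily with the next one if the
-- two are connected; they are the last elements of the connected components of odd length.
unpaired : ℕ → List Pair → List ℕ
unpaired d [] = []
unpaired d (α ∷ []) = proj₁ α ∷ []
unpaired d (α ∷ β ∷ C) = if connectedᵇ d α β then unpaired d C else proj₁ α ∷ unpaired d (β ∷ C)

if-intro : ∀ {A : Set} (P : A → Set) c {x y} → P x → P y → P (if c then x else y)
if-intro P true p q = p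
if-intro P false p q = q

unpaired-All : ∀ {P : ℕ → Set} d C → All (λ α → P (proj₁ α)) C → All P (unpaired d C)
unpaired-All d [] [] = []
unpaired-All d (α ∷ []) (p ∷ []) = p ∷ []
unpaired-All {P} d (α ∷ β ∷ C) (p ∷ q ∷ ps) =
  if-intro (All P) (connectedᵇ d α β) (unpaired-All d C ps) (p ∷ unpaired-All d (β ∷ C) (q ∷ ps))

unpaired-lone : ∀ d z C → z ∈ C → All (λ β → connectedᵇ d β z ≡ false) C →
  All (λ β → connectedᵇ d z β ≡ false) C → proj₁ z ∈ unpaired d C
unpaired-lone d z (z ∷ []) (here refl) h k = here refl
unpaired-lone d z (z ∷ β ∷ C) (here refl) h (_ ∷ k ∷ _) rewrite k = here refl
unpaired-lone d z (α ∷ z ∷ C) (there (here refl)) (h ∷ hs) (_ ∷ k) rewrite h =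
  there (unpaired-lone d z (z ∷ C) (here refl) hs k)
unpaired-lone d z (α ∷ β ∷ C) (there (there p)) (_ ∷ h ∷ hs) (_ ∷ k ∷ ks) =
  if-intro (proj₁ z ∈_) (connectedᵇ d α β) (unpaired-lone d z C p hs ks)
    (there (unpaired-lone d z (β ∷ C) (there p) (h ∷ hs) (k ∷ ks)))

All-before : ∀ {A : Set} {S : A → A → Set} L {x C} → AllPairs S (L ++ x ∷ C) → All (λ y → S y x) L
All-before [] p = []
All-before (y ∷ L) (h ∷ p) = All.lookup h (mid L) ∷ All-before L p
  where
  mid : ∀ L {x C} → x ∈ (L ++ x ∷ C)
  mid [] = here refl
  mid (_ ∷ L) = there (mid L)

Cell-row : ∀ {n} e (b : Bits n) α → Cell e b α → suc e < proj₁ α × proj₁ α < e + n + n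
Cell-row {suc n} e (true ∷ b) (r , c) (inj₁ (refl , i , p)) = R-lower (suc e) b p ,
  subst (r <_) (sym (hi-eq e n)) (s≤s (R-upper (suc e) b p))
Cell-row {suc n} e (true ∷ b) (r , c) (inj₂ p) with q , s ← Cell-row (suc e) b (r , c) p =
  <-trans (n<1+n _) q , <-≤-trans s (≤-trans (n≤1+n _) (≤-reflexive (sym (hi-eq e n))))
Cell-row {suc n} e (false ∷ b) (r , c) p with q , s ← Cell-row (suc e) b (r , c) p =
  <-trans (n<1+n _) q , <-≤-trans s (≤-trans (n≤1+n _) (≤-reflexive (sym (hi-eq e n))))

Cell-column : ∀ {n} e (b : Bits n) α → Cell e b α → proj₂ α ≤ e + n
Cell-column {suc n} e (true ∷ b) α (inj₁ (refl , _)) = subst (suc e ≤_) (sym (+-suc e n)) (s≤s (m≤m+n e n))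
Cell-column {suc n} e (true ∷ b) α (inj₂ p) = subst (proj₂ α ≤_) (sym (+-suc e n)) (Cell-column (suc e) b α p)
Cell-column {suc n} e (false ∷ b) α p = subst (proj₂ α ≤_) (sym (+-suc e n)) (Cell-column (suc e) b α p)

module Star (d e n : ℕ) (de : e + suc n ≡ d) where
  total : suc (d + d) ≡ suc e + hi e n
  total rewrite sym de = cong suc (trans (cong (e + suc n +_) (+-comm e (suc n)))
    (trans (sym (+-assoc (e + suc n) (suc n) e)) (trans (cong (_+ e) (hi-eq e n)) (+-comm (hi e n) e))))

  star-lo : star d (suc e) ≡ hi e n
  star-lo = trans (cong (_∸ suc e) total) (m+n∸m≡n (suc e) (hi e n))

  star-hi : star d (hi e n) ≡ suc e
  star-hi = trans (cong (_∸ hi e n) total) (m+n∸n≡m (suc e) (hi e n))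

  star-< : ∀ {c} → suc e < c → c ≤ d → star d c < hi e n
  star-< {c} p q = subst (star d c <_) star-lo (∸-monoʳ-< p (≤-trans q (≤-trans (m≤m+n d d) (n≤1+n _))))

  star-≥ : ∀ {c} → c ≤ suc e → hi e n ≤ star d c
  star-≥ {c} p = subst (_≤ star d c) star-lo (∸-monoʳ-≤ (suc (d + d)) p)

≤ᵇ-false : ∀ {m n} → n < m → (m ≤ᵇ n) ≡ false
≤ᵇ-false {m} {n} p with m ≤ᵇ n in eq
... | false = refl
... | true = ⊥-elim (<⇒≱ p (≤ᵇ⇒≤ m n (subst B.T (sym eq) tt)))

≤ᵇ-true : ∀ {m n} → m ≤ n → (m ≤ᵇ n) ≡ true
≤ᵇ-true {m} {n} p with m ≤ᵇ n in eq
... | true = refl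
... | false = ⊥-elim (subst B.T eq (≤⇒≤ᵇ p))

<ᵇ-false : ∀ {m n} → n ≤ m → (m <ᵇ n) ≡ false
<ᵇ-false {m} {n} p with m <ᵇ n in eq
... | false = refl
... | true = ⊥-elim (<⇒≱ (<ᵇ⇒< m n (subst B.T (sym eq) tt)) p)

<ᵇ-true : ∀ {m n} → m < n → (m <ᵇ n) ≡ true
<ᵇ-true {m} {n} p with m <ᵇ n in eq
... | true = refl
... | false = ⊥-elim (subst B.T eq (<⇒<ᵇ p))

∧-false₂ : ∀ {x y} → y ≡ false → x ∧ y ≡ false
∧-false₂ {true} e = e
∧-false₂ {false} e = refl

top-row : ℕ → Pair → ℕ
top-row d α = star d (proj₂ α)

-- The row indices of S_C: the first part comes from the p_v(α), the second from p_h of the last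
-- elements of odd components. `Z` differs from `C` during the sweep, when earlier elements may
-- still await a partner.
changed : ℕ → List Pair → List Pair → ℕ → Bool
changed d C Z x = elemᵇ x (map (top-row d) C) ∨ elemᵇ x (unpaired d Z)

live : List Pair → ℕ → Bool
live L x = elemᵇ x (map proj₁ L)

Past : ∀ {n} → ℕ → Bits n → Pair → Set
Past e b (r , c) = c ≤ e × (r ∈ⱽ R e b ⊎ r ≤ e)

module _ (d : ℕ) where
  CellHead : ∀ {n} → ℕ → Bits n → List Pair → Set
  CellHead e b C = All (Cell (suc e) b) C ⊎
    (Σ ℕ λ r → Σ (List Pair) λ C′ → C ≡ (r , suc e) ∷ C′ × r ∈ⱽ R (suc e) b × All (Cell (suc e) b) C′)

  later : ∀ {n} e (b : Bits n) C → All (λ α → suc e < proj₂ α) C → All (Cell e (true ∷ b)) C → All (Cell (suc e) b) C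
  later e b [] [] [] = []
  later e b (α ∷ C) (p ∷ ps) (inj₁ (q , _) ∷ qs) = ⊥-elim (<-irrefl (sym q) p)
  later e b (α ∷ C) (p ∷ ps) (inj₂ q ∷ qs) = q ∷ later e b C ps qs

  cellHead : ∀ {n} e (b : Bits n) C → AllPairs _⋗_ C → All (Cell e (true ∷ b)) C → CellHead e b C
  cellHead e b [] ap [] = inj₁ []
  cellHead e b ((r , c) ∷ C) (p ∷ ap) (inj₁ (refl , m) ∷ qs) = inj₂ (r , C , refl , m , later e b C (All.map (λ {α} → proj₂) p) qs)
  cellHead e b (α ∷ C) (p ∷ ap) (inj₂ q ∷ qs) =
    inj₁ (q ∷ later e b C (All.map (λ z → <-trans (Cell-lower (suc e) b α q) (proj₂ z)) p) qs)

  module Column {n} (e : ℕ) (b : Bits n) (de : e + suc n ≡ d) where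
    open Star d e n de public
    h = hi e n

    Good : Pair → Set
    Good (r , c) = c ≤ suc e × (r ∈ⱽ R (suc e) b ⊎ r ≤ e)

    R<h : ∀ {x} → x ∈ⱽ R (suc e) b → x < h
    R<h (i , p) = s≤s (R-upper (suc e) b p)

    X<h : ∀ {i x} → Nth i x (X (suc e) b) → x < h
    X<h p = s≤s (X-upper (suc e) b p)

    e<h : e < h
    e<h = s≤s (m≤n⇒m≤1+n (≤-trans (m≤m+n e n) (m≤m+n (e + n) n)))

    Good<h : ∀ {α} → Good α → proj₁ α < h
    Good<h (_ , inj₁ p) = R<h p
    Good<h (_ , inj₂ p) = ≤-<-trans p e<h

    Cell<h : ∀ {α} → Cell (suc e) b α → proj₁ α < h
    Cell<h {α} p = s≤s (<⇒≤ (proj₂ (Cell-row (suc e) b α p)))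

    Cell-star : ∀ {α} → Cell (suc e) b α → top-row d α < h
    Cell-star {α} p = star-< (Cell-lower (suc e) b α p) (subst (proj₂ α ≤_) (trans (sym (+-suc e n)) de) (Cell-column (suc e) b α p))

    Past-suc : ∀ {α} → Past e (true ∷ b) α → proj₁ α < h → Good α
    Past-suc (p , inj₂ q) lt = m≤n⇒m≤1+n p , inj₂ q
    Past-suc (p , inj₁ (i , q)) lt with Nth-∷ʳ⁻ (R (suc e) b) q
    ... | inj₁ q′ = m≤n⇒m≤1+n p , inj₁ (i , q′)
    ... | inj₂ (_ , refl) = ⊥-elim (<-irrefl refl lt)

    Past≤h : ∀ {α} → Past e (true ∷ b) α → proj₁ α ≤ h
    Past≤h {α} (p , inj₁ (i , q)) = subst (proj₁ α ≤_) (hi-eq e n) (R-upper e (true ∷ b) q)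
    Past≤h (p , inj₂ q) = ≤-trans q (<⇒≤ e<h)

    not-live : ∀ {L x} → All (λ α → x ≢ proj₁ α) L → live L x ≡ false
    not-live {L} {x} p = elemᵇ-false {x} {map proj₁ L} (map⁺ p)

    conn-head : ∀ {α c} → Cell (suc e) b α → connectedᵇ d (h , c) α ≡ false
    conn-head {α} p rewrite ≤ᵇ-false (Cell-star p) = refl

    conn-stale : ∀ {α c} → proj₁ α ≤ e → connectedᵇ d (h , c) α ≡ false
    conn-stale {α} p = ∧-false₂ {h ≤ᵇ star d (proj₂ α)} (trans (cong (_<ᵇ proj₁ α) star-hi) (<ᵇ-false (m≤n⇒m≤1+n p)))

    -- Connectedness is recognised as the meeting of two lines: α has started by column `suc e` =
    -- h*, and its row is still ahead, so the line reflected from h runs into that of α.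
    conn-good : ∀ {α c} → proj₂ α ≤ suc e → proj₁ α ∈ⱽ R (suc e) b → connectedᵇ d (h , c) α ≡ true
    conn-good p (i , q) rewrite ≤ᵇ-true (star-≥ p) | star-hi = <ᵇ-true (R-lower (suc e) b q)

    h∉unpaired : ∀ Z → All (λ α → proj₁ α < h) Z → elemᵇ h (unpaired d Z) ≡ false
    h∉unpaired Z p = elemᵇ-false {h} {unpaired d Z} (unpaired-All d Z (All.map (λ q eq → <-irrefl (sym eq) q) p))

    h∉tops : ∀ C → All (Cell (suc e) b) C → elemᵇ h (map (top-row d) C) ≡ false
    h∉tops C p = elemᵇ-false {h} {map (top-row d) C} (map⁺ (All.map (λ q eq → <-irrefl (sym eq) (Cell-star q)) p))

    Later : List Pair → List Pair → Set
    Later L C = out b (fillOf (ind C) (suc e) b) (Vec.map (live L) (R (suc e) b)) ≡ Vec.map (changed d C (L ++ C)) (X (suc e) b)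

    assemble : ∀ L L′ C C′ Z k → All (Cell (suc e) b) C′ →
      RowIs (λ r → ind C r (suc e)) (live L) (R (suc e) b) (live L h) k (live L′) →
      fillOf (ind C) (suc e) b ≡ fillOf (ind C′) (suc e) b → Later L′ C′ →
      k ≡ changed d C Z h → (∀ {x} → x < h → changed d C′ (L′ ++ C′) x ≡ changed d C Z x) →
      out (true ∷ b) (fillOf (ind C) e (true ∷ b)) (Vec.map (live L) (R e (true ∷ b))) ≡ Vec.map (changed d C Z) (X e (true ∷ b))
    assemble L L′ C C′ Z k cells (p , q) fe ih ke xe
      rewrite map-∷ʳ (live L) h (R (suc e) b) | p | q | fe =
      cong₂ _∷_ ke (trans ih (map-cong-Nth (X (suc e) b) (λ x nth → xe (X<h nth))))

    ind-later : ∀ C → All (Cell (suc e) b) C → ∀ x → ind C x (suc e) ≡ 0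
    ind-later C p x with ind C x (suc e) in eq
    ... | zero = refl
    ... | suc k = ⊥-elim (ind-support {λ _ c → c ≢ suc e} C x (suc e)
            (All.map (λ {α} q eq′ → <-irrefl (sym eq′) (Cell-lower (suc e) b α q)) p)
            (λ z → 1+n≢0 (trans (sym eq) z)) refl)

    ind-other : ∀ r C → All (Cell (suc e) b) C → ∀ {x} → x ≢ r → ind ((r , suc e) ∷ C) x (suc e) ≡ 0
    ind-other r C p {x} ne rewrite ≢⇒≡ᵇ x r ne = ind-later C p x

    fill-skip : ∀ r C → fillOf (ind ((r , suc e) ∷ C)) (suc e) b ≡ fillOf (ind C) (suc e) b
    fill-skip r C = fillOf-cong (suc e) b
      (λ r′ c′ cell → ind-skip r (suc e) C r′ c′ (λ e′ → <-irrefl (sym e′) (Cell-lower (suc e) b (r′ , c′) cell)))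

    live-skip : ∀ α L {x} → x ≢ proj₁ α → live (α ∷ L) x ≡ live L x
    live-skip α L {x} ne = elemᵇ-skip x (proj₁ α) (map proj₁ L) ne

    live-++ : ∀ L M x → live (L ++ M) x ≡ live L x ∨ live M x
    live-++ L M x = trans (cong (elemᵇ x) (map-++ proj₁ L M)) (elemᵇ-++ x (map proj₁ L) (map proj₁ M))

    live-snoc : ∀ L α {x} → x ≢ proj₁ α → live (L ++ α ∷ []) x ≡ live L x
    live-snoc L α {x} ne = trans (live-++ L (α ∷ []) x)
      (trans (cong (live L x ∨_) (elemᵇ-skip x (proj₁ α) [] ne)) (∨-identityʳ _))

    live-last : ∀ L α → live (L ++ α ∷ []) (proj₁ α) ≡ true
    live-last L α = trans (live-++ L (α ∷ []) (proj₁ α))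
      (trans (cong (live L (proj₁ α) ∨_) (elemᵇ-here (proj₁ α) [])) (∨-zeroʳ _))

    below-live : ∀ {L r} → All (λ α → r < proj₁ α) L → ∀ {x} → x ≤ r → live L x ≡ false
    below-live {L} p x≤r = not-live {L} (All.map (λ q eq → <⇒≱ q (subst (_≤ _) eq x≤r)) p)

    above-live : ∀ {L r} → All (λ α → proj₁ α < r) L → ∀ {x} → r ≤ x → live L x ≡ false
    above-live {L} p r≤x = not-live {L} (All.map (λ q eq → <⇒≱ q (subst (_ ≤_) eq r≤x)) p)

    changed-skip : ∀ r C Z Z′ → unpaired d Z ≡ unpaired d Z′ → ∀ {x} → x < h →
      changed d C Z x ≡ changed d ((r , suc e) ∷ C) Z′ x
    changed-skip r C Z Z′ eq {x} lt = cong₂ _∨_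
      (sym (elemᵇ-skip x (star d (suc e)) (map (top-row d) C) (λ z → <-irrefl (trans z star-lo) lt))) (cong (elemᵇ x) eq)

    changed-top : ∀ r C Z → true ≡ changed d ((r , suc e) ∷ C) Z h
    changed-top r C Z = sym (cong (_∨ elemᵇ h (unpaired d Z))
      (trans (cong (λ y → elemᵇ h (y ∷ map (top-row d) C)) star-lo) (elemᵇ-here h (map (top-row d) C))))

    unchanged-top : ∀ C Z Z′ → All (Cell (suc e) b) C → All (λ α → proj₁ α < h) Z →
      unpaired d Z ≡ unpaired d Z′ → false ≡ changed d C Z′ h
    unchanged-top C Z Z′ p q eq = sym (cong₂ _∨_ (h∉tops C p) (trans (cong (elemᵇ h) (sym eq)) (h∉unpaired Z q)))

    unpaired-dead : ∀ c L C → All (λ α → proj₁ α ≤ e) L → All (Cell (suc e) b) C →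
      unpaired d ((h , c) ∷ L ++ C) ≡ h ∷ unpaired d (L ++ C)
    unpaired-dead c [] [] p q = refl
    unpaired-dead c [] (γ ∷ C) p (q ∷ _) rewrite conn-head {c = c} q = refl
    unpaired-dead c (γ ∷ L) C (p ∷ _) q rewrite conn-stale {γ} {c} p = refl

    unpaired-pair : ∀ c β L → proj₂ β ≤ suc e → proj₁ β ∈ⱽ R (suc e) b →
      unpaired d ((h , c) ∷ β ∷ L) ≡ unpaired d L
    unpaired-pair c β L p q rewrite conn-good {β} {c} p q = refl

    R-live-dead : ∀ {c L} → All (λ α → proj₁ α ≤ e) L → ∀ {x} → x ∈ⱽ R (suc e) b → live ((h , c) ∷ L) x ≡ false
    R-live-dead {c} {L} p {x} m@(i , q) = not-live {(h , c) ∷ L} ((λ eq → <-irrefl eq (R<h m)) ∷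
      All.map (λ q′ eq → <⇒≱ (R-lower (suc e) b q) (≤-trans (≤-reflexive eq) (m≤n⇒m≤1+n q′))) p)

    paired-kill : ∀ {k} c β L C → All (λ γ → proj₁ γ < proj₁ β) L → (ρ : Vec ℕ k) → Asc ρ → proj₁ β ∈ⱽ ρ →
      (∀ {x} → x ∈ⱽ ρ → x < h) → (∀ {x} → x ∈ⱽ ρ → x ≤ proj₁ β → ind C x (suc e) ≡ 0) →
      RowIs (λ r → ind C r (suc e)) (live ((h , c) ∷ β ∷ L)) ρ true false (live L)
    paired-kill c β L C lt ρ a m ρ<h gz = row-kill _ (live ((h , c) ∷ β ∷ L)) (live L) (proj₁ β) ρ a m
      (trans (live-skip (h , c) (β ∷ L) (<⇒≢ (ρ<h m))) (elemᵇ-here (proj₁ β) (map proj₁ L)))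
      (above-live {L} lt ≤-refl)
      (λ p ne → sym (trans (live-skip (h , c) (β ∷ L) (<⇒≢ (ρ<h p))) (live-skip β L ne)))
      (λ p q → trans (live-skip (h , c) (β ∷ L) (<⇒≢ (ρ<h p))) (trans (live-skip β L (>⇒≢ q)) (above-live {L} lt (<⇒≤ q))))
      gz

    Good⇒Past : ∀ {α} → Good α → Past (suc e) b α
    Good⇒Past (p , inj₁ q) = p , inj₁ q
    Good⇒Past (p , inj₂ q) = p , inj₂ (m≤n⇒m≤1+n q)

    -- Rows decrease along L, so only its first element can have the row h = c*, whose line is now
    -- reflected. In `paired` a second line is running and will be hit; in `stale` the other lines
    -- have left already.
    data PastHead : List Pair → Set where
      lower : ∀ {L} → All Good L → PastHead L
      only : ∀ c → PastHead ((h , c) ∷ [])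
      stale : ∀ c L → All Good L → All (λ α → proj₁ α ≤ e) L → L ≢ [] → PastHead ((h , c) ∷ L)
      paired : ∀ c β L → proj₂ β ≤ suc e → proj₁ β ∈ⱽ R (suc e) b → All Good L → PastHead ((h , c) ∷ β ∷ L)

    pastHead : ∀ L → AllPairs _⋗_ L → All (Past e (true ∷ b)) L → PastHead L
    pastHead [] ap pa = lower []
    pastHead (α ∷ L) (gt ∷ ap) (p ∷ pa) with proj₁ α ≟ h
    ... | no ne = lower (Past-suc p lt ∷ All.zipWith (λ (g , q) → Past-suc q (<-trans (proj₁ g) lt)) (gt , pa))
      where lt = ≤∧≢⇒< (Past≤h p) ne
    pastHead (α ∷ []) (gt ∷ ap) (p ∷ pa) | yes refl = only (proj₂ α)
    pastHead (α ∷ β ∷ L) ((gtβ ∷ gt) ∷ (gt′ ∷ ap)) (p ∷ q ∷ pa) | yes refl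
      with Past-suc q (proj₁ gtβ) | All.zipWith (λ (g , q) → Past-suc q (proj₁ g)) (gt , pa)
    ... | (c , inj₁ m) | good = paired (proj₂ α) β L c m good
    ... | (c , inj₂ m) | good = stale (proj₂ α) (β ∷ L) ((c , inj₂ m) ∷ good)
            (m ∷ All.map (λ g → ≤-trans (<⇒≤ (proj₁ g)) m) gt′) (λ ())

  AllPairs-++ʳ : ∀ {A : Set} {S : A → A → Set} L {C} → AllPairs S (L ++ C) → AllPairs S C
  AllPairs-++ʳ [] p = p
  AllPairs-++ʳ (x ∷ L) (_ ∷ p) = AllPairs-++ʳ L p

  AllPairs-++ˡ : ∀ {A : Set} {S : A → A → Set} L {C} → AllPairs S (L ++ C) → AllPairs S L
  AllPairs-++ˡ [] p = []
  AllPairs-++ˡ (x ∷ L) (h ∷ p) = ++⁻ˡ L h ∷ AllPairs-++ˡ L p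

  -- No row exceeds (e + 1)*, so an element with row e + 1 is connected to none and remains
  -- unpaired. Conversely the elements still to be read have larger rows, and their p_v contribute
  -- row indices beyond d.
  low-label : ∀ {n} e (b : Bits n) L C → e + suc n ≡ d → All (Past e (false ∷ b)) L → All (Cell (suc e) b) C →
    live L (suc e) ≡ changed d C (L ++ C) (suc e)
  low-label {n} e b L C de pa ce = bool-ext to from
    where
    open Star d e n de
    bound : ∀ {α} → Past e (false ∷ b) α → proj₁ α ≤ hi e n
    bound {α} (_ , inj₁ (i , p)) = subst (proj₁ α ≤_) (hi-eq e n) (R-upper e (false ∷ b) p)
    bound (_ , inj₂ p) = ≤-trans p (m≤n⇒m≤1+n (m≤n⇒m≤1+n (≤-trans (m≤m+n e n) (m≤m+n (e + n) n))))
    bounds : All (λ α → proj₁ α ≤ hi e n) (L ++ C)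
    bounds = ++⁺ (All.map (λ {α} → bound {α}) pa) (All.map (λ {α} p → m≤n⇒m≤1+n (<⇒≤ (proj₂ (Cell-row (suc e) b α p)))) ce)
    to : live L (suc e) ≡ true → changed d C (L ++ C) (suc e) ≡ true
    to eq with ∈-map⁻ proj₁ (elemᵇ⇒∈ (map proj₁ L) eq)
    ... | z , z∈L , refl = trans (cong (elemᵇ (suc e) (map (top-row d) C) ∨_)
        (∈⇒elemᵇ (unpaired-lone d z (L ++ C) (∈-++⁺ˡ z∈L)
          (All.map (λ {β} p → ∧-false₂ {proj₁ β ≤ᵇ star d (proj₂ z)} (<ᵇ-false (subst (_≤ star d (proj₁ β)) star-hi (∸-monoʳ-≤ (suc (d + d)) p)))) bounds)
          (All.map (λ {β} p → ∧-false₂ {suc e ≤ᵇ star d (proj₂ β)} (<ᵇ-false (subst (proj₁ β ≤_) (sym star-lo) p))) bounds)))) (∨-zeroʳ (elemᵇ (suc e) (map (top-row d) C)))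
    high : ∀ {α} → Cell (suc e) b α → suc e ≢ top-row d α
    high {α} p eq = <⇒≱ (≤-trans (s≤s (subst (suc e ≤_) (trans (sym (+-suc e n)) de) (s≤s (m≤m+n e n))))
      (≤-trans (≤-reflexive (sym (m+n∸n≡m (suc d) d))) (∸-monoʳ-≤ (suc (d + d))
        (subst (proj₂ α ≤_) (trans (sym (+-suc e n)) de) (Cell-column (suc e) b α p))))) (≤-reflexive (sym eq))
    from : changed d C (L ++ C) (suc e) ≡ true → live L (suc e) ≡ true
    from eq rewrite elemᵇ-false {suc e} {map (top-row d) C} (map⁺ (All.map (λ {α} → high {α}) ce)) =
      All.lookup (unpaired-All {λ x → x ≡ suc e → live L (suc e) ≡ true} d (L ++ C)
        (++⁺ (All.tabulate (λ m → λ { refl → ∈⇒elemᵇ (∈-map⁺ proj₁ m) }))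
             (All.map (λ {α} p eq′ → ⊥-elim (<-asym (proj₁ (Cell-row (suc e) b α p)) (subst (_< suc (suc e)) (sym eq′) (n<1+n _)))) ce)))
        (elemᵇ⇒∈ (unpaired d (L ++ C)) eq) refl

  -- L holds the elements already read whose line has not been annihilated, C those still to be read.
  exact : ∀ {n} e (b : Bits n) L C → e + n ≡ d → AllPairs _⋗_ (L ++ C) → All (Past e b) L → All (Cell e b) C →
    out b (fillOf (ind C) e b) (Vec.map (live L) (R e b)) ≡ Vec.map (changed d C (L ++ C)) (X e b)
  exact-column : ∀ {n} e (b : Bits n) L C → (de : e + suc n ≡ d) → AllPairs _⋗_ (L ++ C) →
    Column.PastHead e b de L → CellHead e b C →
    out (true ∷ b) (fillOf (ind C) e (true ∷ b)) (Vec.map (live L) (R e (true ∷ b))) ≡ Vec.map (changed d C (L ++ C)) (X e (true ∷ b))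

  exact e [] L C de ap pa ce = refl
  exact {suc n} e (true ∷ b) L C de ap pa ce =
    exact-column e b L C de ap (Column.pastHead e b de L (AllPairs-++ˡ L ap) pa) (cellHead e b C (AllPairs-++ʳ L ap) ce)
  exact {suc n} e (false ∷ b) L C de ap pa ce = cong₂ _∷_ (low-label e b L C de pa ce)
    (exact (suc e) b L C (trans (sym (+-suc e n)) de) ap (All.map (λ {α} → step {α}) pa) ce)
    where
    step : ∀ {α} → Past e (false ∷ b) α → Past (suc e) b α
    step (p , inj₂ q) = m≤n⇒m≤1+n p , inj₂ (m≤n⇒m≤1+n q)
    step (p , inj₁ (zero , here)) = m≤n⇒m≤1+n p , inj₂ ≤-refl
    step (p , inj₁ (suc i , there q)) = m≤n⇒m≤1+n p , inj₁ (i , q)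

  exact-column {n} e b L C de ap ph ch = go L C ap ph ch
    where
    open Column e b de
    de′ : suc e + n ≡ d
    de′ = trans (sym (+-suc e n)) de
    ρ = R (suc e) b
    g : List Pair → ℕ → ℕ
    g C r = ind C r (suc e)
    Goal : List Pair → List Pair → Set
    Goal L C = out (true ∷ b) (fillOf (ind C) e (true ∷ b)) (Vec.map (live L) (R e (true ∷ b))) ≡
      Vec.map (changed d C (L ++ C)) (X e (true ∷ b))
    with-label : ∀ {l l′ f k f′} C → l ≡ l′ → RowIs (g C) f ρ l′ k f′ → RowIs (g C) f ρ l k f′
    with-label C refl p = p
    -- With no line to meet, the reflected line leaves at the column itself; its element is the last
    -- of an odd component.
    dead : ∀ c L C → AllPairs _⋗_ (L ++ C) → All Good L → All (λ α → proj₁ α ≤ e) L → All (Cell (suc e) b) C →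
      Goal ((h , c) ∷ L) C
    dead c L C ap pa le ce = assemble ((h , c) ∷ L) L C C ((h , c) ∷ L ++ C) true ce
      (with-label C (elemᵇ-here h (map proj₁ L))
        (RowIs-cong (g C) (live ((h , c) ∷ L)) ρ true true (λ p → live-skip (h , c) L (<⇒≢ (R<h p)))
          (row-carry (g C) (live ((h , c) ∷ L)) ρ (R-live-dead {c} le))))
      refl (exact (suc e) b L C de′ ap (All.map (λ {α} → Good⇒Past {α}) pa) ce)
      (sym (trans (cong (λ u → elemᵇ h (map (top-row d) C) ∨ elemᵇ h u) (unpaired-dead c L C le ce))
        (trans (cong (elemᵇ h (map (top-row d) C) ∨_) (elemᵇ-here h (unpaired d (L ++ C)))) (∨-zeroʳ (elemᵇ h (map (top-row d) C))))))
      (λ {x} lt → cong (elemᵇ x (map (top-row d) C) ∨_)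
        (sym (trans (cong (elemᵇ x) (unpaired-dead c L C le ce)) (elemᵇ-skip x h (unpaired d (L ++ C)) (<⇒≢ lt)))))
    go : ∀ L C → AllPairs _⋗_ (L ++ C) → PastHead L → CellHead e b C → Goal L C
    go L C ap (lower pa) (inj₁ ce) = assemble L L C C (L ++ C) false ce
      (with-label C (above-live {L} (All.map (λ {α} → Good<h {α}) pa) ≤-refl) (row-pass (g C) (live L) ρ (λ {x} _ → ind-later C ce x)))
      refl (exact (suc e) b L C de′ ap (All.map (λ {α} → Good⇒Past {α}) pa) ce)
      (unchanged-top C (L ++ C) (L ++ C) ce (++⁺ (All.map (λ {α} → Good<h {α}) pa) (All.map (λ {α} → Cell<h {α}) ce)) refl) (λ _ → refl)
    go L .((r , suc e) ∷ C) ap (lower pa) (inj₂ (r , C , refl , m , ce)) = assemble L (L ++ α ∷ []) (α ∷ C) C (L ++ α ∷ C) true ce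
      (with-label (α ∷ C) (above-live {L} (All.map (λ {α} → Good<h {α}) pa) ≤-refl)
        (row-create (g (α ∷ C)) (live L) (live (L ++ α ∷ [])) r false ρ (R-asc (suc e) b) m (λ z → 1+n≢0 (trans (sym (ind-head r (suc e) C)) z))
          (live-last L α) (λ _ → below-live {L} before)
          (λ _ lt → trans (live-snoc L α (<⇒≢ lt)) (below-live {L} before (<⇒≤ lt)))
          (λ ρ′ _ _ _ gt → RowIs-cong (g (α ∷ C)) (live L) ρ′ false false (λ p → sym (live-snoc L α (>⇒≢ (gt p))))
            (row-pass (g (α ∷ C)) (live L) ρ′ (λ p → ind-other r C ce (>⇒≢ (gt p)))))))
      (fill-skip r C)
      (exact (suc e) b (L ++ α ∷ []) C de′ (subst (AllPairs _⋗_) (sym (++-assoc L (α ∷ []) C)) ap)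
        (++⁺ (All.map (λ {α} → Good⇒Past {α}) pa) ((≤-refl , inj₁ m) ∷ [])) ce)
      (changed-top r C (L ++ α ∷ C))
      (changed-skip r C ((L ++ α ∷ []) ++ C) (L ++ α ∷ C) (cong (unpaired d) (++-assoc L (α ∷ []) C)))
      where
      α = (r , suc e)
      before : All (λ β → r < proj₁ β) L
      before = All.map (λ {α} → proj₁) (All-before L ap)
    go .((hi e n , c) ∷ []) C (gt ∷ ap) (only c) (inj₁ ce) = dead c [] C ap [] [] ce
    go .((hi e n , c) ∷ L) C (gt ∷ ap) (stale c L pa le _) (inj₁ ce) = dead c L C ap pa le ce
    -- The carry passes over the new cell, which therefore starts no line. The two elements form a
    -- connected pair, and the label leaving now accounts for p_v of the new one.
    go .((hi e n , c) ∷ []) .((r , suc e) ∷ C) (gt ∷ (_ ∷ ap)) (only c) (inj₂ (r , C , refl , m , ce)) =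
      assemble ((h , c) ∷ []) [] ((r , suc e) ∷ C) C ((h , c) ∷ (r , suc e) ∷ C) true ce
        (with-label ((r , suc e) ∷ C) (elemᵇ-here h [])
          (RowIs-cong (g ((r , suc e) ∷ C)) (live ((h , c) ∷ [])) ρ true true (λ p → live-skip (h , c) [] (<⇒≢ (R<h p)))
            (row-carry (g ((r , suc e) ∷ C)) (live ((h , c) ∷ [])) ρ (R-live-dead {c} []))))
        (fill-skip r C) (exact (suc e) b [] C de′ ap [] ce)
        (changed-top r C ((h , c) ∷ (r , suc e) ∷ C))
        (changed-skip r C C ((h , c) ∷ (r , suc e) ∷ C) (sym (unpaired-pair c (r , suc e) C ≤-refl m)))
    -- A new element has a row beyond e + 1, but smaller than the rows of the stale lines, which are
    -- at most e.
    go .((hi e n , c) ∷ L) .((r , suc e) ∷ C) (gt ∷ ap) (stale c L pa le ne) (inj₂ (r , C , refl , (i , m) , ce)) =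
      ⊥-elim (impossible L ne le (All-before L ap))
      where
      impossible : ∀ L → L ≢ [] → All (λ β → proj₁ β ≤ e) L → All (_⋗ (r , suc e)) L → ⊥
      impossible [] ne _ _ = ne refl
      impossible (β ∷ L) ne (p ∷ _) (q ∷ _) = <-asym (R-lower (suc e) b m) (≤-trans (proj₁ q) (m≤n⇒m≤1+n p))
    -- The reflected line and that of β annihilate, so nothing leaves at this column.
    go .((hi e n , c) ∷ β ∷ L) C (_ ∷ gt ∷ ap) (paired c β L cβ m pa) (inj₁ ce) =
      assemble ((h , c) ∷ β ∷ L) L C C ((h , c) ∷ β ∷ L ++ C) false ce
        (with-label C (elemᵇ-here h (map proj₁ (β ∷ L)))
          (paired-kill c β L C (++⁻ˡ L (All.map (λ {α} → proj₁) gt)) ρ (R-asc (suc e) b) m R<h (λ {x} _ _ → ind-later C ce x)))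
        refl (exact (suc e) b L C de′ ap (All.map (λ {α} → Good⇒Past {α}) pa) ce)
        (unchanged-top C (L ++ C) ((h , c) ∷ β ∷ L ++ C) ce (++⁺ (All.map (λ {α} → Good<h {α}) pa) (All.map (λ {α} → Cell<h {α}) ce))
          (sym (unpaired-pair c β (L ++ C) cβ m)))
        (λ {x} _ → cong (λ u → elemᵇ x (map (top-row d) C) ∨ elemᵇ x u) (sym (unpaired-pair c β (L ++ C) cβ m)))
    -- Since r is smaller than the row of β, the reflected line is annihilated by that of β before
    -- it reaches r, and the new element starts a line of its own.
    go .((hi e n , c) ∷ β ∷ L) .((r , suc e) ∷ C) (_ ∷ gt ∷ ap) (paired c β L cβ m pa) (inj₂ (r , C , refl , mr , ce)) =
      assemble Λ (L ++ α ∷ []) (α ∷ C) C (Λ ++ α ∷ C) true ce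
        (with-label (α ∷ C) (elemᵇ-here h (map proj₁ (β ∷ L)))
          (row-create (g (α ∷ C)) (live Λ) (live (L ++ α ∷ [])) r true ρ (R-asc (suc e) b) mr
            (λ z → 1+n≢0 (trans (sym (ind-head r (suc e) C)) z)) (live-last L α)
            (λ p → below-live {Λ} ((<-trans r<β β<h) ∷ r<β ∷ before))
            (λ _ lt → trans (live-snoc L α (<⇒≢ lt)) (below-live {L} before (<⇒≤ lt)))
            (λ ρ′ a sub sup gt′ → RowIs-cong (g (α ∷ C)) (live Λ) ρ′ true false
              (λ p → sym (live-snoc L α (>⇒≢ (gt′ p))))
              (paired-kill c β L (α ∷ C) (++⁻ˡ L (All.map (λ {α} → proj₁) gt)) ρ′ a (sup m r<β) (λ p → R<h (sub p))
                (λ p _ → ind-other r C ce (>⇒≢ (gt′ p)))))))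
        (fill-skip r C)
        (exact (suc e) b (L ++ α ∷ []) C de′ (subst (AllPairs _⋗_) (sym (++-assoc L (α ∷ []) C)) ap)
          (++⁺ (All.map (λ {α} → Good⇒Past {α}) pa) ((≤-refl , inj₁ mr) ∷ [])) ce)
        (changed-top r C (Λ ++ α ∷ C))
        (changed-skip r C ((L ++ α ∷ []) ++ C) (Λ ++ α ∷ C)
          (trans (cong (unpaired d) (++-assoc L (α ∷ []) C)) (sym (unpaired-pair c β (L ++ α ∷ C) cβ m))))
      where
      α = (r , suc e)
      Λ = (h , c) ∷ β ∷ L
      before : All (λ γ → r < proj₁ γ) L
      before = All.map (λ {α} → proj₁) (All-before L ap)
      β<h = R<h m
      r<β : r < proj₁ β
      r<β = proj₁ (All.lookup gt (∈-++⁺ʳ L (here refl)))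

-- Connected components

oddLast : List Pair → List ℕ
oddLast [] = []
oddLast (α ∷ []) = proj₁ α ∷ []
oddLast (α ∷ β ∷ C) = oddLast C

-- Two elements put in front of a component change neither its parity nor its last element; two that
-- form a component by themselves contribute nothing.
unpaired-attach : ∀ k α β Cs → concatMap oddLast (attach true α (attach k β Cs)) ≡ concatMap oddLast Cs
unpaired-attach true α β [] = refl
unpaired-attach true α β (C ∷ Cs) = refl
unpaired-attach false α β Cs = refl

unpaired-components : ∀ d C → concatMap oddLast (components d C) ≡ unpaired d C
unpaired-components d [] = refl
unpaired-components d (α ∷ []) = refl
unpaired-components d (α ∷ β ∷ []) with connectedᵇ d α β
... | true = refl
... | false = refl
unpaired-components d (α ∷ β ∷ γ ∷ C) = split (connectedᵇ d α β) (connectedᵇ d β γ)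
    (unpaired-components d (γ ∷ C)) (unpaired-components d (β ∷ γ ∷ C))
  where
  split : ∀ j k {U V} → concatMap oddLast (components d (γ ∷ C)) ≡ U →
    concatMap oddLast (attach k β (components d (γ ∷ C))) ≡ V →
    concatMap oddLast (attach j α (attach k β (components d (γ ∷ C)))) ≡ (if j then U else proj₁ α ∷ V)
  split true k p q = trans (unpaired-attach k α β (components d (γ ∷ C))) p
  split false k p q = cong (proj₁ α ∷_) q

concat-attach : ∀ k α Cs → concat (attach k α Cs) ≡ α ∷ concat Cs
concat-attach true α [] = refl
concat-attach true α (C ∷ Cs) = refl
concat-attach false α Cs = refl

concat-components : ∀ d C → concat (components d C) ≡ C
concat-components d [] = refl
concat-components d (α ∷ []) = refl
concat-components d (α ∷ β ∷ C) = trans (concat-attach (connectedᵇ d α β) α (components d (β ∷ C)))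
  (cong (α ∷_) (concat-components d (β ∷ C)))

oddLast-last : ∀ α C → oddLast (α ∷ C) ≡
  (if length (α ∷ C) % 2 ≡ᵇ 0 then [] else proj₁ (proj₂ (initLast α C)) ∷ [])
oddLast-last α [] = refl
oddLast-last α (β ∷ []) = refl
oddLast-last α (β ∷ γ ∷ C) = oddLast-last γ C

initLast-++ : ∀ α C → proj₁ (initLast α C) ++ proj₂ (initLast α C) ∷ [] ≡ α ∷ C
initLast-++ α [] = refl
initLast-++ α (β ∷ C) = cong (α ∷_) (initLast-++ β C)

∨-swap : ∀ a b c d → (a ∨ b) ∨ (c ∨ d) ≡ (a ∨ c) ∨ (b ∨ d)
∨-swap true b c d = refl
∨-swap false true true d = refl
∨-swap false true false d = refl
∨-swap false false c d = refl

diag : ℕ → ℕ → Pair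
diag d r = (r , star d r)

-- Both shapes of S_C for a component of odd length have, in each coordinate separately, the entries of the p_v(α)
-- together with those of p_h of the last element.
module _ (d : ℕ) (f : Pair → ℕ)
  (last-two : ∀ x α → (x ≡ᵇ f α) ∨ (x ≡ᵇ f (sharp d α)) ∨ false ≡ ((x ≡ᵇ f (pv d α)) ∨ false) ∨ (x ≡ᵇ f (ph d α)) ∨ false) where

  elem-SConn : ∀ x C → elemᵇ x (map f (SConn d C)) ≡
    elemᵇ x (map f (map (pv d) C)) ∨ elemᵇ x (map f (map (diag d) (oddLast C)))
  elem-SConn x [] = refl
  elem-SConn x (α ∷ C) rewrite oddLast-last α C with length (α ∷ C) % 2 ≡ᵇ 0
  ... | true = sym (∨-identityʳ _)
  ... | false with star d (proj₁ (proj₂ (initLast α C))) <ᵇ proj₁ (proj₂ (initLast α C))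
  ...   | true = trans (cong (elemᵇ x) (map-++ f (map (pv d) (α ∷ C)) _)) (elemᵇ-++ x (map f (map (pv d) (α ∷ C))) _)
  ...   | false = begin
      elemᵇ x (map f (map (pv d) I ++ l ∷ sharp d l ∷ [])) ≡⟨ cong (elemᵇ x) (map-++ f (map (pv d) I) _) ⟩
      elemᵇ x (map f (map (pv d) I) ++ f l ∷ f (sharp d l) ∷ []) ≡⟨ elemᵇ-++ x (map f (map (pv d) I)) _ ⟩
      A ∨ ((x ≡ᵇ f l) ∨ (x ≡ᵇ f (sharp d l)) ∨ false) ≡⟨ cong (A ∨_) (last-two x l) ⟩
      A ∨ (((x ≡ᵇ f (pv d l)) ∨ false) ∨ (x ≡ᵇ f (ph d l)) ∨ false) ≡⟨ ∨-assoc A _ _ ⟨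
      (A ∨ ((x ≡ᵇ f (pv d l)) ∨ false)) ∨ ((x ≡ᵇ f (ph d l)) ∨ false) ≡⟨ cong (_∨ ((x ≡ᵇ f (ph d l)) ∨ false)) (elemᵇ-++ x (map f (map (pv d) I)) _) ⟨
      elemᵇ x (map f (map (pv d) I) ++ f (pv d l) ∷ []) ∨ ((x ≡ᵇ f (ph d l)) ∨ false)
        ≡⟨ cong (λ u → elemᵇ x u ∨ ((x ≡ᵇ f (ph d l)) ∨ false)) (trans (sym (map-++ f (map (pv d) I) _))
            (cong (map f) (trans (sym (map-++ (pv d) I _)) (cong (map (pv d)) (initLast-++ α C))))) ⟩
      elemᵇ x (map f (map (pv d) (α ∷ C))) ∨ ((x ≡ᵇ f (ph d l)) ∨ false) ∎
    where
    open ≡-Reasoning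
    I = proj₁ (initLast α C)
    l = proj₂ (initLast α C)
    A = elemᵇ x (map f (map (pv d) I))

  elem-components : ∀ x Cs → elemᵇ x (map f (concatMap (SConn d) Cs)) ≡
    elemᵇ x (map f (map (pv d) (concat Cs))) ∨ elemᵇ x (map f (map (diag d) (concatMap oddLast Cs)))
  elem-components x [] = refl
  elem-components x (C ∷ Cs) = begin
      elemᵇ x (map f (SConn d C ++ concatMap (SConn d) Cs)) ≡⟨ cong (elemᵇ x) (map-++ f (SConn d C) _) ⟩
      elemᵇ x (map f (SConn d C) ++ map f (concatMap (SConn d) Cs)) ≡⟨ elemᵇ-++ x (map f (SConn d C)) _ ⟩
      elemᵇ x (map f (SConn d C)) ∨ elemᵇ x (map f (concatMap (SConn d) Cs)) ≡⟨ cong₂ _∨_ (elem-SConn x C) (elem-components x Cs) ⟩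
      _ ≡⟨ ∨-swap (elemᵇ x (map f (map (pv d) C))) _ _ _ ⟩
      _ ≡⟨ cong₂ _∨_ (join (pv d) C (concat Cs)) (join (diag d) (oddLast C) (concatMap oddLast Cs)) ⟩
      _ ∎
    where
    open ≡-Reasoning
    join : ∀ {A : Set} (h : A → Pair) u w → elemᵇ x (map f (map h u)) ∨ elemᵇ x (map f (map h w)) ≡ elemᵇ x (map f (map h (u ++ w)))
    join h u w = trans (sym (elemᵇ-++ x (map f (map h u)) _))
      (cong (elemᵇ x) (trans (sym (map-++ f (map h u) _)) (cong (map f) (sym (map-++ h u w)))))

  elem-SChain : ∀ x C → elemᵇ x (map f (SChain d C)) ≡
    elemᵇ x (map f (map (pv d) C)) ∨ elemᵇ x (map f (map (diag d) (unpaired d C)))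
  elem-SChain x C = trans (elem-components x (components d C))
    (cong₂ (λ K U → elemᵇ x (map f (map (pv d) K)) ∨ elemᵇ x (map f (map (diag d) U)))
      (concat-components d C) (unpaired-components d C))

SChain-rows : ∀ d C x → elemᵇ x (map proj₁ (SChain d C)) ≡ changed d C C x
SChain-rows d C x = trans (elem-SChain d proj₁ swap x C)
  (cong₂ (λ u w → elemᵇ x u ∨ elemᵇ x w) (sym (map-∘ C)) (trans (sym (map-∘ (unpaired d C))) (map-id (unpaired d C))))
  where
  swap : ∀ x α → (x ≡ᵇ proj₁ α) ∨ (x ≡ᵇ star d (proj₂ α)) ∨ false ≡ ((x ≡ᵇ star d (proj₂ α)) ∨ false) ∨ (x ≡ᵇ proj₁ α) ∨ false
  swap x (r , c) with x ≡ᵇ r | x ≡ᵇ star d c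
  ... | true | true = refl
  ... | true | false = refl
  ... | false | true = refl
  ... | false | false = refl

star-star : ∀ d x → x ≤ suc (d + d) → star d (star d x) ≡ x
star-star d x p = m∸[m∸n]≡n p

elem-star : ∀ {A : Set} d (f : A → ℕ) x u → x ≤ suc (d + d) → All (λ y → f y ≤ suc (d + d)) u →
  elemᵇ x (map f u) ≡ elemᵇ (star d x) (map (λ y → star d (f y)) u)
elem-star d f x [] p [] = refl
elem-star d f x (y ∷ u) p (q ∷ qs) = cong₂ _∨_ eq (elem-star d f x u p qs)
  where
  eq : (x ≡ᵇ f y) ≡ (star d x ≡ᵇ star d (f y))
  eq = bool-ext
    (λ e → subst (λ z → (star d x ≡ᵇ star d z) ≡ true) (≡ᵇ-true x (f y) e) (≡ᵇ-refl (star d x)))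
    (λ e → subst (λ z → (x ≡ᵇ z) ≡ true) (trans (sym (star-star d x p)) (trans (cong (star d) (≡ᵇ-true (star d x) (star d (f y)) e)) (star-star d (f y) q))) (≡ᵇ-refl x))

-- S_C is stable under α ↦ α^#, so its columns are the mirror images of its rows.
SChain-columns : ∀ d C x → x ≤ suc (d + d) → All (λ α → proj₁ α ≤ suc (d + d) × proj₂ α ≤ suc (d + d)) C →
  elemᵇ x (map proj₂ (SChain d C)) ≡ changed d C C (star d x)
SChain-columns d C x p q = trans (elem-SChain d proj₂ (λ x α → cong (_∨ ((x ≡ᵇ star d (proj₁ α)) ∨ false)) (sym (∨-identityʳ (x ≡ᵇ proj₂ α)))) x C)
  (cong₂ _∨_ (trans (cong (elemᵇ x) (sym (map-∘ C))) (elem-star d proj₂ x C p (All.map proj₂ q)))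
    (trans (cong (elemᵇ x) (sym (map-∘ (unpaired d C)))) (elem-star′ (unpaired d C) (unpaired-All d C (All.map proj₁ q)))))
  where
  elem-star′ : ∀ u → All (_≤ suc (d + d)) u → elemᵇ x (map (star d) u) ≡ elemᵇ (star d x) u
  elem-star′ u r = trans (elem-star d (star d) x u p (All.map (λ {y} _ → m∸n≤m (suc (d + d)) y) r))
    (cong (elemᵇ (star d x)) (go u r))
    where
    go : ∀ u → All (_≤ suc (d + d)) u → map (λ y → star d (star d y)) u ≡ u
    go [] [] = refl
    go (y ∷ u) (r ∷ rs) = cong₂ _∷_ (star-star d y r) (go u rs)

-- Bits and elements of I(d)

comp : ∀ {n} → Bits n → Bits n
comp = Vec.map not

-- Members are the non-members of the complement, so the order lemmas about `R` apply again.
enc : ∀ {n} → ℕ → Bits n → List ℕ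
enc e β = toList (R e (comp β))

Agree : ∀ {n} → ℕ → Bits n → (ℕ → Bool) → Set
Agree e [] m = ⊤
Agree {suc n} e (x ∷ β) m = m (suc e) ≡ x × m (hi e n) ≡ not x × Agree (suc e) β m

lo<hi : ∀ e n → suc e < hi e n
lo<hi e n = s≤s (s≤s (≤-trans (m≤m+n e n) (m≤m+n (e + n) n)))

inner≤ : ∀ {x} e n → x ≤ suc e + n + n → x ≤ e + suc n + suc n
inner≤ {x} e n p = subst (x ≤_) (sym (hi-eq e n)) (m≤n⇒m≤1+n p)

Agree-cong : ∀ {n} e (β : Bits n) {m m′} → (∀ x → e < x → x ≤ e + n + n → m x ≡ m′ x) → Agree e β m → Agree e β m′
Agree-cong e [] h a = tt
Agree-cong {suc n} e (x ∷ β) h (p , q , a) =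
  trans (sym (h (suc e) (n<1+n e) (subst (suc e ≤_) (sym (hi-eq e n)) (<⇒≤ (lo<hi e n))))) p ,
  trans (sym (h (hi e n) (<-trans (n<1+n e) (lo<hi e n)) (≤-reflexive (sym (hi-eq e n))))) q ,
  Agree-cong (suc e) β (λ y p q → h y (<-trans (n<1+n e) p) (inner≤ e n q)) a

Agree-comp : ∀ {n} e (β : Bits n) {m} → Agree e β m → Agree e (comp β) (not ∘ m)
Agree-comp e [] a = tt
Agree-comp e (x ∷ β) (p , q , a) = cong not p , cong not q , Agree-comp (suc e) β a

comp-comp : ∀ {n} (β : Bits n) → comp (comp β) ≡ β
comp-comp [] = refl
comp-comp (x ∷ β) = cong₂ _∷_ (not-involutive x) (comp-comp β)

∈R⇒ : ∀ {n} e (γ : Bits n) {m x} → Agree e γ m → x ∈ⱽ R e γ → m x ≡ false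
∈R⇒ e (true ∷ γ) (p , q , a) (i , k) with Nth-∷ʳ⁻ (R (suc e) γ) k
... | inj₁ k′ = ∈R⇒ (suc e) γ a (i , k′)
... | inj₂ (_ , refl) = q
∈R⇒ e (false ∷ γ) (p , q , a) (zero , here) = p
∈R⇒ e (false ∷ γ) (p , q , a) (suc i , there k) = ∈R⇒ (suc e) γ a (i , k)

true≢false : true ≢ false
true≢false ()

data Between (e n : ℕ) : ℕ → Set where
  isLo : Between e n (suc e)
  isHi : Between e n (hi e n)
  inside : ∀ {x} → suc e < x → x ≤ suc e + n + n → Between e n x

between : ∀ {e n x} → e < x → x ≤ e + suc n + suc n → Between e n x
between {e} {n} {x} p q with m≤n⇒m<n∨m≡n p
... | inj₂ refl = isLo
... | inj₁ p′ with m≤n⇒m<n∨m≡n (subst (x ≤_) (hi-eq e n) q)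
...   | inj₂ refl = isHi
...   | inj₁ (s≤s q′) = inside p′ q′

∈R⇐ : ∀ {n} e (γ : Bits n) {m x} → Agree e γ m → e < x → x ≤ e + n + n → m x ≡ false → x ∈ⱽ R e γ
∈R⇐ e [] a p q r = ⊥-elim (<⇒≱ p (≤-trans q (≤-reflexive (trans (+-identityʳ (e + 0)) (+-identityʳ e)))))
∈R⇐ e (y ∷ γ) a p q r with between p q
∈R⇐ e (true ∷ γ) (u , v , a) p q r | isLo = ⊥-elim (true≢false (trans (sym u) r))
∈R⇐ e (false ∷ γ) (u , v , a) p q r | isLo = 0 , here
∈R⇐ {suc n} e (true ∷ γ) (u , v , a) p q r | isHi = n , Nth-last (R (suc e) γ)
∈R⇐ e (false ∷ γ) (u , v , a) p q r | isHi = ⊥-elim (true≢false (trans (sym v) r))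
∈R⇐ e (true ∷ γ) (u , v , a) p q r | inside p′ q′ with ∈R⇐ (suc e) γ a p′ q′ r
... | i , k = i , Nth-∷ʳ k
∈R⇐ e (false ∷ γ) (u , v , a) p q r | inside p′ q′ = thereⱽ (∈R⇐ (suc e) γ a p′ q′ r)

Agree-star : ∀ {n} d e (β : Bits n) {m x} → e + n ≡ d → Agree e β m → e < x → x ≤ e + n + n → m (star d x) ≡ not (m x)
Agree-star d e [] de a p q = ⊥-elim (<⇒≱ p (≤-trans q (≤-reflexive (trans (+-identityʳ (e + 0)) (+-identityʳ e)))))
Agree-star {suc n} d e (y ∷ β) {m} de (u , v , a) p q with between p q
... | isLo = trans (cong m (Star.star-lo d e n de)) (trans v (cong not (sym u)))
... | isHi = trans (cong m (Star.star-hi d e n de)) (trans u (trans (sym (not-involutive y)) (cong not (sym v))))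
... | inside p′ q′ = Agree-star d (suc e) β (trans (sym (+-suc e n)) de) a p′ q′

∈ⱽ⇒∈ : ∀ {n x} (xs : Vec ℕ n) → x ∈ⱽ xs → x ∈ toList xs
∈ⱽ⇒∈ (x ∷ xs) (zero , here) = here refl
∈ⱽ⇒∈ (x ∷ xs) (suc i , there p) = there (∈ⱽ⇒∈ xs (i , p))

∈⇒∈ⱽ : ∀ {n x} (xs : Vec ℕ n) → x ∈ toList xs → x ∈ⱽ xs
∈⇒∈ⱽ (x ∷ xs) (here refl) = 0 , here
∈⇒∈ⱽ (x ∷ xs) (there p) = thereⱽ (∈⇒∈ⱽ xs p)

toList-sorted : ∀ {n} (xs : Vec ℕ n) → Asc xs → AllPairs _<_ (toList xs)
toList-sorted [] a = []
toList-sorted (x ∷ xs) (lt , a) = All.tabulate (λ p → lt (∈⇒∈ⱽ xs p)) ∷ toList-sorted xs a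

enc-sorted : ∀ {n} e (β : Bits n) → AllPairs _<_ (enc e β)
enc-sorted e β = toList-sorted (R e (comp β)) (R-asc e (comp β))

enc-lower : ∀ {n x} e (β : Bits n) → x ∈ enc e β → e < x
enc-lower e β p with ∈⇒∈ⱽ (R e (comp β)) p
... | i , q = R-lower e (comp β) q

enc-upper : ∀ {n x} e (β : Bits n) → x ∈ enc e β → x ≤ e + n + n
enc-upper e β p with ∈⇒∈ⱽ (R e (comp β)) p
... | i , q = R-upper e (comp β) q

∉⇒elemᵇ : ∀ {x} u → x ∉ u → elemᵇ x u ≡ false
∉⇒elemᵇ {x} u h with elemᵇ x u in eq
... | false = refl
... | true = ⊥-elim (h (elemᵇ⇒∈ u eq))

elemᵇ⇒∉ : ∀ {x} u → elemᵇ x u ≡ false → x ∉ u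
elemᵇ⇒∉ u e p = true≢false (trans (sym (∈⇒elemᵇ p)) e)

Agree-enc : ∀ {n} e (β : Bits n) → Agree e β (λ x → elemᵇ x (enc e β))
Agree-enc e [] = tt
Agree-enc {suc n} e (true ∷ β) = elemᵇ-here (suc e) (enc (suc e) β) ,
  ∉⇒elemᵇ (suc e ∷ enc (suc e) β) (λ { (here eq) → <⇒≢ (lo<hi e n) (sym eq) ; (there p) → <⇒≱ (n<1+n (suc (e + n + n))) (enc-upper (suc e) β p) }) ,
  Agree-cong (suc e) β (λ x p q → sym (elemᵇ-skip x (suc e) (enc (suc e) β) (>⇒≢ p))) (Agree-enc (suc e) β)
Agree-enc {suc n} e (false ∷ β) rewrite toList-∷ʳ (hi e n) (R (suc e) (comp β)) =
  ∉⇒elemᵇ (enc (suc e) β ++ hi e n ∷ []) (λ p → low (∈-++⁻ (enc (suc e) β) p)) ,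
  ∈⇒elemᵇ (∈-++⁺ʳ (enc (suc e) β) (here refl)) ,
  Agree-cong (suc e) β (λ x p q → sym (trans (elemᵇ-++ x (enc (suc e) β) _)
    (trans (cong (elemᵇ x (enc (suc e) β) ∨_) (elemᵇ-skip x (hi e n) [] (<⇒≢ (s≤s q)))) (∨-identityʳ _)))) (Agree-enc (suc e) β)
  where
  low : suc e ∈ enc (suc e) β ⊎ suc e ∈ (hi e n ∷ []) → ⊥
  low (inj₁ p) = <-irrefl refl (enc-lower (suc e) β p)
  low (inj₂ (here eq)) = <⇒≢ (lo<hi e n) eq

sorted-ext : ∀ {u w} → AllPairs _<_ u → AllPairs _<_ w → (∀ {x} → x ∈ u → x ∈ w) → (∀ {x} → x ∈ w → x ∈ u) → u ≡ w
sorted-ext {[]} {[]} p q f g = refl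
sorted-ext {[]} {y ∷ w} p q f g with () ← g (here refl)
sorted-ext {x ∷ u} {[]} p q f g with () ← f (here refl)
sorted-ext {x ∷ u} {y ∷ w} (p ∷ ps) (q ∷ qs) f g with heads (f (here refl)) (g (here refl))
  where
  heads : x ∈ y ∷ w → y ∈ x ∷ u → x ≡ y
  heads (here eq) _ = eq
  heads (there _) (here eq) = sym eq
  heads (there a) (there b) = ⊥-elim (<-asym (All.lookup q a) (All.lookup p b))
... | refl = cong (x ∷_) (sorted-ext ps qs (λ a → drop (f (there a)) (All.lookup p a)) (λ a → drop (g (there a)) (All.lookup q a)))
  where
  drop : ∀ {z v} → z ∈ x ∷ v → x < z → z ∈ v
  drop (here refl) lt = ⊥-elim (<-irrefl refl lt)
  drop (there a) lt = a

enc-unique : ∀ {d} (β : Bits d) u → AllPairs _<_ u → All (InRange d) u → Agree 0 β (λ x → elemᵇ x u) → u ≡ enc 0 β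
enc-unique {d} β u s r a = sorted-ext s (enc-sorted 0 β)
  (λ {x} p → ∈ⱽ⇒∈ (R 0 (comp β)) (∈R⇐ 0 (comp β) a′ (proj₁ (All.lookup r p)) (proj₂ (All.lookup r p)) (cong not (∈⇒elemᵇ p))))
  (λ {x} p → elemᵇ⇒∈ u (trans (sym (not-involutive (elemᵇ x u))) (cong not (∈R⇒ 0 (comp β) {m = λ x → not (elemᵇ x u)} a′ (∈⇒∈ⱽ (R 0 (comp β)) p)))))
  where
  a′ : Agree 0 (comp β) (λ x → not (elemᵇ x u))
  a′ = Agree-comp 0 β a

bitsOf : (ℕ → Bool) → ℕ → (n : ℕ) → Bits n
bitsOf m e zero = []
bitsOf m e (suc n) = m (suc e) ∷ bitsOf m (suc e) n

dec : (d : ℕ) → List ℕ → Bits d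
dec d u = bitsOf (λ x → elemᵇ x u) 0 d

Agree-bitsOf : ∀ d m e n → e + n ≡ d → (∀ x → e < x → x ≤ d → m (star d x) ≡ not (m x)) → Agree e (bitsOf m e n) m
Agree-bitsOf d m e zero de h = tt
Agree-bitsOf d m e (suc n) de h = refl ,
  trans (cong m (sym (Star.star-lo d e n de))) (h (suc e) (n<1+n e) (subst (suc e ≤_) (trans (sym (+-suc e n)) de) (s≤s (m≤m+n e n)))) ,
  Agree-bitsOf d m (suc e) n (trans (sym (+-suc e n)) de) (λ x p q → h x (<-trans (n<1+n e) p) q)

bitsOf-Agree : ∀ {n} m e (β : Bits n) → Agree e β m → bitsOf m e n ≡ β
bitsOf-Agree m e [] a = refl
bitsOf-Agree m e (x ∷ β) (p , q , a) = cong₂ _∷_ p (bitsOf-Agree m (suc e) β a)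

dec-enc : ∀ {d} (β : Bits d) → dec d (enc 0 β) ≡ β
dec-enc β = bitsOf-Agree _ 0 β (Agree-enc 0 β)

IsI-Agree : ∀ d u → (∀ k → InRange d k → (k ∈ u × star d k ∉ u) ⊎ (k ∉ u × star d k ∈ u)) → Agree 0 (dec d u) (λ x → elemᵇ x u)
IsI-Agree d u h = Agree-bitsOf d _ 0 d refl f
  where
  f : ∀ x → 0 < x → x ≤ d → elemᵇ (star d x) u ≡ not (elemᵇ x u)
  f x p q with h x (p , ≤-trans q (m≤m+n d d))
  ... | inj₁ (a , b) rewrite ∈⇒elemᵇ a | ∉⇒elemᵇ u b = refl
  ... | inj₂ (a , b) rewrite ∉⇒elemᵇ u a | ∈⇒elemᵇ b = refl

high-count : ∀ {n} d e (γ : Bits n) → e + n ≡ d → length (filterᵇ (d <ᵇ_) (toList (R e γ))) ≡ ones γ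
high-count d e [] de = refl
high-count {suc n} d e (true ∷ γ) de rewrite toList-∷ʳ (hi e n) (R (suc e) γ)
  | filter-++ (T? ∘ (d <ᵇ_)) (toList (R (suc e) γ)) (hi e n ∷ [])
  | <ᵇ-true {d} {hi e n} (subst (_< hi e n) (trans (sym (+-suc e n)) de) (s≤s (s≤s (m≤m+n (e + n) n))))
  | length-++ (filterᵇ (d <ᵇ_) (toList (R (suc e) γ))) {hi e n ∷ []}
  | high-count d (suc e) γ (trans (sym (+-suc e n)) de) = +-comm (ones γ) 1
high-count {suc n} d e (false ∷ γ) de
  rewrite <ᵇ-false {d} {suc e} (subst (suc e ≤_) (trans (sym (+-suc e n)) de) (s≤s (m≤m+n e n))) =
  high-count d (suc e) γ (trans (sym (+-suc e n)) de)

even⇒ : ∀ k → k % 2 ≡ 0 → odd k ≡ false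
even⇒ zero e = refl
even⇒ (suc (suc k)) e = trans (not-involutive (odd k)) (even⇒ k e)

even⇐ : ∀ k → odd k ≡ false → k % 2 ≡ 0
even⇐ zero e = refl
even⇐ (suc (suc k)) e = even⇐ k (trans (sym (not-involutive (odd k))) e)

InI-enc : ∀ {d u} → InI d u → u ≡ enc 0 (dec d u)
InI-enc {d} {u} ((s , r , l) , h , e) = enc-unique (dec d u) u (Linked⇒AllPairs <-trans s) r (IsI-Agree d u h)

InI-par : ∀ {d u} → InI d u → par (comp (dec d u)) ≡ false
InI-par {d} {u} i@((s , r , l) , h , e) = trans (sym (ones-par (comp (dec d u))))
  (even⇒ (ones (comp (dec d u))) (trans (cong (_% 2) (trans (sym (high-count d 0 (comp (dec d u)) refl))
    (cong (length ∘ filterᵇ (d <ᵇ_)) (sym (InI-enc i))))) e))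

enc-InI : ∀ {d} (β : Bits d) → par (comp β) ≡ false → InI d (enc 0 β)
enc-InI {d} β e = (AllPairs⇒Linked (enc-sorted 0 β) ,
    All.tabulate (λ p → enc-lower 0 β p , enc-upper 0 β p) ,
    length-toList (R 0 (comp β))) , opposite ,
  trans (cong (_% 2) (high-count d 0 (comp β) refl)) (even⇐ (ones (comp β)) (trans (ones-par (comp β)) e))
  where
  opposite : ∀ k → InRange d k → (k ∈ enc 0 β × star d k ∉ enc 0 β) ⊎ (k ∉ enc 0 β × star d k ∈ enc 0 β)
  opposite k (p , q) with elemᵇ k (enc 0 β) in eq | Agree-star d 0 β {x = k} refl (Agree-enc 0 β) p q
  ... | true | st = inj₁ (elemᵇ⇒∈ _ eq , elemᵇ⇒∉ _ st)
  ... | false | st = inj₂ (elemᵇ⇒∉ _ eq , elemᵇ⇒∈ _ st)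

-- The order of I(d) by counting entries

count : ℕ → List ℕ → ℕ
count k [] = 0
count k (x ∷ u) = ⟦ x ≤ᵇ k ⟧ + count k u

count-++ : ∀ k u w → count k (u ++ w) ≡ count k u + count k w
count-++ k [] w = refl
count-++ k (x ∷ u) w = trans (cong (⟦ x ≤ᵇ k ⟧ +_) (count-++ k u w)) (sym (+-assoc ⟦ x ≤ᵇ k ⟧ _ _))

count-none : ∀ {k u} → All (k <_) u → count k u ≡ 0
count-none [] = refl
count-none (p ∷ ps) rewrite ≤ᵇ-false p = count-none ps

count-all : ∀ {k u} → All (_≤ k) u → count k u ≡ length u
count-all [] = refl
count-all (p ∷ ps) rewrite ≤ᵇ-true p = cong suc (count-all ps)

⟦⟧-mono : ∀ {x y k} → x ≤ y → ⟦ y ≤ᵇ k ⟧ ≤ ⟦ x ≤ᵇ k ⟧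
⟦⟧-mono {x} {y} {k} p with y ≤? k
... | yes q rewrite ≤ᵇ-true q | ≤ᵇ-true (≤-trans p q) = ≤-refl
... | no q rewrite ≤ᵇ-false (≰⇒> q) = z≤n

≼⇒count : ∀ {u w} → u ≼ w → ∀ k → count k w ≤ count k u
≼⇒count [] k = z≤n
≼⇒count (p ∷ ps) k = +-mono-≤ (⟦⟧-mono p) (≼⇒count ps k)

-- Counting at k = y, the first entry of w, forces an entry of u up to y, hence x ≤ y. At every k ≥
-- y both first entries are then counted and cancel; below y nothing of w is counted.
count⇒≼ : ∀ {u w} → length u ≡ length w → AllPairs _<_ u → AllPairs _<_ w → (∀ k → count k w ≤ count k u) → u ≼ w
count⇒≼ {[]} {[]} l p q h = []
count⇒≼ {x ∷ u} {y ∷ w} l (p ∷ ps) (q ∷ qs) h = x≤y ∷ count⇒≼ (suc-injective l) ps qs tails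
  where
  x≤y : x ≤ y
  x≤y with x ≤? y
  ... | yes r = r
  ... | no r = ⊥-elim (<⇒≱ (s≤s z≤n) (≤-trans (≤-trans (≤-reflexive (cong (λ z → ⟦ z ⟧ + count y w) (sym (≤ᵇ-true (≤-refl {y}))))) (h y))
                 (≤-reflexive (count-none {y} {x ∷ u} (≰⇒> r ∷ All.map (<-trans (≰⇒> r)) p)))))
  tails : ∀ k → count k w ≤ count k u
  tails k with y ≤? k | h k
  ... | no r | _ = ≤-trans (≤-reflexive (count-none (All.map (<-trans (≰⇒> r)) q))) z≤n
  ... | yes r | hk rewrite ≤ᵇ-true r | ≤ᵇ-true (≤-trans x≤y r) = ≤-pred hk

count-low : ∀ {n} e (β : Bits n) {k} → k ≤ e → count k (enc e β) ≡ 0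
count-low e β p = count-none (All.tabulate (λ q → ≤-<-trans p (enc-lower e β q)))

count-high : ∀ {n} e (β : Bits n) {k} → e + n + n ≤ k → count k (enc e β) ≡ n
count-high e β p = trans (count-all (All.tabulate (λ q → ≤-trans (enc-upper e β q) p))) (length-toList (R e (comp β)))

count-mid : ∀ {n} e x (β : Bits n) {k} → e < k → k < hi e n → count k (enc e (x ∷ β)) ≡ ⟦ x ⟧ + count k (enc (suc e) β)
count-mid e true β p q rewrite ≤ᵇ-true p = refl
count-mid {n} e false β {k} p q rewrite toList-∷ʳ (hi e n) (R (suc e) (comp β))
  | count-++ k (enc (suc e) β) (hi e n ∷ []) | ≤ᵇ-false q = +-identityʳ _

Step-elim : ∀ δ x y {P : ℕ → Set} → Step δ x y P → Σ ℕ λ δ′ → ⟦ y ⟧ + δ′ ≡ ⟦ x ⟧ + δ × P δ′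
Step-elim δ true true p = δ , refl , p
Step-elim δ true false p = suc δ , refl , p
Step-elim (suc δ) false true p = δ , refl , p
Step-elim δ false false p = δ , refl , p

Step-intro : ∀ δ x y {P : ℕ → Set} → ⟦ y ⟧ ≤ ⟦ x ⟧ + δ → (∀ δ′ → ⟦ y ⟧ + δ′ ≡ ⟦ x ⟧ + δ → P δ′) → Step δ x y P
Step-intro δ true true p f = f δ refl
Step-intro δ true false p f = f (suc δ) refl
Step-intro zero false true () f
Step-intro (suc δ) false true p f = f δ refl
Step-intro δ false false p f = f δ refl

shift : ∀ y x δ δ′ c → y + δ′ ≡ x + δ → δ + (x + c) ≡ y + (δ′ + c)
shift y x δ δ′ c e = begin
    δ + (x + c) ≡⟨ +-assoc δ x c ⟨
    δ + x + c ≡⟨ cong (_+ c) (trans (+-comm δ x) (sym e)) ⟩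
    y + δ′ + c ≡⟨ +-assoc y δ′ c ⟩
    y + (δ′ + c) ∎
  where open ≡-Reasoning

-- Peels off the outermost pair e + 1, (e + 1)*. Below it nothing is counted and from its upper end
-- on everything is, in both lists alike; in between it contributes one bit. So the prefixes up to d
-- control all k.
Dom⇒count : ∀ {n} δ e (β γ : Bits n) → Dom δ β γ → ∀ k → count k (enc e γ) ≤ δ + count k (enc e β)
Dom⇒count δ e [] [] p k = z≤n
Dom⇒count {suc n} δ e (x ∷ β) (y ∷ γ) p k with k ≤? e
... | yes q = ≤-trans (≤-reflexive (count-low e (y ∷ γ) q)) z≤n
... | no q with hi e n ≤? k
...   | yes r = ≤-trans (≤-reflexive (trans (count-high e (y ∷ γ) r′) (sym (count-high e (x ∷ β) r′)))) (m≤n+m _ δ)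
  where r′ = subst (_≤ k) (sym (hi-eq e n)) r
...   | no r with Step-elim δ x y p
...     | δ′ , eq , p′ rewrite count-mid e y γ (≰⇒> q) (≰⇒> r) | count-mid e x β (≰⇒> q) (≰⇒> r)
            | shift ⟦ y ⟧ ⟦ x ⟧ δ δ′ (count k (enc (suc e) β)) eq = +-monoʳ-≤ ⟦ y ⟧ (Dom⇒count δ′ (suc e) β γ p′ k)

count⇒Dom : ∀ {n} δ e (β γ : Bits n) → (∀ k → count k (enc e γ) ≤ δ + count k (enc e β)) → Dom δ β γ
count⇒Dom δ e [] [] h = tt
count⇒Dom {suc n} δ e (x ∷ β) (y ∷ γ) h = Step-intro δ x y first (λ δ′ eq → count⇒Dom δ′ (suc e) β γ (rest δ′ eq))
  where
  mid : ∀ k → e < k → k < hi e n → ⟦ y ⟧ + count k (enc (suc e) γ) ≤ δ + (⟦ x ⟧ + count k (enc (suc e) β))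
  mid k p q = subst₂ (λ a b → a ≤ δ + b) (count-mid e y γ p q) (count-mid e x β p q) (h k)
  first : ⟦ y ⟧ ≤ ⟦ x ⟧ + δ
  first with mid (suc e) (n<1+n e) (lo<hi e n)
  ... | q rewrite count-low (suc e) γ {suc e} ≤-refl | count-low (suc e) β {suc e} ≤-refl
          | +-identityʳ ⟦ y ⟧ | +-identityʳ ⟦ x ⟧ = ≤-trans q (≤-reflexive (+-comm δ ⟦ x ⟧))
  rest : ∀ δ′ → ⟦ y ⟧ + δ′ ≡ ⟦ x ⟧ + δ → ∀ k → count k (enc (suc e) γ) ≤ δ′ + count k (enc (suc e) β)
  rest δ′ eq k with k ≤? e
  ... | yes q = ≤-trans (≤-reflexive (count-low (suc e) γ (m≤n⇒m≤1+n q))) z≤n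
  ... | no q with hi e n ≤? k
  ...   | yes r = ≤-trans (≤-reflexive (trans (count-high (suc e) γ (<⇒≤ r)) (sym (count-high (suc e) β (<⇒≤ r))))) (m≤n+m _ δ′)
  ...   | no r = +-cancelˡ-≤ ⟦ y ⟧ _ _ (≤-trans (mid k (≰⇒> q) (≰⇒> r)) (≤-reflexive (shift ⟦ y ⟧ ⟦ x ⟧ δ δ′ _ eq)))

Dom⇒≼ : ∀ {d} (β γ : Bits d) → Dom 0 β γ → enc 0 β ≼ enc 0 γ
Dom⇒≼ β γ p = count⇒≼ (trans (length-toList (R 0 (comp β))) (sym (length-toList (R 0 (comp γ)))))
  (enc-sorted 0 β) (enc-sorted 0 γ) (Dom⇒count 0 0 β γ p)

≼⇒Dom : ∀ {d} (β γ : Bits d) → enc 0 β ≼ enc 0 γ → Dom 0 β γ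
≼⇒Dom β γ p = count⇒Dom 0 0 β γ (≼⇒count p)

diff-count : ∀ {n} e (b β : Bits n) m → Agree e β m → length (filterᵇ (λ x → not (m x)) (enc e b)) ≡ ones (b ⊕ β)
diff-count e [] [] m a = refl
diff-count {suc n} e (true ∷ b) (y ∷ β) m (p , q , a) rewrite p with y
... | true = diff-count (suc e) b β m a
... | false = cong suc (diff-count (suc e) b β m a)
diff-count {suc n} e (false ∷ b) (y ∷ β) m (p , q , a)
  rewrite toList-∷ʳ (hi e n) (R (suc e) (comp b))
  | filter-++ (T? ∘ (λ x → not (m x))) (enc (suc e) b) (hi e n ∷ [])
  | length-++ (filterᵇ (λ x → not (m x)) (enc (suc e) b)) {filterᵇ (λ x → not (m x)) (hi e n ∷ [])}
  | diff-count (suc e) b β m a | q with y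
... | true = +-comm _ 1
... | false = +-identityʳ _

diffCard-enc : ∀ {d} (b β : Bits d) → diffCard (enc 0 b) (enc 0 β) ≡ ones (b ⊕ β)
diffCard-enc b β = diff-count 0 b β (λ x → elemᵇ x (enc 0 β)) (Agree-enc 0 β)

changed-member : ∀ {x p q} → x ≡ true → p ≡ false → (x ∧ not q) ∨ p ≡ not q
changed-member refl refl = ∨-identityʳ _

changed-nonmember : ∀ {x p q} → x ≡ false → (x ∧ not q) ∨ p ≡ p
changed-nonmember refl = refl

-- Adding x as a row and removing x* as a column is one flip of the coded bit.
Agree-changed : ∀ {n} d e (b : Bits n) (mv f : ℕ → Bool) → e + n ≡ d → Agree e b mv →
  (∀ x → mv x ≡ true → f x ≡ false) →
  Agree e (b ⊕ Vec.map f (X e b)) (λ x → (mv x ∧ not (f (star d x))) ∨ f x)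
Agree-changed d e [] mv f de a h = tt
Agree-changed {suc n} d e (true ∷ b) mv f de (p , q , a) h =
  trans (changed-member p (h (suc e) p)) (cong (not ∘ f) (Star.star-lo d e n de)) ,
  trans (changed-nonmember q) (sym (not-involutive _)) ,
  Agree-changed d (suc e) b mv f (trans (sym (+-suc e n)) de) a h
Agree-changed {suc n} d e (false ∷ b) mv f de (p , q , a) h =
  changed-nonmember p ,
  trans (changed-member q (h (hi e n) q)) (cong (not ∘ f) (Star.star-hi d e n de)) ,
  Agree-changed d (suc e) b mv f (trans (sym (+-suc e n)) de) a h

filterᵇ-Agree : ∀ {d} (β : Bits d) m → Agree 0 β m → filterᵇ m (map suc (upTo (d + d))) ≡ enc 0 β
filterᵇ-Agree {d} β m a = sorted-ext
  (AllPairs.filter⁺ (T? ∘ m) (AllPairs.map⁺ (AllPairs.applyUpTo⁺₁ (λ x → x) (d + d) (λ p _ → s≤s p))))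
  (enc-sorted 0 β) to from
  where
  T-true : ∀ {x} → T x → x ≡ true
  T-true {true} _ = refl
  true-T : ∀ {x} → x ≡ true → T x
  true-T refl = tt
  to : ∀ {x} → x ∈ filterᵇ m (map suc (upTo (d + d))) → x ∈ enc 0 β
  to {x} p with ∈-filter⁻ (T? ∘ m) {xs = map suc (upTo (d + d))} p
  ... | q , t with ∈-map⁻ suc q
  ...   | i , r , refl = ∈ⱽ⇒∈ (R 0 (comp β)) (∈R⇐ 0 (comp β) (Agree-comp 0 β a) (s≤s z≤n) (∈-upTo⁻ r) (cong not (T-true t)))
  from : ∀ {x} → x ∈ enc 0 β → x ∈ filterᵇ m (map suc (upTo (d + d)))
  from {zero} p with () ← enc-lower 0 β p
  from {suc x} p = ∈-filter⁺ (T? ∘ m) (∈-map⁺ suc (∈-upTo⁺ (enc-upper 0 β p)))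
    (true-T (trans (sym (not-involutive (m (suc x)))) (cong not (∈R⇒ 0 (comp β) {m = not ∘ m} (Agree-comp 0 β a) (∈⇒∈ⱽ (R 0 (comp β)) p)))))

Cell-bounds : ∀ {d} (b : Bits d) α → Cell 0 b α → InRange d (proj₁ α) × InRange d (proj₂ α) × proj₂ α ≤ d
Cell-bounds {d} b α p with Cell-row 0 b α p | Cell-lower 0 b α p | Cell-column 0 b α p
... | q , r | s | t = (<⇒≤ q , <⇒≤ r) , (s , ≤-trans t (m≤m+n d d)) , t

Cell-outside : ∀ {n} e (b : Bits n) α {m} → Agree e b m → Cell e b α → m (proj₁ α) ≡ false × m (proj₂ α) ≡ true
Cell-outside e (true ∷ b) (r , c) {m} (p , q , a) (inj₁ (refl , k)) = ∈R⇒ (suc e) b {m = m} a k , p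
Cell-outside e (true ∷ b) (r , c) (p , q , a) (inj₂ k) = Cell-outside (suc e) b (r , c) a k
Cell-outside e (false ∷ b) (r , c) (p , q , a) k = Cell-outside (suc e) b (r , c) a k

filterᵇ-cong : ∀ {p q : ℕ → Bool} u → All (λ x → p x ≡ q x) u → filterᵇ p u ≡ filterᵇ q u
filterᵇ-cong [] [] = refl
filterᵇ-cong {p} {q} (x ∷ u) (e ∷ es) rewrite e with q x
... | true = cong (x ∷_) (filterᵇ-cong u es)
... | false = filterᵇ-cong u es

-- `exact`, started without live lines, identifies the outgoing labels of the chain with the row
-- indices of S_C.
wOf-top : ∀ {d} (b : Bits d) C → Linked _⋗_ C → All (Cell 0 b) C → wOf d (enc 0 b) C ≡ enc 0 (top b (fillOf (ind C) 0 b))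
wOf-top {d} b C l ce = begin
    wOf d (enc 0 b) C ≡⟨ filterᵇ-cong (map suc (upTo (d + d))) (All.tabulate (λ {x} p → same x (range p))) ⟩
    filterᵇ (λ x → (mv x ∧ not (f (star d x))) ∨ f x) (map suc (upTo (d + d)))
      ≡⟨ filterᵇ-Agree (b ⊕ Vec.map f (X 0 b)) _ (Agree-changed d 0 b mv f refl (Agree-enc 0 b) outside) ⟩
    enc 0 (b ⊕ Vec.map f (X 0 b)) ≡⟨ cong (λ t → enc 0 (b ⊕ t)) (sym (trans (cong (out b (fillOf (ind C) 0 b)) (labels (R 0 b)))
        (exact d 0 b [] C refl (Linked⇒AllPairs (λ (p , q) (r , s) → <-trans r p , <-trans q s) l) [] ce))) ⟩
    enc 0 (top b (fillOf (ind C) 0 b)) ∎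
  where
  open ≡-Reasoning
  mv : ℕ → Bool
  mv x = elemᵇ x (enc 0 b)
  f : ℕ → Bool
  f = changed d C C
  labels : ∀ {n} (xs : Vec ℕ n) → zeros ≡ Vec.map (live []) xs
  labels [] = refl
  labels (x ∷ xs) = cong (false ∷_) (labels xs)
  range : ∀ {x} → x ∈ map suc (upTo (d + d)) → x ≤ suc (d + d)
  range p with ∈-map⁻ suc p
  ... | i , q , refl = m≤n⇒m≤1+n (∈-upTo⁻ q)
  wide : ∀ {α} → Cell 0 b α → proj₁ α ≤ suc (d + d) × proj₂ α ≤ suc (d + d)
  wide {α} p with Cell-bounds b α p
  ... | (_ , q) , (_ , r) , _ = m≤n⇒m≤1+n q , m≤n⇒m≤1+n r
  same : ∀ x → x ≤ suc (d + d) → (mv x ∧ not (elemᵇ x (map proj₂ (SChain d C)))) ∨ elemᵇ x (map proj₁ (SChain d C)) ≡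
    (mv x ∧ not (f (star d x))) ∨ f x
  same x p = cong₂ (λ y z → (mv x ∧ not y) ∨ z) (SChain-columns d C x p (All.map (λ {α} → wide {α}) ce)) (SChain-rows d C x)
  outside : ∀ x → mv x ≡ true → f x ≡ false
  outside x e = cong₂ _∨_ (elemᵇ-false (map⁺ (All.map tops ce))) (elemᵇ-false (unpaired-All d C (All.map rows ce)))
    where
    tops : ∀ {α} → Cell 0 b α → x ≢ top-row d α
    tops {α} p refl with Cell-bounds b α p | Cell-outside 0 b α (Agree-enc 0 b) p
    ... | _ , (q , r) , _ | _ , s = true≢false (trans (sym e) (trans (Agree-star d 0 b {m = mv} refl (Agree-enc 0 b) q r) (cong not s)))
    rows : ∀ {α} → Cell 0 b α → x ≢ proj₁ α
    rows {α} p refl = true≢false (trans (sym e) (proj₁ (Cell-outside 0 b α (Agree-enc 0 b) p)))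

-- Matrices of multiplicities

assoc : ∀ {n} → Vec ℕ n → Vec ℕ n → ℕ → ℕ
assoc [] [] r = 0
assoc (x ∷ xs) (a ∷ as) r = (if r ≡ᵇ x then a else 0) + assoc xs as r

-- A sum over the columns, of which at most one contributes; in this form the degree follows by
-- linearity.
cellVal : ∀ {n} e (b : Bits n) → Fill b → ℕ → ℕ → ℕ
cellVal e [] f r c = 0
cellVal e (true ∷ b) (a , f) r c = (if c ≡ᵇ suc e then assoc (R (suc e) b) a r else 0) + cellVal (suc e) b f r c
cellVal e (false ∷ b) f r c = cellVal (suc e) b f r c

assoc-support : ∀ {n} (xs as : Vec ℕ n) r → assoc xs as r ≢ 0 → r ∈ⱽ xs
assoc-support [] [] r h = ⊥-elim (h refl)
assoc-support (x ∷ xs) (a ∷ as) r h with r ≡ᵇ x in eq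
... | true = 0 , subst (λ y → Nth 0 y (x ∷ xs)) (sym (≡ᵇ-true r x eq)) here
... | false = thereⱽ (assoc-support xs as r h)

cellVal-support : ∀ {n} e (b : Bits n) f r c → cellVal e b f r c ≢ 0 → Cell e b (r , c)
cellVal-support e [] f r c h = h refl
cellVal-support e (true ∷ b) (a , f) r c h with c ≡ᵇ suc e in eq
... | false = inj₂ (cellVal-support (suc e) b f r c h)
... | true with assoc (R (suc e) b) a r in eq′
...   | zero = inj₂ (cellVal-support (suc e) b f r c h)
...   | suc k = inj₁ (≡ᵇ-true c (suc e) eq , assoc-support (R (suc e) b) a r (λ z → 1+n≢0 (trans (sym eq′) z)))
cellVal-support e (false ∷ b) f r c h = cellVal-support (suc e) b f r c h

zero-unless : ∀ {P : Set} x → (x ≢ 0 → P) → (P → ⊥) → x ≡ 0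
zero-unless zero f g = refl
zero-unless (suc x) f g = ⊥-elim (g (f (λ ())))

cellVal-outside : ∀ {n} e (b : Bits n) f r c → (Cell e b (r , c) → ⊥) → cellVal e b f r c ≡ 0
cellVal-outside e b f r c = zero-unless _ (cellVal-support e b f r c)

assoc-outside : ∀ {n} (xs as : Vec ℕ n) r → (r ∈ⱽ xs → ⊥) → assoc xs as r ≡ 0
assoc-outside xs as r = zero-unless _ (assoc-support xs as r)

map-assoc : ∀ {n} (xs as : Vec ℕ n) → Asc xs → Vec.map (assoc xs as) xs ≡ as
map-assoc [] [] h = refl
map-assoc (x ∷ xs) (a ∷ as) (lt , h) = cong₂ _∷_
  (trans (cong₂ (λ c k → (if c then a else 0) + k) (≡ᵇ-refl x) (assoc-outside xs as x (λ p → <-irrefl refl (lt p)))) (+-identityʳ a))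
  (trans (map-cong-Nth xs (λ y p → cong (λ c → (if c then a else 0) + assoc xs as y) (≢⇒≡ᵇ y x (>⇒≢ (lt (_ , p)))))) (map-assoc xs as h))

fillOf-cellVal : ∀ {n} e (b : Bits n) f → fillOf (cellVal e b f) e b ≡ f
fillOf-cellVal e [] f = refl
fillOf-cellVal e (true ∷ b) (a , f) = cong₂ _,_
  (trans (map-cong-Nth (R (suc e) b) (λ r _ → trans
    (cong₂ (λ c k → (if c then assoc (R (suc e) b) a r else 0) + k) (≡ᵇ-refl e)
      (cellVal-outside (suc e) b f r (suc e) (λ p → <-irrefl refl (Cell-lower (suc e) b (r , suc e) p)))) (+-identityʳ _)))
    (map-assoc (R (suc e) b) a (R-asc (suc e) b)))
  (trans (fillOf-cong (suc e) b (λ r c p → cong (λ z → (if z then assoc (R (suc e) b) a r else 0) + cellVal (suc e) b f r c)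
    (≢⇒≡ᵇ c (suc e) (>⇒≢ (Cell-lower (suc e) b (r , c) p))))) (fillOf-cellVal (suc e) b f))
fillOf-cellVal e (false ∷ b) f = fillOf-cellVal (suc e) b f

assoc-map : ∀ {n} (xs : Vec ℕ n) h r → Asc xs → r ∈ⱽ xs → assoc xs (Vec.map h xs) r ≡ h r
assoc-map (x ∷ xs) h x (lt , a) (zero , here) = trans
  (cong₂ (λ c k → (if c then h x else 0) + k) (≡ᵇ-refl x) (assoc-outside xs _ x (λ p → <-irrefl refl (lt p)))) (+-identityʳ _)
assoc-map (x ∷ xs) h r (lt , a) (suc i , there p) rewrite ≢⇒≡ᵇ r x (>⇒≢ (lt (i , p))) = assoc-map xs h r a (i , p)

cellVal-fillOf : ∀ {n} e (b : Bits n) g r c → Cell e b (r , c) → cellVal e b (fillOf g e b) r c ≡ g r c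
cellVal-fillOf e (true ∷ b) g r c (inj₁ (refl , p)) = trans
  (cong₂ (λ z k → (if z then assoc (R (suc e) b) (Vec.map (λ r → g r (suc e)) (R (suc e) b)) r else 0) + k) (≡ᵇ-refl e)
    (cellVal-outside (suc e) b (fillOf g (suc e) b) r (suc e) (λ p → <-irrefl refl (Cell-lower (suc e) b (r , suc e) p))))
  (trans (+-identityʳ _) (assoc-map (R (suc e) b) (λ r → g r (suc e)) r (R-asc (suc e) b) p))
cellVal-fillOf e (true ∷ b) g r c (inj₂ p) rewrite ≢⇒≡ᵇ c (suc e) (>⇒≢ (Cell-lower (suc e) b (r , c) p)) =
  cellVal-fillOf (suc e) b g r c p
cellVal-fillOf e (false ∷ b) g r c p = cellVal-fillOf (suc e) b g r c p

range : ℕ → (n : ℕ) → Vec ℕ n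
range s zero = []
range s (suc n) = s ∷ range (suc s) n

vat-range : ∀ {A : Set} (f : ℕ → A) (h : A → ℕ) s n i → i < n → vat (Vec.map h (Vec.map f (range s n))) i ≡ h (f (s + i))
vat-range f h s (suc n) zero p = cong (λ z → h (f z)) (sym (+-identityʳ s))
vat-range f h s (suc n) (suc i) (s≤s p) = trans (vat-range f h (suc s) n i p) (cong (λ z → h (f z)) (sym (+-suc s i)))

vat-outside : ∀ {n} (xs : Vec ℕ n) i → vat xs i ≢ 0 → i < n
vat-outside [] i h = ⊥-elim (h refl)
vat-outside (x ∷ xs) zero h = s≤s z≤n
vat-outside (x ∷ xs) (suc i) h = s≤s (vat-outside xs i h)

vat-ext : ∀ {n} (f : ℕ → ℕ) (xs : Vec ℕ n) s → (∀ i → i < n → f (s + i) ≡ vat xs i) → Vec.map f (range s n) ≡ xs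
vat-ext f [] s h = refl
vat-ext f (x ∷ xs) s h = cong₂ _∷_ (trans (cong f (sym (+-identityʳ s))) (h 0 (s≤s z≤n)))
  (vat-ext f xs (suc s) (λ i p → trans (cong f (sym (+-suc s i))) (h (suc i) (s≤s p))))

matrix : ∀ N → (ℕ → ℕ → ℕ) → Vec (Vec ℕ N) N
matrix N g = Vec.map (λ r → Vec.map (g r) (range 1 N)) (range 1 N)

vat-id : ∀ {n} (xs : Vec ℕ n) i → vat (Vec.map (λ x → x) xs) i ≡ vat xs i
vat-id (x ∷ xs) zero = refl
vat-id [] i = refl
vat-id (x ∷ xs) (suc i) = vat-id xs i

mult-matrix : ∀ N g r c → r < N → c < N → mult (matrix N g) (suc r , suc c) ≡ g (suc r) (suc c)
mult-matrix N g r c p q = trans (vat-range (λ r → Vec.map (g r) (range 1 N)) (λ row → vat row c) 1 N r p)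
  (trans (sym (vat-id (Vec.map (g (suc r)) (range 1 N)) c)) (vat-range (g (suc r)) (λ x → x) 1 N c q))

column-outside : ∀ {m n} (M : Vec (Vec ℕ n) m) r c → vat (Vec.map (λ row → vat row c) M) r ≢ 0 → c < n
column-outside [] r c h = ⊥-elim (h refl)
column-outside (row ∷ M) zero c h = vat-outside row c h
column-outside (row ∷ M) (suc r) c h = column-outside M r c h

mult-range : ∀ {N} (M : Vec (Vec ℕ N) N) r c → mult M (r , c) ≢ 0 → (1 ≤ r × r ≤ N) × (1 ≤ c × c ≤ N)
mult-range M zero c h = ⊥-elim (h refl)
mult-range M (suc r) zero h = ⊥-elim (h refl)
mult-range M (suc r) (suc c) h = (s≤s z≤n , vat-outside (Vec.map (λ row → vat row c) M) r h) , (s≤s z≤n , column-outside M r c h)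

rows-ext : ∀ {m N} (g : ℕ → ℕ → ℕ) (M : Vec (Vec ℕ N) m) s →
  (∀ r c → r < m → c < N → g (s + r) (suc c) ≡ vat (Vec.map (λ row → vat row c) M) r) →
  Vec.map (λ r → Vec.map (g r) (range 1 N)) (range s m) ≡ M
rows-ext g [] s h = refl
rows-ext g (row ∷ M) s h = cong₂ _∷_
  (vat-ext (g s) row 1 (λ c p → trans (cong (λ z → g z (suc c)) (sym (+-identityʳ s))) (h 0 c (s≤s z≤n) p)))
  (rows-ext g M (suc s) (λ r c p q → trans (cong (λ z → g z (suc c)) (sym (+-suc s r))) (h (suc r) c (s≤s p) q)))

matrix-ext : ∀ {N} g (M : Vec (Vec ℕ N) N) → (∀ r c → 1 ≤ r → r ≤ N → 1 ≤ c → c ≤ N → g r c ≡ mult M (r , c)) → matrix N g ≡ M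
matrix-ext g M h = rows-ext g M 1 (λ r c p q → h (suc r) (suc c) (s≤s z≤n) p (s≤s z≤n) q)

sumR : ℕ → ℕ → (ℕ → ℕ) → ℕ
sumR s zero f = 0
sumR s (suc n) f = f s + sumR (suc s) n f

sumR-cong : ∀ s n {f g} → (∀ x → f x ≡ g x) → sumR s n f ≡ sumR s n g
sumR-cong s zero h = refl
sumR-cong s (suc n) h = cong₂ _+_ (h s) (sumR-cong (suc s) n h)

sum-range : ∀ s n f → Vec.sum (Vec.map f (range s n)) ≡ sumR s n f
sum-range s zero f = refl
sum-range s (suc n) f = cong (f s +_) (sum-range (suc s) n f)

interchange : ∀ a b c d → (a + b) + (c + d) ≡ (a + c) + (b + d)
interchange a b c d = begin
    a + b + (c + d) ≡⟨ +-assoc a b (c + d) ⟩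
    a + (b + (c + d)) ≡⟨ cong (a +_) (trans (sym (+-assoc b c d)) (trans (cong (_+ d) (+-comm b c)) (+-assoc c b d))) ⟩
    a + (c + (b + d)) ≡⟨ +-assoc a c (b + d) ⟨
    a + c + (b + d) ∎
  where open ≡-Reasoning

sumR-+ : ∀ s n f g → sumR s n (λ x → f x + g x) ≡ sumR s n f + sumR s n g
sumR-+ s zero f g = refl
sumR-+ s (suc n) f g = trans (cong (f s + g s +_) (sumR-+ (suc s) n f g)) (interchange (f s) (g s) _ _)

sumR-0 : ∀ s n → sumR s n (λ _ → 0) ≡ 0
sumR-0 s zero = refl
sumR-0 s (suc n) = sumR-0 (suc s) n

sumR-swap : ∀ s n t m (g : ℕ → ℕ → ℕ) → sumR s n (λ r → sumR t m (g r)) ≡ sumR t m (λ c → sumR s n (λ r → g r c))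
sumR-swap s zero t m g = sym (sumR-0 t m)
sumR-swap s (suc n) t m g = trans (cong (sumR t m (g s) +_) (sumR-swap (suc s) n t m g)) (sym (sumR-+ t m (g s) _))

sumR-before : ∀ s n y a → y < s → sumR s n (λ x → if x ≡ᵇ y then a else 0) ≡ 0
sumR-before s zero y a p = refl
sumR-before s (suc n) y a p rewrite ≢⇒≡ᵇ s y (>⇒≢ p) = sumR-before (suc s) n y a (m≤n⇒m≤1+n p)

sumR-delta : ∀ s n y a → s ≤ y → y < s + n → sumR s n (λ x → if x ≡ᵇ y then a else 0) ≡ a
sumR-delta s zero y a p q = ⊥-elim (<⇒≱ q (≤-trans (≤-reflexive (+-identityʳ s)) p))
sumR-delta s (suc n) y a p q = split (m≤n⇒m<n∨m≡n p)
  where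
  split : s < y ⊎ s ≡ y → (if s ≡ᵇ y then a else 0) + sumR (suc s) n (λ x → if x ≡ᵇ y then a else 0) ≡ a
  split (inj₁ p′) = cong₂ _+_ (cong (λ c → if c then a else 0) (≢⇒≡ᵇ s y (<⇒≢ p′)))
    (sumR-delta (suc s) n y a p′ (subst (y <_) (+-suc s n) q))
  split (inj₂ refl) = trans (cong₂ _+_ (cong (λ c → if c then a else 0) (≡ᵇ-refl s)) (sumR-before (suc s) n s a (n<1+n s)))
    (+-identityʳ a)

sumR-assoc : ∀ {n} N (xs as : Vec ℕ n) → (∀ {x} → x ∈ⱽ xs → 1 ≤ x × x ≤ N) → sumR 1 N (assoc xs as) ≡ Vec.sum as
sumR-assoc N [] [] h = sumR-0 1 N
sumR-assoc N (x ∷ xs) (a ∷ as) h = trans (sumR-+ 1 N (λ r → if r ≡ᵇ x then a else 0) (assoc xs as))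
  (cong₂ _+_ (sumR-delta 1 N x a (proj₁ (h (0 , here))) (s≤s (proj₂ (h (0 , here))))) (sumR-assoc N xs as (λ p → h (thereⱽ p))))

sum-cellVal : ∀ {n} N e (b : Bits n) f → e + n + n ≤ N → sumR 1 N (λ r → sumR 1 N (cellVal e b f r)) ≡ fdeg b f
sum-cellVal N e [] f p = trans (sumR-cong 1 N (λ _ → sumR-0 1 N)) (sumR-0 1 N)
sum-cellVal {suc n} N e (true ∷ b) (a , f) p = begin
    sumR 1 N (λ r → sumR 1 N (λ c → (if c ≡ᵇ suc e then A r else 0) + cellVal (suc e) b f r c))
      ≡⟨ sumR-cong 1 N (λ r → trans (sumR-+ 1 N _ (cellVal (suc e) b f r))
           (cong (_+ sumR 1 N (cellVal (suc e) b f r)) (sumR-delta 1 N (suc e) (A r) (s≤s z≤n) (s≤s (≤-trans (<⇒≤ (lo<hi e n)) p′))))) ⟩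
    sumR 1 N (λ r → A r + sumR 1 N (cellVal (suc e) b f r)) ≡⟨ sumR-+ 1 N A _ ⟩
    sumR 1 N A + sumR 1 N (λ r → sumR 1 N (cellVal (suc e) b f r))
      ≡⟨ cong₂ _+_ (sumR-assoc N (R (suc e) b) a (λ (i , q) → ≤-trans (s≤s z≤n) (R-lower (suc e) b q) , ≤-trans (R-upper (suc e) b q) p″))
           (sum-cellVal N (suc e) b f p″) ⟩
    Vec.sum a + fdeg b f ∎
  where
  open ≡-Reasoning
  A = assoc (R (suc e) b) a
  p′ : hi e n ≤ N
  p′ = subst (_≤ N) (hi-eq e n) p
  p″ : suc e + n + n ≤ N
  p″ = ≤-trans (n≤1+n _) p′
sum-cellVal {suc n} N e (false ∷ b) f p = sum-cellVal N (suc e) b f (≤-trans (n≤1+n _) (subst (_≤ N) (hi-eq e n) p))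

mdegree-matrix : ∀ N g → mdegree (matrix N g) ≡ sumR 1 N (λ r → sumR 1 N (g r))
mdegree-matrix N g = trans (cong Vec.sum (sym (VecP.map-∘ Vec.sum (λ r → Vec.map (g r) (range 1 N)) (range 1 N))))
  (trans (sum-range 1 N _) (sumR-cong 1 N (λ r → sum-range 1 N (g r))))

Cell-star : ∀ {n} d e (b : Bits n) r c → e + n ≡ d → Cell e b (r , c) → c < r × r < star d c
Cell-star {suc n} d e (true ∷ b) r c de (inj₁ (refl , i , p)) = R-lower (suc e) b p ,
  subst (r <_) (sym (Star.star-lo d e n de)) (s≤s (R-upper (suc e) b p))
Cell-star {suc n} d e (true ∷ b) r c de (inj₂ p) = Cell-star d (suc e) b r c (trans (sym (+-suc e n)) de) p
Cell-star {suc n} d e (false ∷ b) r c de p = Cell-star d (suc e) b r c (trans (sym (+-suc e n)) de) p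

Cell-intro : ∀ {n} d e (b : Bits n) {m} r c → e + n ≡ d → Agree e b m → e < c → c < r → r < star d c →
  m c ≡ true → m r ≡ false → Cell e b (r , c)
-- Here c > d, so c* ≤ d < c, against c < r < c*.
Cell-intro d e [] r c de a p q s mc mr = <-asym (<-trans q s)
  (≤-<-trans (≤-trans (∸-monoʳ-≤ (suc (d + d)) (subst (_< c) (trans (sym (+-identityʳ e)) de) p)) (≤-reflexive (m+n∸m≡n d d)))
    (subst (_< c) (trans (sym (+-identityʳ e)) de) p))
Cell-intro {suc n} d e (x ∷ b) r c de (u , v , a) p q s mc mr with m≤n⇒m<n∨m≡n p
Cell-intro {suc n} d e (true ∷ b) r c de (u , v , a) p q s mc mr | inj₁ p′ =
  inj₂ (Cell-intro d (suc e) b r c (trans (sym (+-suc e n)) de) a p′ q s mc mr)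
Cell-intro {suc n} d e (false ∷ b) r c de (u , v , a) p q s mc mr | inj₁ p′ =
  Cell-intro d (suc e) b r c (trans (sym (+-suc e n)) de) a p′ q s mc mr
Cell-intro {suc n} d e (true ∷ b) r c de (u , v , a) p q s mc mr | inj₂ refl =
  inj₁ (refl , ∈R⇐ (suc e) b a q (≤-pred (subst (r <_) (Star.star-lo d e n de) s)) mr)
Cell-intro {suc n} d e (false ∷ b) r c de (u , v , a) p q s mc mr | inj₂ refl = ⊥-elim (true≢false (trans (sym mc) u))

star-sym : ∀ d r c → c ≤ suc (d + d) → r < star d c → c < star d r
star-sym d r c c≤ p = m+n≤o⇒m≤o∸n (suc c) (subst (_≤ suc (d + d)) (trans (+-comm (suc r) c) (+-suc c r))
  (≤-trans (+-monoˡ-≤ c p) (≤-reflexive (m∸n+n≡m c≤))))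

module _ {d : ℕ} (b : Bits d) where
  entry : Fill b → Fill (comp b) → ℕ → ℕ → ℕ
  entry f g r c = cellVal 0 b f r c + cellVal 0 (comp b) g c r

  -- The cells of OR_v with r < c are those of ON for the complement of v, transposed.
  monomial : Fill b → Fill (comp b) → Monomial d
  monomial f g = matrix (d + d) (entry f g)

  upperFill : Monomial d → Fill b
  upperFill M = fillOf (λ r c → mult M (r , c)) 0 b

  lowerFill : Monomial d → Fill (comp b)
  lowerFill M = fillOf (λ r c → mult M (c , r)) 0 (comp b)

  inV : ℕ → Bool
  inV x = elemᵇ x (enc 0 b)

  av : Agree 0 b inV
  av = Agree-enc 0 b

  av′ : Agree 0 (comp b) (not ∘ inV)
  av′ = Agree-comp 0 b av

  exclusive : ∀ {r c} → Cell 0 b (r , c) → Cell 0 (comp b) (c , r) → ⊥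
  exclusive {r} {c} p q = <-asym (proj₁ (Cell-star d 0 b r c refl p)) (proj₁ (Cell-star d 0 (comp b) c r refl q))

  Cell⇒InON : ∀ {r c} → Cell 0 b (r , c) → InON d (enc 0 b) (r , c)
  Cell⇒InON {r} {c} p with Cell-bounds b (r , c) p | Cell-outside 0 b (r , c) {inV} av p | Cell-star d 0 b r c refl p
  ... | (rr , cc , _) | (vr , vc) | (lt , st) = ((rr , cc , elemᵇ⇒∉ _ vr , elemᵇ⇒∈ _ vc) , st) , lt

  Cell⇒InOR : ∀ {r c} → Cell 0 (comp b) (c , r) → InOR d (enc 0 b) (r , c)
  Cell⇒InOR {r} {c} p with Cell-bounds (comp b) (c , r) p | Cell-outside 0 (comp b) (c , r) {not ∘ inV} av′ p | Cell-star d 0 (comp b) c r refl p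
  ... | (cc , rr@(_ , r≤) , _) | (vc , vr) | (lt , st) =
    (rr , cc , elemᵇ⇒∉ _ (trans (sym (not-involutive _)) (cong not vr)) , elemᵇ⇒∈ _ (trans (sym (not-involutive _)) (cong not vc))) ,
    star-sym d c r (m≤n⇒m≤1+n r≤) st

  InON⇒Cell : ∀ {r c} → InON d (enc 0 b) (r , c) → Cell 0 b (r , c)
  InON⇒Cell {r} {c} (((_ , (p , _) , r∉ , c∈) , st) , lt) =
    Cell-intro d 0 b {inV} r c refl av p lt st (∈⇒elemᵇ c∈) (∉⇒elemᵇ _ r∉)

  InOR⇒Cell : ∀ {r c} → InOR d (enc 0 b) (r , c) → Cell 0 b (r , c) ⊎ Cell 0 (comp b) (c , r)
  InOR⇒Cell {r} {c} p@((( 1≤r , _) , (1≤c , c≤) , r∉ , c∈) , st) with <-cmp r c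
  ... | tri> _ _ lt = inj₁ (InON⇒Cell (p , lt))
  ... | tri≈ _ refl _ = ⊥-elim (r∉ c∈)
  ... | tri< lt _ _ = inj₂ (Cell-intro d 0 (comp b) {not ∘ inV} c r refl av′ 1≤r lt (star-sym d r c (m≤n⇒m≤1+n c≤) st)
          (cong not (∉⇒elemᵇ _ r∉)) (cong not (∈⇒elemᵇ c∈)))

  entry-upper : ∀ f g r c → Cell 0 b (r , c) → entry f g r c ≡ cellVal 0 b f r c
  entry-upper f g r c p = trans (cong (cellVal 0 b f r c +_) (cellVal-outside 0 (comp b) g c r (exclusive p))) (+-identityʳ _)

  entry-lower : ∀ f g r c → Cell 0 (comp b) (c , r) → entry f g r c ≡ cellVal 0 (comp b) g c r
  entry-lower f g r c p = cong (_+ cellVal 0 (comp b) g c r) (cellVal-outside 0 b f r c (λ q → exclusive q p))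

  mult-entry : ∀ f g r c → InRange d r → InRange d c → mult (monomial f g) (r , c) ≡ entry f g r c
  mult-entry f g (suc r) (suc c) (_ , p) (_ , q) = mult-matrix (d + d) (entry f g) r c p q

  mult-upper : ∀ f g r c → Cell 0 b (r , c) → mult (monomial f g) (r , c) ≡ cellVal 0 b f r c
  mult-upper f g r c p with Cell-bounds b (r , c) p
  ... | (rr , cc , _) = trans (mult-entry f g r c rr cc) (entry-upper f g r c p)

  mult-lower : ∀ f g r c → Cell 0 (comp b) (c , r) → mult (monomial f g) (r , c) ≡ cellVal 0 (comp b) g c r
  mult-lower f g r c p with Cell-bounds (comp b) (c , r) p
  ... | (cc , rr , _) = trans (mult-entry f g r c rr cc) (entry-lower f g r c p)

  upperFill-monomial : ∀ f g → upperFill (monomial f g) ≡ f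
  upperFill-monomial f g = trans (fillOf-cong 0 b (mult-upper f g)) (fillOf-cellVal 0 b f)

  lowerFill-monomial : ∀ f g → lowerFill (monomial f g) ≡ g
  lowerFill-monomial f g = trans (fillOf-cong 0 (comp b) (λ r c → mult-lower f g c r)) (fillOf-cellVal 0 (comp b) g)

  monomial-InOR : ∀ f g α → mult (monomial f g) α ≢ 0 → InOR d (enc 0 b) α
  monomial-InOR f g (r , c) h with mult-range (monomial f g) r c h
  ... | rr , cc = split (λ z → h (trans (mult-entry f g r c rr cc) z))
    where
    split : entry f g r c ≢ 0 → InOR d (enc 0 b) (r , c)
    split k with cellVal 0 b f r c in eq
    ... | suc _ = proj₁ (Cell⇒InON (cellVal-support 0 b f r c (λ z → 1+n≢0 (trans (sym eq) z))))
    ... | zero = Cell⇒InOR (cellVal-support 0 (comp b) g c r k)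

  monomial-fills : ∀ M → (∀ α → mult M α ≢ 0 → InOR d (enc 0 b) α) → monomial (upperFill M) (lowerFill M) ≡ M
  monomial-fills M h = matrix-ext (entry (upperFill M) (lowerFill M)) M (λ r c p q s t → eq r c)
    where
    upper : ∀ r c → Cell 0 b (r , c) → entry (upperFill M) (lowerFill M) r c ≡ mult M (r , c)
    upper r c p = trans (entry-upper (upperFill M) (lowerFill M) r c p) (cellVal-fillOf 0 b (λ r c → mult M (r , c)) r c p)
    lower : ∀ r c → Cell 0 (comp b) (c , r) → entry (upperFill M) (lowerFill M) r c ≡ mult M (r , c)
    lower r c p = trans (entry-lower (upperFill M) (lowerFill M) r c p) (cellVal-fillOf 0 (comp b) (λ r c → mult M (c , r)) c r p)
    eq : ∀ r c → entry (upperFill M) (lowerFill M) r c ≡ mult M (r , c)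
    eq r c with mult M (r , c) in e
    ... | suc k with InOR⇒Cell (h (r , c) (λ z → 1+n≢0 (trans (sym e) z)))
    ...   | inj₁ p = trans (upper r c p) e
    ...   | inj₂ p = trans (lower r c p) e
    eq r c | zero = cong₂ _+_ (zero-or (λ p → trans (sym (entry-upper (upperFill M) (lowerFill M) r c p)) (trans (upper r c p) e)) (cellVal-support 0 b (upperFill M) r c))
        (zero-or (λ p → trans (sym (entry-lower (upperFill M) (lowerFill M) r c p)) (trans (lower r c p) e)) (cellVal-support 0 (comp b) (lowerFill M) c r))
      where
      zero-or : ∀ {P : Set} {x} → (P → x ≡ 0) → (x ≢ 0 → P) → x ≡ 0
      zero-or {x = x} f k = zero-unless x (λ h → h , k h) (λ (h , p) → h (f p))

  mdegree-monomial : ∀ f g → mdegree (monomial f g) ≡ fdeg b f + fdeg (comp b) g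
  mdegree-monomial f g = begin
      mdegree (monomial f g) ≡⟨ mdegree-matrix N (entry f g) ⟩
      sumR 1 N (λ r → sumR 1 N (entry f g r))
        ≡⟨ sumR-cong 1 N (λ r → sumR-+ 1 N (cellVal 0 b f r) (λ c → cellVal 0 (comp b) g c r)) ⟩
      sumR 1 N (λ r → sumR 1 N (cellVal 0 b f r) + sumR 1 N (λ c → cellVal 0 (comp b) g c r)) ≡⟨ sumR-+ 1 N _ _ ⟩
      sumR 1 N (λ r → sumR 1 N (cellVal 0 b f r)) + sumR 1 N (λ r → sumR 1 N (λ c → cellVal 0 (comp b) g c r))
        ≡⟨ cong₂ _+_ (sum-cellVal N 0 b f ≤-refl)
             (trans (sumR-swap 1 N 1 N (λ r c → cellVal 0 (comp b) g c r)) (sum-cellVal N 0 (comp b) g ≤-refl)) ⟩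
      fdeg b f + fdeg (comp b) g ∎
    where
    open ≡-Reasoning
    N = d + d

-- Splitting a standard monomial at v

Dom? : ∀ {n} δ (u w : Bits n) → Dec (Dom δ u w)
Dom? δ [] [] = yes tt
Dom? δ (true ∷ u) (true ∷ w) = Dom? δ u w
Dom? δ (true ∷ u) (false ∷ w) = Dom? (suc δ) u w
Dom? zero (false ∷ u) (true ∷ w) = no (λ ())
Dom? (suc δ) (false ∷ u) (true ∷ w) = Dom? δ u w
Dom? δ (false ∷ u) (false ∷ w) = Dom? δ u w

xor-interchange : ∀ x y p q → (x xor y) xor (p xor q) ≡ (x xor p) xor (y xor q)
xor-interchange true true p q = sym (xor-annihilates-not p q)
xor-interchange true false p q = not-distribˡ-xor p q
xor-interchange false true p q = not-distribʳ-xor p q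
xor-interchange false false p q = refl

par-⊕ : ∀ {n} (u w : Bits n) → par (u ⊕ w) ≡ par u xor par w
par-⊕ [] [] = refl
par-⊕ (x ∷ u) (y ∷ w) = trans (cong ((x xor y) xor_) (par-⊕ u w)) (xor-interchange x y (par u) (par w))

comp-⊕ : ∀ {n} (u w : Bits n) → comp u ⊕ comp w ≡ u ⊕ w
comp-⊕ [] [] = refl
comp-⊕ (true ∷ u) (y ∷ w) = cong (not y ∷_) (comp-⊕ u w)
comp-⊕ (false ∷ u) (y ∷ w) = cong₂ _∷_ (not-involutive y) (comp-⊕ u w)

AllPairs-reverse : ∀ {A : Set} {S : A → A → Set} {xs} → AllPairs S xs → AllPairs (λ x y → S y x) (reverse xs)
AllPairs-reverse [] = []
AllPairs-reverse {S = S} {x ∷ xs} (p ∷ ps) = subst (AllPairs (λ x y → S y x)) (sym (unfold-reverse x xs))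
  (AllPairs.++⁺ (AllPairs-reverse ps) ([] ∷ []) (All.map (λ s → s ∷ []) (All.tabulate (λ m → All.lookup p (∈-reverse⁻ m)))))
  where
  ∈-reverse⁻ : ∀ {y} → y ∈ reverse xs → y ∈ xs
  ∈-reverse⁻ m = ∈-resp-↭ (↭-reverse xs) m

_⊒_ : ∀ {n} → Bits n → Bits n → Set
x ⊒ y = Dom 0 y x

⊒-trans : ∀ {n} {x y z : Bits n} → x ⊒ y → y ⊒ z → x ⊒ z
⊒-trans {x = x} {y} {z} p q = Dom-trans 0 0 z y x q p

module _ {n : ℕ} (b : Bits n) where
  Comparable : Bits n → Set
  Comparable β = (Dom 0 b β × β ≢ b) ⊎ (Dom 0 β b × β ≢ b)

  Valid : List (Bits n) → Set
  Valid βs = All (λ β → par (b ⊕ β) ≡ false) βs × Linked _⊒_ βs × All Comparable βs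

  Up? : ∀ β → Dec (Dom 0 b β)
  Up? = Dom? 0 b

  ups : List (Bits n) → List (Bits n)
  ups = filter Up?

  -- Complementing reverses the order; reversing the list makes it decreasing again.
  downs : List (Bits n) → List (Bits n)
  downs βs = reverse (map comp (filter (¬? ∘ Up?) βs))

  join : List (Bits n) → List (Bits n) → List (Bits n)
  join us ls = us ++ map comp (reverse ls)

  comp-map : ∀ (βs : List (Bits n)) → map comp (map comp βs) ≡ βs
  comp-map βs = trans (sym (map-∘ βs)) (trans (map-cong comp-comp βs) (map-id βs))

  comp-downs : ∀ βs → map comp (reverse (downs βs)) ≡ filter (¬? ∘ Up?) βs
  comp-downs βs = trans (cong (map comp) (reverse-involutive _)) (comp-map _)

  -- In a decreasing list no element above `b` can follow one that is not, so filtering cuts the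
  -- list in two.
  ups-++-downs : ∀ βs → AllPairs _⊒_ βs → All Comparable βs → filter Up? βs ++ filter (¬? ∘ Up?) βs ≡ βs
  ups-++-downs [] ap cs = refl
  ups-++-downs (β ∷ βs) (p ∷ ap) (c ∷ cs) with Up? β
  ... | yes u = cong (β ∷_) (ups-++-downs βs ap cs)
  ... | no nu = trans (cong (_++ β ∷ filter (¬? ∘ Up?) βs) (filter-none Up? low)) (cong (β ∷_) (filter-all (¬? ∘ Up?) low))
    where
    low : All (λ γ → ¬ Dom 0 b γ) βs
    low = All.map (λ {γ} q u → nu (Dom-trans 0 0 b γ β u q)) p

  join-split : ∀ βs → Valid βs → join (ups βs) (downs βs) ≡ βs
  join-split βs (_ , l , cs) = trans (cong (ups βs ++_) (comp-downs βs))
    (ups-++-downs βs (Linked.Linked⇒AllPairs (λ {x} {y} {z} → ⊒-trans {x = x} {y} {z}) l) cs)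

  filter-All : ∀ {P Q : Bits n → Set} (P? : ∀ β → Dec (P β)) {βs} → All Q βs → All (λ β → P β × Q β) (filter P? βs)
  filter-All P? {βs} qs = All.zip (All.all-filter P? βs , All.filter⁺ P? qs)

  ups-Multichain : ∀ βs → Valid βs → Multichain b (ups βs)
  ups-Multichain βs (e , l , cs) =
    All.map (λ (u , p , c) → u , distinct c , p) (filter-All Up? (All.zip (e , cs))) ,
    Linked.filter⁺ Up? (λ {x} {y} {z} → ⊒-trans {x = x} {y} {z}) l
    where
    distinct : ∀ {β} → Comparable β → β ≢ b
    distinct (inj₁ (_ , ne)) = ne
    distinct (inj₂ (_ , ne)) = ne

  comp-injective : ∀ {u w : Bits n} → comp u ≡ comp w → u ≡ w
  comp-injective {u} {w} e = trans (sym (comp-comp u)) (trans (cong comp e) (comp-comp w))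

  downs-Multichain : ∀ βs → Valid βs → Multichain (comp b) (downs βs)
  downs-Multichain βs (e , l , cs) =
    All.tabulate (λ m → All.lookup above (∈-resp-↭ (↭-reverse _) m)) ,
    Linked.AllPairs⇒Linked (AllPairs-reverse (AllPairs.map⁺ (AllPairs.map (λ {x} {y} q → Dom-not 0 y x q)
      (AllPairs.filter⁺ (¬? ∘ Up?) (Linked.Linked⇒AllPairs (λ {x} {y} {z} → ⊒-trans {x = x} {y} {z}) l)))))
    where
    conv : ∀ {β} → ¬ Dom 0 b β × par (b ⊕ β) ≡ false × Comparable β → Above (comp b) (comp β)
    conv (nu , p , inj₁ (u , _)) = ⊥-elim (nu u)
    conv {β} (nu , p , inj₂ (u , ne)) = Dom-not 0 β b u , (λ eq → ne (comp-injective eq)) , trans (cong par (comp-⊕ b β)) p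
    above : All (Above (comp b)) (map comp (filter (¬? ∘ Up?) βs))
    above = All.map⁺ (All.map (λ {β} → conv {β}) (filter-All (¬? ∘ Up?) (All.zip (e , cs))))

  lower-part : ∀ ls → Multichain (comp b) ls →
    All (λ β → (Dom 0 β b × β ≢ b) × par (b ⊕ β) ≡ false) (map comp (reverse ls)) × AllPairs _⊒_ (map comp (reverse ls))
  lower-part ls (as , l) =
    All.map⁺ (All.tabulate (λ m → conv (All.lookup as (∈-resp-↭ (↭-reverse ls) m)))) ,
    AllPairs.map⁺ (AllPairs.map (λ {x} {y} q → Dom-not 0 x y q) (AllPairs-reverse
      (Linked.Linked⇒AllPairs (λ {x} {y} {z} → ⊒-trans {x = x} {y} {z}) l)))
    where
    conv : ∀ {β} → Above (comp b) β → (Dom 0 (comp β) b × comp β ≢ b) × par (b ⊕ comp β) ≡ false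
    conv {β} (u , ne , p) = (subst (Dom 0 (comp β)) (comp-comp b) (Dom-not 0 (comp b) β u) ,
      (λ eq → ne (trans (sym (comp-comp β)) (cong comp eq)))) ,
      trans (cong par (trans (sym (comp-⊕ b (comp β))) (cong (comp b ⊕_) (comp-comp β)))) p

  down-not-up : ∀ {β} → Dom 0 β b × β ≢ b → ¬ Dom 0 b β
  down-not-up {β} (q , ne) u = ne (Dom-antisym β b q u)

  module _ (us ls : List (Bits n)) (mu : Multichain b us) (ml : Multichain (comp b) ls) where
    private
      lowers = map comp (reverse ls)
      down : All (λ β → ¬ Dom 0 b β) lowers
      down = All.map (λ {β} (q , _) → down-not-up {β} q) (proj₁ (lower-part ls ml))
      up : All (Dom 0 b) us
      up = All.map proj₁ (proj₁ mu)

    ups-join : ups (join us ls) ≡ us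
    ups-join = trans (filter-++ Up? us lowers) (trans (cong₂ _++_ (filter-all Up? up) (filter-none Up? down)) (++-identityʳ us))

    downs-join : downs (join us ls) ≡ ls
    downs-join = trans (cong (λ z → reverse (map comp z)) (trans (filter-++ (¬? ∘ Up?) us lowers)
        (cong₂ _++_ (filter-none (¬? ∘ Up?) (All.map (λ u k → k u) up)) (filter-all (¬? ∘ Up?) down))))
      (trans (cong reverse (comp-map (reverse ls))) (reverse-involutive ls))

    join-Valid : Valid (join us ls)
    join-Valid = All.++⁺ (All.map (proj₂ ∘ proj₂) (proj₁ mu)) (All.map proj₂ (proj₁ (lower-part ls ml))) ,
      Linked.AllPairs⇒Linked (AllPairs.++⁺ (Linked.Linked⇒AllPairs (λ {x} {y} {z} → ⊒-trans {x = x} {y} {z}) (proj₂ mu)) (proj₂ (lower-part ls ml))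
        (All.map (λ {β} u → All.map (λ {γ} ((q , _) , _) → Dom-trans 0 0 γ b β q u) (proj₁ (lower-part ls ml))) up)) ,
      All.++⁺ (All.map (λ (u , ne , _) → inj₁ (u , ne)) (proj₁ mu)) (All.map (inj₂ ∘ proj₁) (proj₁ (lower-part ls ml)))

    -- If nothing lies above v, the head of the list is below v, hence below w because v ≤ w.
    join-Below : ∀ {w} → Dom 0 b w → Below w us → Below w (join us ls)
    join-Below {w} bw bu = go us bu (All.map proj₁ (proj₁ (lower-part ls ml)))
      where
      go : ∀ us → Below w us → ∀ {Y} → All (λ β → Dom 0 β b × β ≢ b) Y → Below w (us ++ Y)
      go [] _ [] = tt
      go [] _ {β ∷ _} ((q , _) ∷ _) = Dom-trans 0 0 β b w q bw
      go (β ∷ us) q _ = q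

  ups-Below : ∀ {w} βs → Linked _⊒_ βs → Below w βs → Below w (ups βs)
  ups-Below {w} βs l q = go (filter Up? βs) (All.filter⁺ Up? (all βs l q))
    where
    all : ∀ βs → Linked _⊒_ βs → Below w βs → All (λ β → Dom 0 β w) βs
    all [] l q = []
    all (β ∷ []) l q = q ∷ []
    all (β ∷ γ ∷ βs) (r ∷ l) q = q ∷ all (γ ∷ βs) l (Dom-trans 0 0 γ β w r q)
    go : ∀ γs → All (λ β → Dom 0 β w) γs → Below w γs
    go [] _ = tt
    go (γ ∷ _) (p ∷ _) = p

  degrees-join : ∀ us ls → degrees b (join us ls) ≡ degrees b us + degrees (comp b) ls
  degrees-join us ls = trans (cong sum (map-++ h us lowers)) (trans (sum-++ (map h us) (map h lowers)) (cong (degrees b us +_)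
    (trans (cong sum (trans (sym (map-∘ (reverse ls))) (trans (map-cong h-comp (reverse ls)) (reverse-map h′ ls)))) (sum-↭ (↭-reverse (map h′ ls))))))
    where
    lowers = map comp (reverse ls)
    h h′ : Bits n → ℕ
    h β = ⌊ ones (b ⊕ β) /2⌋
    h′ β = ⌊ ones (comp b ⊕ β) /2⌋
    h-comp : ∀ β → h (comp β) ≡ h′ β
    h-comp β = cong (λ z → ⌊ ones z /2⌋) (trans (sym (comp-⊕ b (comp β))) (cong (comp b ⊕_) (comp-comp β)))

-- The bijection for v and w given by bits

module _ {d : ℕ} (b w : Bits d) (m : ℕ) (be : par (comp b) ≡ false) (we : par (comp w) ≡ false) (bw : Dom 0 b w) where
  Source : List (List ℕ) → Set
  Source θs = StandardMonomial d θs × WDominated (enc 0 w) θs × VCompatible (enc 0 b) θs × degree (enc 0 b) θs ≡ m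

  Target : Monomial d → Set
  Target M = OMonomial d (enc 0 b) m M × ODominates d (enc 0 b) (enc 0 w) M

  -- The number of entries of v exceeding d is even, so parity in I(d) is the same as parity
  -- relative to `b`.
  par-rel : ∀ β → par (comp β) ≡ par (b ⊕ β)
  par-rel β = trans (cong (_xor par (comp β)) (sym be)) (trans (sym (par-⊕ (comp b) (comp β))) (cong par (comp-⊕ b β)))

  decs : List (List ℕ) → List (Bits d)
  decs = map (dec d)

  encs : List (Bits d) → List (List ℕ)
  encs = map (enc 0)

  encs-decs : ∀ θs → All (InI d) θs → θs ≡ encs (decs θs)
  encs-decs [] [] = refl
  encs-decs (θ ∷ θs) (p ∷ ps) = cong₂ _∷_ (InI-enc p) (encs-decs θs ps)

  decs-encs : ∀ βs → decs (encs βs) ≡ βs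
  decs-encs βs = trans (sym (map-∘ βs)) (trans (map-cong dec-enc βs) (map-id βs))

  enc-injective : ∀ (β γ : Bits d) → enc 0 β ≡ enc 0 γ → β ≡ γ
  enc-injective β γ e = trans (sym (dec-enc β)) (trans (cong (dec d) e) (dec-enc γ))

  degree-encs : ∀ βs → degree (enc 0 b) (encs βs) ≡ degrees b βs
  degree-encs βs = cong sum (trans (sym (map-∘ βs)) (map-cong (λ β → cong ⌊_/2⌋ (diffCard-enc b β)) βs))

  BitSource : List (Bits d) → Set
  BitSource βs = Valid b βs × Below w βs × degrees b βs ≡ m

  to-bits : ∀ βs → Source (encs βs) → BitSource βs
  to-bits βs ((is , l) , wd , vc , dg) =
    (All.map (λ {β} i → trans (sym (par-rel β)) (trans (cong (λ γ → par (comp γ)) (sym (dec-enc β))) (InI-par i))) (All.map⁻ is) ,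
     Linked.map (λ {x} {y} → ≼⇒Dom y x) (Linked.map⁻ l) ,
     All.map (λ {β} → Sum.map (λ (p , ne) → ≼⇒Dom b β p , (λ e → ne (cong (enc 0) (sym e)))) (λ (p , ne) → ≼⇒Dom β b p , (λ e → ne (cong (enc 0) e)))) (All.map⁻ vc)) ,
    below βs wd , trans (sym (degree-encs βs)) dg
    where
    below : ∀ βs → WDominated (enc 0 w) (encs βs) → Below w βs
    below [] _ = tt
    below (β ∷ _) p = ≼⇒Dom β w p

  from-bits : ∀ βs → BitSource βs → Source (encs βs)
  from-bits βs ((e , l , c) , bl , dg) =
    (All.map⁺ (All.map (λ {β} p → enc-InI β (trans (par-rel β) p)) e) , Linked.map⁺ (Linked.map (λ {x} {y} → Dom⇒≼ y x) l)) ,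
    below βs bl ,
    All.map⁺ (All.map (λ {β} → Sum.map (λ (p , ne) → Dom⇒≼ b β p , (λ q → ne (enc-injective β b (sym q)))) (λ (p , ne) → Dom⇒≼ β b p , (λ q → ne (enc-injective β b q)))) c) ,
    trans (degree-encs βs) dg
    where
    below : ∀ βs → Below w βs → WDominated (enc 0 w) (encs βs)
    below [] _ = tt
    below (β ∷ _) p = Dom⇒≼ β w p

  toMonomial : List (Bits d) → Monomial d
  toMonomial βs = monomial b (Psi b (ups b βs)) (Psi (comp b) (downs b βs))

  headOr-Below : ∀ us → Below w us → Dom 0 (headOr b us) w
  headOr-Below [] _ = bw
  headOr-Below (β ∷ _) p = p

  Below-headOr : ∀ us → Dom 0 (headOr b us) w → Below w us
  Below-headOr [] _ = tt
  Below-headOr (β ∷ _) p = p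

  -- A chain in the support of M, swept alone, stays below the sweep of M. Chains lie in ON_v, which
  -- is why only `upperFill` enters.
  dominates : ∀ M → Dom 0 (top b (upperFill b M)) w → ODominates d (enc 0 b) (enc 0 w) M
  dominates M p C (l , on) nz = subst (_≼ enc 0 w) (sym (wOf-top b C l cells))
    (Dom⇒≼ (top b (fillOf (ind C) 0 b)) w (Dom-trans 0 0 (top b (fillOf (ind C) 0 b)) (top b (upperFill b M)) w (top-mono b (λ r c → ind-support {λ r c → mult M (r , c) ≢ 0} C r c nz)) p))
    where cells = All.map (λ { {_ , _} → InON⇒Cell b }) on

  dominated : ∀ M → ODominates d (enc 0 b) (enc 0 w) M → Dom 0 (top b (upperFill b M)) w
  dominated M h = top-chains (λ r c → mult M (r , c)) b w (trans (sym (par-rel w)) we) (λ C l cells nz →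
    ≼⇒Dom (top b (fillOf (ind C) 0 b)) w (subst (_≼ enc 0 w) (wOf-top b C l cells) (h C (l , All.map (λ { {_ , _} → Cell⇒InON b }) cells) nz)))

  toMonomial-Target : ∀ βs → BitSource βs → Target (toMonomial βs)
  toMonomial-Target βs (va , bl , dg) =
    (monomial-InOR b _ _ ,
     trans (mdegree-monomial b _ _) (trans (cong₂ _+_ (fdeg-Psi b us (ups-Multichain b βs va)) (fdeg-Psi (comp b) ls (downs-Multichain b βs va)))
       (trans (sym (degrees-join b us ls)) (trans (cong (degrees b) (join-split b βs va)) dg)))) ,
    dominates (toMonomial βs) (subst (λ f → Dom 0 (top b f) w) (sym (upperFill-monomial b _ _))
      (subst (λ β → Dom 0 β w) (sym (top-Psi b us (ups-Multichain b βs va)))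
        (headOr-Below us (ups-Below b βs (proj₁ (proj₂ va)) bl))))
    where
    us = ups b βs
    ls = downs b βs

  toMonomial-injective : ∀ βs γs → BitSource βs → BitSource γs → toMonomial βs ≡ toMonomial γs → βs ≡ γs
  toMonomial-injective βs γs (va , _) (va′ , _) e = trans (sym (join-split b βs va)) (trans (cong₂ (join b)
      (Psi-injective b _ _ (ups-Multichain b βs va) (ups-Multichain b γs va′)
        (trans (sym (upperFill-monomial b _ _)) (trans (cong (upperFill b) e) (upperFill-monomial b _ _))))
      (Psi-injective (comp b) _ _ (downs-Multichain b βs va) (downs-Multichain b γs va′)
        (trans (sym (lowerFill-monomial b (Psi b (ups b βs)) _)) (trans (cong (lowerFill b) e) (lowerFill-monomial b (Psi b (ups b γs)) _)))))
    (join-split b γs va′))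

  toMonomial-surjective : ∀ M → Target M → Σ (List (Bits d)) λ βs → BitSource βs × toMonomial βs ≡ M
  toMonomial-surjective M ((or , dg) , od)
    with Psi-surjective b (upperFill b M) | Psi-surjective (comp b) (lowerFill b M)
  ... | us , mu , eu | ls , ml , el = join b us ls ,
    (join-Valid b us ls mu ml ,
     join-Below b us ls mu ml {w} bw (Below-headOr us (subst (λ β → Dom 0 β w) (trans (cong (top b) (sym eu)) (top-Psi b us mu)) (dominated M od))) ,
     trans (degrees-join b us ls) (trans (cong₂ _+_ (sym (trans (cong (fdeg b) (sym eu)) (fdeg-Psi b us mu)))
        (sym (trans (cong (fdeg (comp b)) (sym el)) (fdeg-Psi (comp b) ls ml))))
       (trans (sym (mdegree-monomial b _ _)) (trans (cong mdegree (monomial-fills b M or)) dg)))) ,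
    trans (cong₂ (monomial b) (trans (cong (Psi b) (ups-join b us ls mu ml)) eu) (trans (cong (Psi (comp b)) (downs-join b us ls mu ml)) el))
      (monomial-fills b M or)

  bijection : SetBijection Source Target
  bijection = (λ θs → toMonomial (decs θs)) ,
    (λ θs s → toMonomial-Target (decs θs) (bits θs s)) ,
    (λ θs ηs s t e → trans (encs-decs θs (proj₁ (proj₁ s))) (trans (cong encs
      (toMonomial-injective (decs θs) (decs ηs) (bits θs s) (bits ηs t) e)) (sym (encs-decs ηs (proj₁ (proj₁ t)))))) ,
    λ M t → let (βs , s , e) = toMonomial-surjective M t in
      encs βs , from-bits βs s , trans (cong toMonomial (decs-encs βs)) e
    where
    bits : ∀ θs → Source θs → BitSource (decs θs)
    bits θs s = to-bits (decs θs) (subst Source (encs-decs θs (proj₁ (proj₁ s))) s)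

theorem3p3 : (d : ℕ) (v w : List ℕ) (m : ℕ) →
    InI d v → InI d w → v ≼ w →
    SetBijection
    (λ (θs : List (List ℕ)) →
    StandardMonomial d θs × WDominated w θs × VCompatible v θs × degree v θs ≡ m)
    (λ (M : Monomial d) → OMonomial d v m M × ODominates d v w M)
theorem3p3 d v w m iv iw v≼w = subst₂
  (λ v w → SetBijection
    (λ (θs : List (List ℕ)) → StandardMonomial d θs × WDominated w θs × VCompatible v θs × degree v θs ≡ m)
    (λ (M : Monomial d) → OMonomial d v m M × ODominates d v w M))
  (sym (InI-enc iv)) (sym (InI-enc iw))
  (bijection (dec d v) (dec d w) m (InI-par iv) (InI-par iw) (≼⇒Dom (dec d v) (dec d w) (subst₂ _≼_ (InI-enc iv) (InI-enc iw) v≼w)))
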